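{- Let $G$ be a nonabelian finite group and let $S\subseteq G$ be inverse-closed ($S=S^{ -1}$) and not contain the identity. Then the Cayley graph $X=\Gamma(G,S)$ does not have average uniform mixing; that is, $\widehat{M}_X\ne\frac1{|G|}J_{|G|}$.
   Context: The Cayley graph $\Gamma(G,S)$ has vertex set $G$, with $g$ adjacent to $sg$ for each $g\in G$ and $s\in S$; its adjacency matrix is $A=\sum_{s\in S}R(s)$, where $R$ is the left-regular representation of $G$. For a graph $X$ of order $n$ with Hermitian adjacency matrix $A$, let $U_X(t)=e^{ -itA}$ and $M_X(t)=U_X(t)\circ\overline{U_X(t)}$ (entrywise product). The average mixing matrix is $\widehat{M}_X=\lim_{T\to\infty}\frac1T\int_0^TM_X(t)\,dt$. $X$ has average uniform mixing if $\widehat{M}_X=\frac1nJ_n$, where $J_n$ is the $n\times n$ all-one matrix. -}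

module Defs where

open import Algebra.Apartness.Bundles using (HeytingField)
open import Algebra.Bundles using (Group)
open import Algebra.Bundles.Raw using (RawSemiring; RawRing)
import Algebra.Definitions
import Algebra.Definitions.RawSemiring
open import Data.Bool.Base using (if_then_else_)
open import Data.Fin.Base as Fin using (Fin; toℕ; fromℕ; inject₁)
open import Data.Fin.Properties using (nonZeroIndex) renaming (_≟_ to _≟ᶠ_)
open import Data.Fin.Subset using (Subset; _∈_)
open import Data.Nat.Base as ℕ using (ℕ; zero; suc; NonZero; _!)
open import Data.Nat.Properties using (_!≢0)
open import Data.Product.Base using (Σ-syntax; ∃-syntax; _×_; proj₁)
open import Data.Sum.Base using (_⊎_)
open import Data.Vec.Base using (lookup)
open import Function.Bundles using (Inverse)
open import Level using (_⊔_) renaming (suc to lsuc)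
open import Relation.Binary.Core using (Rel)
open import Relation.Binary.PropositionalEquality.Properties using () renaming (setoid to ≡-setoid)
open import Relation.Binary.Structures using (IsStrictPartialOrder)
open import Relation.Nullary.Decidable.Core using (⌊_⌋)
open import Relation.Nullary.Negation.Core using (¬_)

-- The Cauchy-complete Archimedean ordered fields.  Up to isomorphism ℝ is the
-- only one, so quantifying over this record is quantifying over presentations
-- of ℝ.  The axioms are the constructive ones (apartness instead of decidable
-- equality, no trichotomy); classically they are the usual axioms of ℝ.
record RealNumbers c ℓ₁ ℓ₂ : Set (lsuc (c ⊔ ℓ₁ ⊔ ℓ₂)) where
  infix 4 _<_ _≤_ ∣_∣<_
  field
    heytingField : HeytingField c ℓ₁ ℓ₂

  open HeytingField heytingField public

  rawRing : RawRing c ℓ₁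
  rawRing = record
    { _≈_ = _≈_ ; _+_ = _+_ ; _*_ = _*_ ; -_ = -_ ; 0# = 0# ; 1# = 1# }

  open Algebra.Definitions.RawSemiring (RawRing.rawSemiring rawRing) public
    using (sum) renaming (_×_ to _×ℕ_)

  fromNat : ℕ → Carrier
  fromNat n = n ×ℕ 1#

  field
    _<_                  : Rel Carrier ℓ₂
    isStrictPartialOrder : IsStrictPartialOrder _≈_ _<_
    <⇒#                  : ∀ {x y} → x < y → x # y
    #⇒<⊎>                : ∀ {x y} → x # y → x < y ⊎ y < x
    0<1                  : 0# < 1#
    +-monoˡ-<            : ∀ {x y} z → x < y → x + z < y + z
    *-pos                : ∀ {x y} → 0# < x → 0# < y → 0# < x * y
    archimedean          : ∀ x → ∃[ n ] x < fromNat n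

  module <-Order = IsStrictPartialOrder isStrictPartialOrder

  _≤_ : Rel Carrier ℓ₂
  x ≤ y = ¬ (y < x)

  ∣_∣<_ : Rel Carrier ℓ₂
  ∣ x ∣< ε = - ε < x × x < ε

  IsCauchy : (ℕ → Carrier) → Set (c ⊔ ℓ₂)
  IsCauchy s = ∀ ε → 0# < ε →
    ∃[ N ] (∀ m n → N ℕ.≤ m → N ℕ.≤ n → ∣ s m - s n ∣< ε)

  infix 4 _⟶_
  _⟶_ : (ℕ → Carrier) → Carrier → Set (c ⊔ ℓ₂)
  s ⟶ l = ∀ ε → 0# < ε → ∃[ N ] (∀ n → N ℕ.≤ n → ∣ s n - l ∣< ε)

  field
    complete : ∀ s → IsCauchy s → ∃[ l ] s ⟶ l

  -- The inverse supplied by the Heyting field is that of x - 0#.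
  recip : ∀ x → 0# < x → Carrier
  recip x 0<x = proj₁ (#⇒invertible (#-sym (<⇒# 0<x)))

  0<fromNat : ∀ n .{{_ : NonZero n}} → 0# < fromNat n
  0<fromNat (suc zero)    = <-Order.<-respʳ-≈ (sym (+-identityʳ 1#)) 0<1
  0<fromNat (suc (suc n)) =
    <-Order.trans (0<fromNat (suc n))
      (<-Order.<-respˡ-≈ (+-identityˡ _) (+-monoˡ-< (fromNat (suc n)) 0<1))

  1/_ : ∀ n .{{_ : NonZero n}} → Carrier
  1/ n = recip (fromNat n) (0<fromNat n)

module _ {c ℓ₁ ℓ₂} (R : RealNumbers c ℓ₁ ℓ₂) where
  open RealNumbers R using (_≈_; _+_; _*_; -_; _-_; 0#; 1#; _<_; _≤_; ∣_∣<_;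
                            _⟶_; recip; 1/_)
    renaming (Carrier to ℝ; sum to sumℝ)

  record TaggedPartition (a b : ℝ) : Set (c ⊔ ℓ₁ ⊔ ℓ₂) where
    field
      pieces    : ℕ
      point     : Fin (suc pieces) → ℝ
      tag       : Fin pieces → ℝ
      start     : point Fin.zero ≈ a
      end       : point (fromℕ pieces) ≈ b
      point≤tag : ∀ k → point (inject₁ k) ≤ tag k
      tag≤point : ∀ k → tag k ≤ point (Fin.suc k)

    width : Fin pieces → ℝ
    width k = point (Fin.suc k) - point (inject₁ k)

    Finer : ℝ → Set ℓ₂
    Finer δ = ∀ k → width k < δ

    riemannSum : (ℝ → ℝ) → ℝ
    riemannSum f = sumℝ (λ k → f (tag k) * width k)

  HasRealIntegral : (ℝ → ℝ) → ℝ → ℝ → ℝ → Set (c ⊔ ℓ₁ ⊔ ℓ₂)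
  HasRealIntegral f a b I = ∀ ε → 0# < ε → ∃[ δ ] (0# < δ ×
    ((P : TaggedPartition a b) → TaggedPartition.Finer P δ →
      ∣ TaggedPartition.riemannSum P f - I ∣< ε))

  -- Functions of T > 0 may use the positivity proof, as T ↦ 1/T does.
  RealLimitAtInfinity : ((T : ℝ) → 0# < T → ℝ) → ℝ → Set (c ⊔ ℓ₂)
  RealLimitAtInfinity f l = ∀ ε → 0# < ε →
    ∃[ T₀ ] (∀ T (0<T : 0# < T) → T₀ < T → ∣ f T 0<T - l ∣< ε)

  record ℂ : Set c where
    constructor _+i_
    field
      re im : ℝ

  open ℂ public

  ℂ-rawRing : RawRing c ℓ₁
  ℂ-rawRing = record
    { Carrier = ℂ
    ; _≈_     = λ z w → re z ≈ re w × im z ≈ im w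
    ; _+_     = λ z w → (re z + re w) +i (im z + im w)
    ; _*_     = λ z w → (re z * re w - im z * im w) +i (re z * im w + im z * re w)
    ; -_      = λ z → (- re z) +i (- im z)
    ; 0#      = 0# +i 0#
    ; 1#      = 1# +i 0#
    }

  open RawRing ℂ-rawRing using ()
    renaming (_≈_ to _≈ᶜ_; _+_ to _+ᶜ_; _*_ to _*ᶜ_; -_ to -ᶜ_; 0# to 0ᶜ; 1# to 1ᶜ)
  open Algebra.Definitions.RawSemiring (RawRing.rawSemiring ℂ-rawRing) using ()
    renaming (sum to sumᶜ)

  conj : ℂ → ℂ
  conj z = re z +i (- im z)

  real : ℝ → ℂ
  real x = x +i 0#

  𝕚 : ℂ
  𝕚 = 0# +i 1#

  HasIntegral : (ℝ → ℂ) → ℝ → ℝ → ℂ → Set (c ⊔ ℓ₁ ⊔ ℓ₂)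
  HasIntegral f a b I = HasRealIntegral (λ t → re (f t)) a b (re I)
                      × HasRealIntegral (λ t → im (f t)) a b (im I)

  LimitAtInfinity : ((T : ℝ) → 0# < T → ℂ) → ℂ → Set (c ⊔ ℓ₂)
  LimitAtInfinity f l = RealLimitAtInfinity (λ T 0<T → re (f T 0<T)) (re l)
                      × RealLimitAtInfinity (λ T 0<T → im (f T 0<T)) (im l)

  Matrix : ℕ → Set c
  Matrix n = Fin n → Fin n → ℂ

  Matrix-rawSemiring : ℕ → RawSemiring c ℓ₁
  Matrix-rawSemiring n = record
    { Carrier = Matrix n
    ; _≈_     = λ A B → ∀ i j → A i j ≈ᶜ B i j
    ; _+_     = λ A B i j → A i j +ᶜ B i j
    ; _*_     = λ A B i j → sumᶜ (λ k → A i k *ᶜ B k j)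
    ; 0#      = λ _ _ → 0ᶜ
    ; 1#      = λ i j → if ⌊ i ≟ᶠ j ⌋ then 1ᶜ else 0ᶜ
    }

  module Mat {n : ℕ} where
    open RawSemiring (Matrix-rawSemiring n) public
      using () renaming (_≈_ to _≈ᴹ_; 0# to 0ᴹ)
    open Algebra.Definitions.RawSemiring (Matrix-rawSemiring n) public
      using (_^_) renaming (sum to sumᴹ)

  open Mat

  infixr 7 _•_
  _•_ : ∀ {n} → ℂ → Matrix n → Matrix n
  (z • A) i j = z *ᶜ A i j

  _∘ᴴ_ : ∀ {n} → Matrix n → Matrix n → Matrix n
  (A ∘ᴴ B) i j = A i j *ᶜ B i j

  conjᴹ : ∀ {n} → Matrix n → Matrix n
  conjᴹ A i j = conj (A i j)

  allOnes : ∀ n → Matrix n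
  allOnes n _ _ = 1ᶜ

  expPartialSum : ∀ {n} → Matrix n → ℕ → Matrix n
  expPartialSum B N =
    sumᴹ (λ (k : Fin N) → real (1/_ (toℕ k !) {{toℕ k !≢0}}) • B ^ toℕ k)

  IsExp : ∀ {n} → Matrix n → Matrix n → Set (c ⊔ ℓ₂)
  IsExp B E = ∀ i j → (λ N → re (expPartialSum B N i j)) ⟶ re (E i j)
                    × (λ N → im (expPartialSum B N i j)) ⟶ im (E i j)

  IsTransitionMatrix : ∀ {n} → Matrix n → (ℝ → Matrix n) → Set (c ⊔ ℓ₂)
  IsTransitionMatrix A U = ∀ t → IsExp (-ᶜ (𝕚 *ᶜ real t) • A) (U t)

  mixingMatrix : ∀ {n} → (ℝ → Matrix n) → ℝ → Matrix n
  mixingMatrix U t = U t ∘ᴴ conjᴹ (U t)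

  IsLongTimeAverage : (ℝ → ℂ) → ℂ → Set (c ⊔ ℓ₁ ⊔ ℓ₂)
  IsLongTimeAverage f m =
    Σ[ I ∈ ((T : ℝ) → 0# < T → ℂ) ]
      (∀ T (0<T : 0# < T) → HasIntegral f 0# T (I T 0<T))
      × LimitAtInfinity (λ T 0<T → real (recip T 0<T) *ᶜ I T 0<T) m

  -- Exponentials, integrals and limits are unique when they exist, so there is
  -- at most one such M̂ up to equality of matrices.
  IsAverageMixingMatrix : ∀ {n} → Matrix n → Matrix n → Set (c ⊔ ℓ₁ ⊔ ℓ₂)
  IsAverageMixingMatrix {n} A M̂ =
    Σ[ U ∈ (ℝ → Matrix n) ] IsTransitionMatrix A U
      × (∀ i j → IsLongTimeAverage (λ t → mixingMatrix U t i j) (M̂ i j))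

  HasAverageUniformMixing : ∀ {n} .{{_ : NonZero n}} → Matrix n → Set (c ⊔ ℓ₁ ⊔ ℓ₂)
  HasAverageUniformMixing {n} A =
    Σ[ M̂ ∈ Matrix n ] IsAverageMixingMatrix A M̂
      × M̂ ≈ᴹ (real (1/ n) • allOnes n)

record FiniteGroup g ℓ : Set (lsuc (g ⊔ ℓ)) where
  field
    group       : Group g ℓ
    order       : ℕ
    enumeration : Inverse (≡-setoid (Fin order)) (Group.setoid group)

  open Group group public

  element : Fin order → Carrier
  element = Inverse.to enumeration

  index : Carrier → Fin order
  index = Inverse.from enumeration

  instance
    order-nonZero : NonZero order
    order-nonZero = nonZeroIndex (index ε)

  Nonabelian : Set (g ⊔ ℓ)
  Nonabelian = ¬ Commutative _∙_
    where open Algebra.Definitions _≈_ using (Commutative)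

  -- Subsets of the group are given through the enumeration.
  infix 4 _∈ᴳ_ _∉ᴳ_
  _∈ᴳ_ _∉ᴳ_ : Carrier → Subset order → Set
  x ∈ᴳ S = index x ∈ S
  x ∉ᴳ S = ¬ (x ∈ᴳ S)

  InverseClosed : Subset order → Set g
  InverseClosed S = ∀ x → x ∈ᴳ S → x ⁻¹ ∈ᴳ S

module _ {c ℓ₁ ℓ₂ g ℓ} (R : RealNumbers c ℓ₁ ℓ₂) (G : FiniteGroup g ℓ) where
  open FiniteGroup G using (Carrier; _∙_; order; element; index)
  open RawRing (ℂ-rawRing R) using () renaming (0# to 0ᶜ; 1# to 1ᶜ)
  open Mat R using (0ᴹ; sumᴹ)

  -- The permutation matrix of y ↦ x ∙ y in the basis indexed by the group.
  leftRegular : Carrier → Matrix R order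
  leftRegular x i j = if ⌊ i ≟ᶠ index (x ∙ element j) ⌋ then 1ᶜ else 0ᶜ

  cayleyAdjacency : Subset order → Matrix R order
  cayleyAdjacency S =
    sumᴹ (λ k → if lookup S k then leftRegular (element k) else 0ᴹ)

module Submission where

-- Let e be the vertex of the identity and f(t) = |U(t)ₑₑ|².  A nonzero real v
-- orthogonal to every Aᵏe confines the unit vectors U(t)e to the hyperplane v^⊥,
-- of dimension n - 1, and ⟨U(s)e, U(t)e⟩ = U(s - t)ₑₑ because A is symmetric.  By
-- the Welch bound the double average of f(s - t) over a grid is then at least
-- 1/(n - 1), whereas uniform mixing forces it to be close to 1/n.  So the columns
-- Aᵏe span, and no spectral theorem is needed.
--
-- Writing χ for the indicator of S, the function h ↦ χ(xh⁻¹) - χ(h⁻¹x) is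
-- orthogonal to every Aᵏe, because these commute with χ in the group algebra.
-- Hence χ, and with it every Aᵏe, is a class function, so δ_{xy} - δ_{yx} is
-- orthogonal to every Aᵏe as well, and xy = yx.

open import Algebra.Bundles using (CommutativeRing; RawRing)
import Algebra.Apartness.Properties.HeytingCommutativeRing
import Algebra.Definitions.RawSemiring
import Algebra.Properties.AbelianGroup
import Algebra.Properties.Group
import Algebra.Properties.Ring
import Algebra.Properties.Semiring.Mult
import Algebra.Properties.Semiring.Mult.TCOptimised
import Algebra.Properties.Semiring.Sum
import Algebra.Solver.Ring
import Algebra.Solver.Ring.AlmostCommutativeRing as ACR
open import Data.Bool.Base using (if_then_else_; true; false)
open import Data.Empty using (⊥)
open import Data.Fin.Base as Fin using (Fin; toℕ)
open import Data.Fin.Permutation using (Permutation; permutation)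
open import Data.Fin.Properties as Finₚ using () renaming (_≟_ to _≟ᶠ_)
open import Data.Fin.Subset using (Subset)
open import Data.Integer.Base as ℤ using (ℤ; +_; -[1+_]; _⊖_)
import Data.Integer.Properties as ℤₚ
open import Data.Maybe.Base using (Maybe; just; nothing)
open import Data.Nat.Base as ℕ using (ℕ; zero; suc; NonZero; _!)
import Data.Nat.Properties as ℕₚ
open import Data.Product.Base using (∃-syntax; _×_; _,_; proj₁; proj₂)
open import Data.Sum.Base using (_⊎_; inj₁; inj₂)
open import Data.Vec.Base using (lookup)
open import Data.Vec.Properties using ([]=⇒lookup; lookup⇒[]=)
open import Defs
open import Function.Base using (_∘_)
open import Function.Bundles using (Inverse)
open import Relation.Binary.PropositionalEquality.Core as ≡ using (_≡_)
import Relation.Binary.Reasoning.Base.Triple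
open import Relation.Binary.Structures using (IsPreorder)
open import Relation.Nullary.Decidable.Core using (yes; no; ⌊_⌋)
open import Relation.Nullary.Negation.Core using (¬_; contradiction)

-- `U` is given only through limits of exponential series, and its long time average only through
-- limits of Riemann integrals. This causes two difficulties. The formula ⟨U(s)e, U(t)e⟩ = U(s -
-- t)ₑₑ rests on exp(z)exp(w) = exp(z + w), which is proved for the (e, e) entry by comparing square
-- and triangular partial sums of a double series. And the fineness demanded of a Riemann sum
-- depends on T, so one mesh can serve only finitely many T. Hence the grid is cut into a number of
-- blocks fixed in advance by n, the average is controlled at block ends only, and monotonicity of
-- the cumulative sums covers the times in between.
--
-- For n > 1 the constants come from 1/n < (1 + 1/n)/n < 1/(n - 1). The middle value is a form of
-- the Welch bound that avoids dividing by n - 1. Half of its excess over 1/n is granted to the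
-- averaging and sampling errors; the other half absorbs the diagonal of the Gram matrix and the
-- rounding to whole blocks, once there are enough blocks.

-- A ring solver with integer coefficients over any commutative ring.

module IntegerRingSolver {c ℓ} (K : CommutativeRing c ℓ) where
  open CommutativeRing K
  open Algebra.Properties.Semiring.Mult.TCOptimised semiring renaming (_×_ to _×′_)
  open Algebra.Properties.Ring ring using (-‿distribˡ-*; -‿distribʳ-*; -‿involutive; -0#≈0#)
  open Algebra.Properties.AbelianGroup +-abelianGroup using (⁻¹-∙-comm)
  open import Relation.Binary.Reasoning.Setoid setoid

  private
    ⟦_⟧ℤ : ℤ → Carrier
    ⟦ + n ⟧ℤ      = n ×′ 1#
    ⟦ -[1+ n ] ⟧ℤ = - (suc n ×′ 1#)

    cancel-1 : ∀ x y → (1# + x) - (1# + y) ≈ x - y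
    cancel-1 x y = begin
      (1# + x) - (1# + y)       ≈⟨ +-cong (+-comm 1# x) (sym (⁻¹-∙-comm 1# y)) ⟩
      (x + 1#) + (- 1# + - y)   ≈⟨ +-assoc x 1# _ ⟩
      x + (1# + (- 1# + - y))   ≈⟨ +-congˡ (+-assoc 1# (- 1#) (- y)) ⟨
      x + ((1# - 1#) + - y)     ≈⟨ +-congˡ (+-congʳ (-‿inverseʳ 1#)) ⟩
      x + (0# + - y)            ≈⟨ +-congˡ (+-identityˡ (- y)) ⟩
      x - y                     ∎

    ⊖-homo : ∀ m n → ⟦ m ⊖ n ⟧ℤ ≈ m ×′ 1# - n ×′ 1#
    ⊖-homo zero    zero    = sym (-‿inverseʳ 0#)
    ⊖-homo zero    (suc n) = sym (+-identityˡ _)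
    ⊖-homo (suc m) zero    = sym (trans (+-congˡ -0#≈0#) (+-identityʳ _))
    ⊖-homo (suc m) (suc n) = begin
      ⟦ suc m ⊖ suc n ⟧ℤ               ≡⟨ ≡.cong ⟦_⟧ℤ (ℤₚ.[1+m]⊖[1+n]≡m⊖n m n) ⟩
      ⟦ m ⊖ n ⟧ℤ                       ≈⟨ ⊖-homo m n ⟩
      m ×′ 1# - n ×′ 1#                  ≈⟨ cancel-1 (m ×′ 1#) (n ×′ 1#) ⟨
      (1# + m ×′ 1#) - (1# + n ×′ 1#)    ≈⟨ +-cong (1+× m 1#) (-‿cong (1+× n 1#)) ⟨
      suc m ×′ 1# - suc n ×′ 1#          ∎

    +-homo : ∀ i j → ⟦ i ℤ.+ j ⟧ℤ ≈ ⟦ i ⟧ℤ + ⟦ j ⟧ℤ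
    +-homo (+ m)    (+ n)    = ×-homo-+ 1# m n
    +-homo (+ m)    -[1+ n ] = ⊖-homo m (suc n)
    +-homo -[1+ m ] (+ n)    = trans (⊖-homo n (suc m)) (+-comm _ _)
    +-homo -[1+ m ] -[1+ n ] = begin
      - (suc (suc (m ℕ.+ n)) ×′ 1#)         ≈⟨ -‿cong (1+× (suc (m ℕ.+ n)) 1#) ⟩
      - (1# + (suc m ℕ.+ n) ×′ 1#)          ≈⟨ -‿cong (+-congˡ (×-homo-+ 1# (suc m) n)) ⟩
      - (1# + (suc m ×′ 1# + n ×′ 1#))       ≈⟨ -‿cong (trans (sym (+-assoc _ _ _))
          (trans (+-congʳ (+-comm _ _)) (+-assoc _ _ _))) ⟩
      - (suc m ×′ 1# + (1# + n ×′ 1#))       ≈⟨ -‿cong (+-congˡ (1+× n 1#)) ⟨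
      - (suc m ×′ 1# + suc n ×′ 1#)          ≈⟨ ⁻¹-∙-comm _ _ ⟨
      - (suc m ×′ 1#) - suc n ×′ 1#          ∎

    -‿homo : ∀ i → ⟦ ℤ.- i ⟧ℤ ≈ - ⟦ i ⟧ℤ
    -‿homo (+ zero)  = sym -0#≈0#
    -‿homo (+ suc n) = refl
    -‿homo -[1+ n ]  = sym (-‿involutive _)

    *-homo : ∀ i j → ⟦ i ℤ.* j ⟧ℤ ≈ ⟦ i ⟧ℤ * ⟦ j ⟧ℤ
    *-homo (+ m) (+ n) = trans (reflexive (≡.cong ⟦_⟧ℤ (≡.sym (ℤₚ.pos-* m n)))) (×1-homo-* m n)
    *-homo (+ m) -[1+ n ] = begin
      ⟦ + m ℤ.* -[1+ n ] ⟧ℤ         ≡⟨ ≡.cong ⟦_⟧ℤ (ℤₚ.neg-distribʳ-* (+ m) (+ suc n)) ⟨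
      ⟦ ℤ.- (+ m ℤ.* + suc n) ⟧ℤ    ≈⟨ -‿homo (+ m ℤ.* + suc n) ⟩
      - ⟦ + m ℤ.* + suc n ⟧ℤ        ≈⟨ -‿cong (*-homo (+ m) (+ suc n)) ⟩
      - (m ×′ 1# * suc n ×′ 1#)       ≈⟨ -‿distribʳ-* _ _ ⟩
      m ×′ 1# * - (suc n ×′ 1#)       ∎
    *-homo -[1+ m ] (+ n) = begin
      ⟦ -[1+ m ] ℤ.* + n ⟧ℤ         ≡⟨ ≡.cong ⟦_⟧ℤ (ℤₚ.neg-distribˡ-* (+ suc m) (+ n)) ⟨
      ⟦ ℤ.- (+ suc m ℤ.* + n) ⟧ℤ    ≈⟨ -‿homo (+ suc m ℤ.* + n) ⟩
      - ⟦ + suc m ℤ.* + n ⟧ℤ        ≈⟨ -‿cong (*-homo (+ suc m) (+ n)) ⟩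
      - (suc m ×′ 1# * n ×′ 1#)       ≈⟨ -‿distribˡ-* _ _ ⟩
      - (suc m ×′ 1#) * n ×′ 1#       ∎
    *-homo -[1+ m ] -[1+ n ] = begin
      (suc m ℕ.* suc n) ×′ 1#            ≈⟨ ×1-homo-* (suc m) (suc n) ⟩
      suc m ×′ 1# * suc n ×′ 1#           ≈⟨ -‿involutive _ ⟨
      - - (suc m ×′ 1# * suc n ×′ 1#)     ≈⟨ -‿cong (-‿distribʳ-* _ _) ⟩
      - (suc m ×′ 1# * - (suc n ×′ 1#))   ≈⟨ -‿distribˡ-* _ _ ⟩
      - (suc m ×′ 1#) * - (suc n ×′ 1#)   ∎

    almostRing = ACR.fromCommutativeRing K

    morphism : ℤ.+-*-rawRing ACR.-Raw-AlmostCommutative⟶ almostRing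
    morphism = record
      { ⟦_⟧ = ⟦_⟧ℤ ; +-homo = +-homo ; *-homo = *-homo
      ; -‿homo = -‿homo ; 0-homo = refl ; 1-homo = refl }

    -- Equality of constructive reals cannot be decided, but equality of integer coefficients can;
    -- this is what lets the solver cancel terms.
    weaklyDec : ∀ i j → Maybe (⟦ i ⟧ℤ ≈ ⟦ j ⟧ℤ)
    weaklyDec i j with i ℤₚ.≟ j
    ... | yes ≡.refl = just refl
    ... | no  _      = nothing

  open Algebra.Solver.Ring ℤ.+-*-rawRing almostRing morphism weaklyDec public
    using (solve; _:=_; _:+_; _:*_; _:-_; :-_; con; Polynomial)

  0: 1: 2: : ∀ {n} → Polynomial n
  0: = con (+ 0)
  1: = con (+ 1)
  2: = con (+ 2)

-- Order and arithmetic of the constructive reals.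

module OrderedField {c ℓ₁ ℓ₂} (R : RealNumbers c ℓ₁ ℓ₂) where
  open RealNumbers R public hiding (sum)
  ℝ-commutativeRing : CommutativeRing c ℓ₁
  ℝ-commutativeRing = record { isCommutativeRing = isCommutativeRing }
  open CommutativeRing ℝ-commutativeRing public using (ring; semiring)
  open Algebra.Apartness.Properties.HeytingCommutativeRing heytingCommutativeRing public
    using (x-0≈x; #-congʳ; invertibleʳ⇒#)
  open Algebra.Properties.Semiring.Sum semiring public
    using (sum; sum-cong-≋; ∑-distrib-+; ∑-comm; *-distribˡ-sum; *-distribʳ-sum)
  open Algebra.Properties.Ring ring public using (-0#≈0#)
  module ℝ-Solver = IntegerRingSolver ℝ-commutativeRing
  open ℝ-Solver
  open <-Order public using (<-respˡ-≈; <-respʳ-≈)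
    renaming (irrefl to <-irrefl; trans to <-trans; asym to <-asym)

  <⇒≤ : ∀ {x y} → x < y → x ≤ y
  <⇒≤ = <-asym

  ≤-reflexive : ∀ {x y} → x ≈ y → x ≤ y
  ≤-reflexive x≈y = <-irrefl (sym x≈y)

  ≤-refl : ∀ {x} → x ≤ x
  ≤-refl = ≤-reflexive refl

  -- The constructive substitute for trichotomy; it makes `<` and the negative relation `≤` compose.
  <-cotrans : ∀ {x y} → x < y → ∀ z → x < z ⊎ z < y
  <-cotrans x<y z with #-cotrans (<⇒# x<y) z
  ... | inj₁ x#z with #⇒<⊎> x#z
  ...   | inj₁ x<z = inj₁ x<z
  ...   | inj₂ z<x = inj₂ (<-trans z<x x<y)
  <-cotrans x<y z | inj₂ z#y with #⇒<⊎> z#y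
  ...   | inj₁ z<y = inj₂ z<y
  ...   | inj₂ y<z = inj₁ (<-trans x<y y<z)

  <-≤-trans : ∀ {x y z} → x < y → y ≤ z → x < z
  <-≤-trans x<y y≤z with <-cotrans x<y _
  ... | inj₁ x<z = x<z
  ... | inj₂ z<y = contradiction z<y y≤z

  ≤-<-trans : ∀ {x y z} → x ≤ y → y < z → x < z
  ≤-<-trans x≤y y<z with <-cotrans y<z _
  ... | inj₁ y<x = contradiction y<x x≤y
  ... | inj₂ x<z = x<z

  ≤-trans : ∀ {x y z} → x ≤ y → y ≤ z → x ≤ z
  ≤-trans x≤y y≤z z<x = x≤y (≤-<-trans y≤z z<x)

  ≤-antisym : ∀ {x y} → x ≤ y → y ≤ x → x ≈ y
  ≤-antisym x≤y y≤x = proj₁ (tight _ _) λ x#y → helper (#⇒<⊎> x#y)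
    where
    helper : ¬ (_ ⊎ _)
    helper (inj₁ x<y) = y≤x x<y
    helper (inj₂ y<x) = x≤y y<x

  ≤-isPreorder : IsPreorder _≈_ _≤_
  ≤-isPreorder = record { isEquivalence = isEquivalence ; reflexive = ≤-reflexive ; trans = ≤-trans }

  module ≤-Reasoning = Relation.Binary.Reasoning.Base.Triple
    {_≈_ = _≈_} {_≤_ = _≤_} {_<_ = _<_}
    ≤-isPreorder <-asym <-trans <-Order.<-resp-≈ <⇒≤ <-≤-trans ≤-<-trans

  ≤-respʳ-≈ : ∀ {x y z} → y ≈ z → x ≤ y → x ≤ z
  ≤-respʳ-≈ y≈z x≤y = ≤-trans x≤y (≤-reflexive y≈z)

  ≤-respˡ-≈ : ∀ {x y z} → x ≈ y → x ≤ z → y ≤ z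
  ≤-respˡ-≈ x≈y x≤z = ≤-trans (≤-reflexive (sym x≈y)) x≤z

  +-monoʳ-< : ∀ {x y} z → x < y → z + x < z + y
  +-monoʳ-< z x<y = <-respˡ-≈ (+-comm _ z) (<-respʳ-≈ (+-comm _ z) (+-monoˡ-< z x<y))

  +-mono-< : ∀ {x y u v} → x < y → u < v → x + u < y + v
  +-mono-< x<y u<v = <-trans (+-monoˡ-< _ x<y) (+-monoʳ-< _ u<v)

  +-monoˡ-≤ : ∀ {x y} z → x ≤ y → x + z ≤ y + z
  +-monoˡ-≤ {x} {y} z x≤y y+z<x+z = x≤y
    (<-respˡ-≈ (lemma y z) (<-respʳ-≈ (lemma x z) (+-monoˡ-< (- z) y+z<x+z)))
    where
    lemma : ∀ x z → x + z - z ≈ x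
    lemma = solve 2 (λ x z → x :+ z :- z := x) refl

  +-monoʳ-≤ : ∀ {x y} z → x ≤ y → z + x ≤ z + y
  +-monoʳ-≤ z x≤y = ≤-respˡ-≈ (+-comm _ z) (≤-respʳ-≈ (+-comm _ z) (+-monoˡ-≤ z x≤y))

  +-mono-≤ : ∀ {x y u v} → x ≤ y → u ≤ v → x + u ≤ y + v
  +-mono-≤ x≤y u≤v = ≤-trans (+-monoˡ-≤ _ x≤y) (+-monoʳ-≤ _ u≤v)

  +-mono-<-≤ : ∀ {x y u v} → x < y → u ≤ v → x + u < y + v
  +-mono-<-≤ x<y u≤v = <-≤-trans (+-monoˡ-< _ x<y) (+-monoʳ-≤ _ u≤v)

  0<y-x⇒x<y : ∀ {x y z} → z ≈ y - x → 0# < z → x < y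
  0<y-x⇒x<y {x} {y} z≈ 0<z =
    <-respˡ-≈ (+-identityˡ x) (<-respʳ-≈ (trans (+-congʳ z≈) (lemma x y)) (+-monoˡ-< x 0<z))
    where
    lemma : ∀ x y → y - x + x ≈ y
    lemma = solve 2 (λ x y → y :- x :+ x := y) refl

  0≤y-x⇒x≤y : ∀ {x y z} → z ≈ y - x → 0# ≤ z → x ≤ y
  0≤y-x⇒x≤y {x} {y} z≈ 0≤z =
    ≤-respˡ-≈ (+-identityˡ x) (≤-respʳ-≈ (trans (+-congʳ z≈) (lemma x y)) (+-monoˡ-≤ x 0≤z))
    where
    lemma : ∀ x y → y - x + x ≈ y
    lemma = solve 2 (λ x y → y :- x :+ x := y) refl

  x<y⇒0<y-x : ∀ {x y} → x < y → 0# < y - x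
  x<y⇒0<y-x {x} x<y = <-respˡ-≈ (-‿inverseʳ x) (+-monoˡ-< (- x) x<y)

  x≤y⇒0≤y-x : ∀ {x y} → x ≤ y → 0# ≤ y - x
  x≤y⇒0≤y-x {x} x≤y = ≤-respˡ-≈ (-‿inverseʳ x) (+-monoˡ-≤ (- x) x≤y)

  neg-anti-< : ∀ {x y} → x < y → - y < - x
  neg-anti-< {x} {y} x<y = 0<y-x⇒x<y
    (solve 2 (λ x y → y :- x := :- x :- :- y) refl x y) (x<y⇒0<y-x x<y)

  neg-anti-≤ : ∀ {x y} → x ≤ y → - y ≤ - x
  neg-anti-≤ {x} {y} x≤y = 0≤y-x⇒x≤y
    (solve 2 (λ x y → y :- x := :- x :- :- y) refl x y) (x≤y⇒0≤y-x x≤y)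

  0<-x : ∀ {x} → x < 0# → 0# < - x
  0<-x {x} x<0 = <-respʳ-≈ (+-identityˡ (- x)) (x<y⇒0<y-x x<0)

  +-nonneg : ∀ {x y} → 0# ≤ x → 0# ≤ y → 0# ≤ x + y
  +-nonneg 0≤x 0≤y = ≤-respˡ-≈ (+-identityˡ 0#) (+-mono-≤ 0≤x 0≤y)

  +-pos : ∀ {x y} → 0# < x → 0# < y → 0# < x + y
  +-pos 0<x 0<y = <-respˡ-≈ (+-identityˡ 0#) (+-mono-< 0<x 0<y)

  +-pos-nonneg : ∀ {x y} → 0# < x → 0# ≤ y → 0# < x + y
  +-pos-nonneg 0<x 0≤y = <-respˡ-≈ (+-identityˡ 0#) (+-mono-<-≤ 0<x 0≤y)

  -- In a Heyting field, being apart from zero is being invertible, and a factor of an invertible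
  -- element is invertible.
  #0-factorˡ : ∀ {x y} → x * y # 0# → x # 0#
  #0-factorˡ {x} {y} xy#0 with #⇒invertible xy#0
  ... | z , _ , xy-0*z≈1 = invertibleʳ⇒# (y * z , trans lemma xy-0*z≈1)
    where
    lemma : (x - 0#) * (y * z) ≈ (x * y - 0#) * z
    lemma = solve 3 (λ x y z → (x :- 0:) :* (y :* z) := (x :* y :- 0:) :* z) refl x y z

  -- No case split on signs is available. But a negative product is apart from zero, hence so are
  -- both factors, and a nonnegative number apart from zero is positive.
  *-nonneg : ∀ {x y} → 0# ≤ x → 0# ≤ y → 0# ≤ x * y
  *-nonneg {x} {y} 0≤x 0≤y xy<0 = <-asym xy<0 (*-pos (pos 0≤x x#0) (pos 0≤y y#0))
    where
    pos : ∀ {z} → 0# ≤ z → z # 0# → 0# < z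
    pos 0≤z z#0 with #⇒<⊎> z#0
    ... | inj₁ z<0 = contradiction z<0 0≤z
    ... | inj₂ 0<z = 0<z
    x#0 = #0-factorˡ (<⇒# xy<0)
    y#0 = #0-factorˡ (#-congʳ (*-comm x y) (<⇒# xy<0))

  #0⇒0<x² : ∀ {x} → x # 0# → 0# < x * x
  #0⇒0<x² {x} x#0 with #⇒<⊎> x#0
  ... | inj₂ 0<x = *-pos 0<x 0<x
  ... | inj₁ x<0 = <-respʳ-≈ (solve 1 (λ x → :- x :* :- x := x :* x) refl x) (*-pos (0<-x x<0) (0<-x x<0))

  x²-nonneg : ∀ x → 0# ≤ x * x
  x²-nonneg x x²<0 = <-asym x²<0 (#0⇒0<x² (#0-factorˡ (<⇒# x²<0)))

  *-monoˡ-< : ∀ {x y z} → 0# < z → x < y → z * x < z * y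
  *-monoˡ-< {x} {y} {z} 0<z x<y = 0<y-x⇒x<y
    (solve 3 (λ x y z → z :* (y :- x) := z :* y :- z :* x) refl x y z) (*-pos 0<z (x<y⇒0<y-x x<y))

  *-monoˡ-≤ : ∀ {x y z} → 0# ≤ z → x ≤ y → z * x ≤ z * y
  *-monoˡ-≤ {x} {y} {z} 0≤z x≤y = 0≤y-x⇒x≤y
    (solve 3 (λ x y z → z :* (y :- x) := z :* y :- z :* x) refl x y z) (*-nonneg 0≤z (x≤y⇒0≤y-x x≤y))

  *-monoʳ-≤ : ∀ {x y z} → 0# ≤ z → x ≤ y → x * z ≤ y * z
  *-monoʳ-≤ 0≤z x≤y = ≤-respˡ-≈ (*-comm _ _) (≤-respʳ-≈ (*-comm _ _) (*-monoˡ-≤ 0≤z x≤y))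

  *-mono-≤ : ∀ {x y u v} → 0# ≤ u → 0# ≤ y → x ≤ y → u ≤ v → x * u ≤ y * v
  *-mono-≤ 0≤u 0≤y x≤y u≤v = ≤-trans (*-monoʳ-≤ 0≤u x≤y) (*-monoˡ-≤ 0≤y u≤v)

  *-cancelˡ-≤ : ∀ {x y z} → 0# < z → z * x ≤ z * y → x ≤ y
  *-cancelˡ-≤ 0<z zx≤zy y<x = zx≤zy (*-monoˡ-< 0<z y<x)

  *-cancelˡ-≈ : ∀ {x y z} → 0# < z → z * x ≈ z * y → x ≈ y
  *-cancelˡ-≈ 0<z zx≈zy =
    ≤-antisym (*-cancelˡ-≤ 0<z (≤-reflexive zx≈zy)) (*-cancelˡ-≤ 0<z (≤-reflexive (sym zx≈zy)))

  recip-inverseʳ : ∀ x (0<x : 0# < x) → x * recip x 0<x ≈ 1#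
  recip-inverseʳ x 0<x with #⇒invertible (#-sym (<⇒# 0<x))
  ... | y , _ , x-0*y≈1 = trans (*-congʳ (sym (x-0≈x x))) x-0*y≈1

  x*recip-x*y≈y : ∀ x (0<x : 0# < x) y → x * (recip x 0<x * y) ≈ y
  x*recip-x*y≈y x 0<x y = trans (sym (*-assoc _ _ _)) (trans (*-congʳ (recip-inverseʳ x 0<x)) (*-identityˡ y))

  0<recip : ∀ x (0<x : 0# < x) → 0# < recip x 0<x
  0<recip x 0<x with <-cotrans 0<1 (recip x 0<x)
  ... | inj₁ 0<r = 0<r
  ... | inj₂ _ = helper (#⇒<⊎> r#0)
    where
    r = recip x 0<x
    1≈rx = trans (sym (recip-inverseʳ x 0<x)) (*-comm x r)
    r#0 : r # 0#
    r#0 = #0-factorˡ (#-congʳ 1≈rx (#-sym (<⇒# 0<1)))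
    helper : _ ⊎ _ → 0# < r
    helper (inj₂ 0<r) = 0<r
    helper (inj₁ r<0) = contradiction (<-trans 0<1 1<0) (<-irrefl refl)
      where
      1<0 : 1# < 0#
      1<0 = <-respˡ-≈ (recip-inverseʳ x 0<x) (<-respʳ-≈ (zeroʳ x) (*-monoˡ-< 0<x r<0))

  *-cancelˡ-< : ∀ {x y z} → 0# < z → z * x < z * y → x < y
  *-cancelˡ-< {x} {y} {z} 0<z zx<zy =
    <-respˡ-≈ (lemma x) (<-respʳ-≈ (lemma y) (*-monoˡ-< (0<recip z 0<z) zx<zy))
    where
    lemma : ∀ u → recip z 0<z * (z * u) ≈ u
    lemma u = trans (sym (*-assoc _ _ _)) (trans (*-congʳ (trans (*-comm _ _) (recip-inverseʳ z 0<z))) (*-identityˡ u))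

  module _ where
    open Algebra.Properties.Semiring.Mult semiring

    fromNat-+ : ∀ m n → fromNat (m ℕ.+ n) ≈ fromNat m + fromNat n
    fromNat-+ = ×-homo-+ 1#

    fromNat-* : ∀ m n → fromNat (m ℕ.* n) ≈ fromNat m * fromNat n
    fromNat-* = ×1-homo-*

  0≤fromNat : ∀ n → 0# ≤ fromNat n
  0≤fromNat zero    = ≤-refl
  0≤fromNat (suc n) = <⇒≤ (0<fromNat (suc n))

  fromNat-mono-≤ : ∀ {m n} → m ℕ.≤ n → fromNat m ≤ fromNat n
  fromNat-mono-≤ {n = n} ℕ.z≤n = 0≤fromNat n
  fromNat-mono-≤ (ℕ.s≤s m≤n)   = +-monoʳ-≤ 1# (fromNat-mono-≤ m≤n)

  1≤fromNat : ∀ n → 1# ≤ fromNat (suc n)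
  1≤fromNat n = ≤-respˡ-≈ (+-identityʳ 1#) (+-monoʳ-≤ 1# (0≤fromNat n))

  sum-mono-≤ : ∀ {n} {f g : Fin n → Carrier} → (∀ i → f i ≤ g i) → sum f ≤ sum g
  sum-mono-≤ {zero}  f≤g = ≤-refl
  sum-mono-≤ {suc n} f≤g = +-mono-≤ (f≤g Fin.zero) (sum-mono-≤ (f≤g ∘ Fin.suc))

  sum-nonneg : ∀ {n} {f : Fin n → Carrier} → (∀ i → 0# ≤ f i) → 0# ≤ sum f
  sum-nonneg {zero}  0≤f = ≤-refl
  sum-nonneg {suc n} 0≤f = +-nonneg (0≤f Fin.zero) (sum-nonneg (0≤f ∘ Fin.suc))

  sum-const : ∀ n x → sum {n} (λ _ → x) ≈ fromNat n * x
  sum-const zero    x = sym (zeroˡ x)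
  sum-const (suc n) x = trans (+-congˡ (sum-const n x))
    (solve 2 (λ x n → x :+ n :* x := (1: :+ n) :* x) refl x (fromNat n))

  x²≤y²⇒∣x∣≤y : ∀ {x y} → 0# ≤ y → x * x ≤ y * y → (- y ≤ x) × (x ≤ y)
  x²≤y²⇒∣x∣≤y {x} {y} 0≤y x²≤y² = left , right
    where
    strict : ∀ {z} → z * z ≤ y * y → z ≤ y
    strict {z} z²≤y² y<z = z²≤y² (begin-strict
      y * y  ≤⟨ *-monoˡ-≤ 0≤y (<⇒≤ y<z) ⟩
      y * z  ≈⟨ *-comm y z ⟩
      z * y  <⟨ *-monoˡ-< (≤-<-trans 0≤y y<z) y<z ⟩
      z * z  ∎)
      where open ≤-Reasoning
    right = strict x²≤y²
    left : - y ≤ x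
    left = ≤-respʳ-≈ (solve 1 (λ x → :- :- x := x) refl x)
      (neg-anti-≤ (strict (≤-respˡ-≈ (solve 1 (λ x → x :* x := :- x :* :- x) refl x) x²≤y²)))

  -- Both 2(xy - ab) and 2(xy + ab) are sums of two products of positive numbers; for instance, the
  -- former is (x - a)(y + b) + (x + a)(y - b).
  ∣*∣< : ∀ {a b x y} → ∣ a ∣< x → ∣ b ∣< y → ∣ a * b ∣< x * y
  ∣*∣< {a} {b} {x} {y} (-x<a , a<x) (-y<b , b<y) =
    *-cancelˡ-< 0<2 (<-respˡ-≈ (sym (solve 2 (λ x y → 2: :* :- (x :* y) := :- (2: :* (x :* y))) refl x y))
      (0<y-x⇒x<y (solve 4 (λ a b x y →
        (x :- a) :* (y :- b) :+ (a :- :- x) :* (b :- :- y) := 2: :* (a :* b) :- :- (2: :* (x :* y))) refl a b x y)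
        (+-pos (*-pos 0<x-a 0<y-b) (*-pos 0<x+a 0<y+b)))) ,
    *-cancelˡ-< 0<2 (0<y-x⇒x<y (solve 4 (λ a b x y →
        (x :- a) :* (b :- :- y) :+ (a :- :- x) :* (y :- b) := 2: :* (x :* y) :- 2: :* (a :* b)) refl a b x y)
        (+-pos (*-pos 0<x-a 0<y+b) (*-pos 0<x+a 0<y-b)))
    where
    0<2 = +-pos 0<1 0<1
    0<x-a = x<y⇒0<y-x a<x
    0<x+a = x<y⇒0<y-x -x<a
    0<y-b = x<y⇒0<y-x b<y
    0<y+b = x<y⇒0<y-x -y<b

-- Null sequences and limits.

module Limits {c ℓ₁ ℓ₂} (R : RealNumbers c ℓ₁ ℓ₂) where
  open OrderedField R
  open ℝ-Solver

  Null : (ℕ → Carrier) → Set _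
  Null s = ∀ ε → 0# < ε → ∃[ N ] (∀ n → N ℕ.≤ n → ∣ s n ∣< ε)

  ∣∣<-cong : ∀ {x y ε} → x ≈ y → ∣ x ∣< ε → ∣ y ∣< ε
  ∣∣<-cong x≈y (-ε<x , x<ε) = <-respʳ-≈ x≈y -ε<x , <-respˡ-≈ x≈y x<ε

  half : Carrier → Carrier
  half x = recip (1# + 1#) (+-pos 0<1 0<1) * x

  half+half : ∀ x → half x + half x ≈ x
  half+half x = trans (solve 2 (λ h x → h :* x :+ h :* x := 2: :* h :* x) refl _ x)
    (trans (*-congʳ (recip-inverseʳ _ _)) (*-identityˡ x))

  0<half : ∀ {x} → 0# < x → 0# < half x
  0<half = *-pos (0<recip _ _)

  null-cong : ∀ {s t} → (∀ n → s n ≈ t n) → Null s → Null t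
  null-cong s≈t null ε 0<ε with null ε 0<ε
  ... | N , small = N , λ n N≤n → ∣∣<-cong (s≈t n) (small n N≤n)

  null-0 : Null (λ _ → 0#)
  null-0 ε 0<ε = 0 , λ _ _ → <-respʳ-≈ -0#≈0# (neg-anti-< 0<ε) , 0<ε

  null-+ : ∀ {s t} → Null s → Null t → Null (λ n → s n + t n)
  null-+ null-s null-t ε 0<ε with null-s (half ε) (0<half 0<ε) | null-t (half ε) (0<half 0<ε)
  ... | M , s-small | N , t-small = M ℕ.⊔ N , λ n M⊔N≤n →
    let -ε<s , s<ε = s-small n (ℕₚ.m⊔n≤o⇒m≤o M N M⊔N≤n)
        -ε<t , t<ε = t-small n (ℕₚ.m⊔n≤o⇒n≤o M N M⊔N≤n)
    in <-respˡ-≈ (trans (solve 1 (λ h → :- h :+ :- h := :- (h :+ h)) refl _) (-‿cong (half+half ε)))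
         (+-mono-< -ε<s -ε<t)
     , <-respʳ-≈ (half+half ε) (+-mono-< s<ε t<ε)

  null-* : ∀ {s t} → Null s → Null t → Null (λ n → s n * t n)
  null-* null-s null-t ε 0<ε with null-s 1# 0<1 | null-t ε 0<ε
  ... | M , s-small | N , t-small = M ℕ.⊔ N , λ n M⊔N≤n →
    let -ε<st , st<ε = ∣*∣< (s-small n (ℕₚ.m⊔n≤o⇒m≤o M N M⊔N≤n))
                            (t-small n (ℕₚ.m⊔n≤o⇒n≤o M N M⊔N≤n))
    in <-respˡ-≈ (-‿cong (*-identityˡ ε)) -ε<st , <-respʳ-≈ (*-identityˡ ε) st<ε

  bounded : ∀ x → ∃[ y ] (0# < y × ∣ x ∣< y)
  bounded x with archimedean x | archimedean (- x)
  ... | m , x<m | n , -x<n = fromNat m + fromNat (suc n) , 0<m+n ,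
      <-respʳ-≈ (solve 1 (λ x → :- :- x := x) refl x) (neg-anti-< (<-trans -x<n n<m+n)) ,
      <-respˡ-≈ (+-identityʳ x) (+-mono-< x<m (0<fromNat (suc n)))
    where
    0<m+n = <-respʳ-≈ (+-comm _ _) (+-pos-nonneg (0<fromNat (suc n)) (0≤fromNat m))
    n<m+n : fromNat n < fromNat m + fromNat (suc n)
    n<m+n = 0<y-x⇒x<y (solve 2 (λ m n → 1: :+ m := m :+ (1: :+ n) :- n) refl (fromNat m) (fromNat n))
      (+-pos-nonneg 0<1 (0≤fromNat m))

  null-const-* : ∀ {s} x → Null s → Null (λ n → x * s n)
  null-const-* {s} x null ε 0<ε = proj₁ small , λ n N≤n →
    ∣∣<-scale (∣*∣< (proj₂ (proj₂ (bounded x))) (proj₂ small n N≤n))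
    where
    y = proj₁ (bounded x)
    0<y = proj₁ (proj₂ (bounded x))
    small = null (recip y 0<y * ε) (*-pos (0<recip y 0<y) 0<ε)
    ∣∣<-scale : ∀ {z} → ∣ z ∣< (y * (recip y 0<y * ε)) → ∣ z ∣< ε
    ∣∣<-scale (-ε<z , z<ε) = <-respˡ-≈ (-‿cong (x*recip-x*y≈y y 0<y ε)) -ε<z , <-respʳ-≈ (x*recip-x*y≈y y 0<y ε) z<ε

  null-neg : ∀ {s} → Null s → Null (λ n → - s n)
  null-neg null = null-cong (λ n → solve 1 (λ x → :- 1: :* x := :- x) refl _) (null-const-* (- 1#) null)

  null-squeeze : ∀ {s t} → Null t → (∀ n → - t n ≤ s n × s n ≤ t n) → Null s
  null-squeeze null bound ε 0<ε with null ε 0<ε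
  ... | N , small = N , λ n N≤n →
    let _ , t<ε = small n N≤n ; -t≤s , s≤t = bound n
    in <-≤-trans (neg-anti-< t<ε) -t≤s , ≤-<-trans s≤t t<ε

  null-constant⇒≈0 : ∀ {x} → Null (λ _ → x) → x ≈ 0#
  null-constant⇒≈0 {x} null = ≤-antisym
    (λ 0<x → let N , small = null x 0<x in <-irrefl refl (proj₂ (small N ℕₚ.≤-refl)))
    (λ x<0 → let N , small = null (- x) (0<-x x<0) in
      <-irrefl (solve 1 (λ x → :- :- x := x) refl x) (proj₁ (small N ℕₚ.≤-refl)))

  ⟶-cong : ∀ {s t l m} → (∀ n → s n ≈ t n) → l ≈ m → s ⟶ l → t ⟶ m
  ⟶-cong s≈t l≈m = null-cong (λ n → +-cong (s≈t n) (-‿cong l≈m))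

  ⟶-const : ∀ x → (λ _ → x) ⟶ x
  ⟶-const x = null-cong (λ n → sym (-‿inverseʳ x)) null-0

  ⟶-+ : ∀ {s t l m} → s ⟶ l → t ⟶ m → (λ n → s n + t n) ⟶ (l + m)
  ⟶-+ s⟶l t⟶m = null-cong
    (λ n → solve 4 (λ s t l m → s :- l :+ (t :- m) := s :+ t :- (l :+ m)) refl _ _ _ _)
    (null-+ s⟶l t⟶m)

  ⟶-neg : ∀ {s l} → s ⟶ l → (λ n → - s n) ⟶ (- l)
  ⟶-neg s⟶l = null-cong (λ n → solve 2 (λ s l → :- (s :- l) := :- s :- :- l) refl _ _) (null-neg s⟶l)

  ⟶-* : ∀ {s t l m} → s ⟶ l → t ⟶ m → (λ n → s n * t n) ⟶ (l * m)
  ⟶-* {l = l} {m} s⟶l t⟶m = null-cong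
    (λ n → solve 4 (λ s t l m → (s :- l) :* (t :- m) :+ (l :* (t :- m) :+ m :* (s :- l)) := s :* t :- l :* m) refl _ _ _ _)
    (null-+ (null-* s⟶l t⟶m) (null-+ (null-const-* l t⟶m) (null-const-* m s⟶l)))

  -- Allowing two sequences with null difference is what later compares the square and the
  -- triangular partial sums of a Cauchy product.
  ⟶-unique : ∀ {s t l m} → Null (λ n → s n - t n) → s ⟶ l → t ⟶ m → l ≈ m
  ⟶-unique {l = l} {m} s-t s⟶l t⟶m =
    trans (solve 2 (λ l m → l := l :- m :+ m) refl l m)
      (trans (+-congʳ (null-constant⇒≈0 (null-cong
        (λ n → solve 4 (λ s t l m → s :- t :+ (:- (s :- l) :+ (t :- m)) := l :- m) refl _ _ _ _)
        (null-+ s-t (null-+ (null-neg s⟶l) t⟶m)))))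
      (+-identityˡ m))

-- Complex numbers, squared moduli and componentwise limits.

module ComplexNumbers {c ℓ₁ ℓ₂} (R : RealNumbers c ℓ₁ ℓ₂) where
  open OrderedField R
  open ℝ-Solver

  ℂ-commutativeRing : CommutativeRing c ℓ₁
  ℂ-commutativeRing = record
    { RawRing (ℂ-rawRing R)
    ; isCommutativeRing = record
      { isRing = record
        { +-isAbelianGroup = record
          { isGroup = record
            { isMonoid = record
              { isSemigroup = record
                { isMagma = record
                  { isEquivalence = record
                    { refl  = refl , refl
                    ; sym   = λ (p , q) → sym p , sym q
                    ; trans = λ (p , q) (r , s) → trans p r , trans q s }
                  ; ∙-cong = λ (p , q) (r , s) → +-cong p r , +-cong q s }
                ; assoc = λ _ _ _ → +-assoc _ _ _ , +-assoc _ _ _ }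
              ; identity = (λ _ → +-identityˡ _ , +-identityˡ _) , (λ _ → +-identityʳ _ , +-identityʳ _) }
            ; inverse = (λ _ → -‿inverseˡ _ , -‿inverseˡ _) , (λ _ → -‿inverseʳ _ , -‿inverseʳ _)
            ; ⁻¹-cong = λ (p , q) → -‿cong p , -‿cong q }
          ; comm = λ _ _ → +-comm _ _ , +-comm _ _ }
        ; *-cong = λ (p , q) (r , s) →
            +-cong (*-cong p r) (-‿cong (*-cong q s)) , +-cong (*-cong p s) (*-cong q r)
        ; *-assoc = λ _ _ _ →
            solve 6 (λ a b c d e f → (a :* c :- b :* d) :* e :- (a :* d :+ b :* c) :* f
                                   := a :* (c :* e :- d :* f) :- b :* (c :* f :+ d :* e)) refl _ _ _ _ _ _
          , solve 6 (λ a b c d e f → (a :* c :- b :* d) :* f :+ (a :* d :+ b :* c) :* e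
                                   := a :* (c :* f :+ d :* e) :+ b :* (c :* e :- d :* f)) refl _ _ _ _ _ _
        ; *-identity =
            (λ _ → solve 2 (λ a b → 1: :* a :- 0: :* b := a) refl _ _
                 , solve 2 (λ a b → 1: :* b :+ 0: :* a := b) refl _ _)
          , (λ _ → solve 2 (λ a b → a :* 1: :- b :* 0: := a) refl _ _
                 , solve 2 (λ a b → a :* 0: :+ b :* 1: := b) refl _ _)
        ; distrib =
            (λ _ _ _ → solve 6 (λ a b c d e f → a :* (c :+ e) :- b :* (d :+ f)
                              := (a :* c :- b :* d) :+ (a :* e :- b :* f)) refl _ _ _ _ _ _
                     , solve 6 (λ a b c d e f → a :* (d :+ f) :+ b :* (c :+ e)
                              := (a :* d :+ b :* c) :+ (a :* f :+ b :* e)) refl _ _ _ _ _ _)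
          , (λ _ _ _ → solve 6 (λ a b c d e f → (c :+ e) :* a :- (d :+ f) :* b
                              := (c :* a :- d :* b) :+ (e :* a :- f :* b)) refl _ _ _ _ _ _
                     , solve 6 (λ a b c d e f → (c :+ e) :* b :+ (d :+ f) :* a
                              := (c :* b :+ d :* a) :+ (e :* b :+ f :* a)) refl _ _ _ _ _ _)
        }
      ; *-comm = λ _ _ → solve 4 (λ a b c d → a :* c :- b :* d := c :* a :- d :* b) refl _ _ _ _
                       , solve 4 (λ a b c d → a :* d :+ b :* c := c :* b :+ d :* a) refl _ _ _ _
      }
    }

  module C where
    open CommutativeRing ℂ-commutativeRing public hiding (rawRing)
    open Algebra.Properties.Semiring.Sum (CommutativeRing.semiring ℂ-commutativeRing) public
    open Algebra.Definitions.RawSemiring (RawRing.rawSemiring (ℂ-rawRing R)) public using (_^_)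
    module Solver = IntegerRingSolver ℂ-commutativeRing

  conj-+ : ∀ z w → conj R (z C.+ w) C.≈ conj R z C.+ conj R w
  conj-+ z w = refl , solve 2 (λ a b → :- (a :+ b) := :- a :+ :- b) refl _ _

  conj-* : ∀ z w → conj R (z C.* w) C.≈ conj R z C.* conj R w
  conj-* z w = solve 4 (λ a b c d → a :* c :- b :* d := a :* c :- :- b :* :- d) refl _ _ _ _
             , solve 4 (λ a b c d → :- (a :* d :+ b :* c) := a :* :- d :+ :- b :* c) refl _ _ _ _

  conj-conj : ∀ z → conj R (conj R z) C.≈ z
  conj-conj z = refl , solve 1 (λ x → :- :- x := x) refl _

  conj-real : ∀ x → conj R (real R x) C.≈ real R x
  conj-real x = refl , -0#≈0#

  conj-sum : ∀ {n} (f : Fin n → ℂ R) → conj R (C.sum f) C.≈ C.sum (conj R ∘ f)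
  conj-sum {zero}  f = conj-real 0#
  conj-sum {suc n} f = C.trans (conj-+ _ _) (C.+-congˡ (conj-sum (f ∘ Fin.suc)))

  conj-^ : ∀ z k → conj R (z C.^ k) C.≈ conj R z C.^ k
  conj-^ z zero    = conj-real 1#
  conj-^ z (suc k) = C.trans (conj-* z _) (C.*-congˡ (conj-^ z k))

  real-cong : ∀ {x y} → x ≈ y → real R x C.≈ real R y
  real-cong x≈y = x≈y , refl

  real-+ : ∀ x y → real R (x + y) C.≈ real R x C.+ real R y
  real-+ x y = refl , sym (+-identityʳ 0#)

  real-* : ∀ x y → real R (x * y) C.≈ real R x C.* real R y
  real-* x y = solve 2 (λ x y → x :* y := x :* y :- 0: :* 0:) refl x y
             , solve 2 (λ x y → 0: := x :* 0: :+ 0: :* y) refl x y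

  real-sum : ∀ {n} (f : Fin n → Carrier) → real R (sum f) C.≈ C.sum (real R ∘ f)
  real-sum {zero}  f = C.refl
  real-sum {suc n} f = C.trans (real-+ _ _) (C.+-congˡ (real-sum (f ∘ Fin.suc)))

  re-sum : ∀ {n} (f : Fin n → ℂ R) → re (C.sum f) ≈ sum (re ∘ f)
  re-sum {zero}  f = refl
  re-sum {suc n} f = +-congˡ (re-sum (f ∘ Fin.suc))

  -- Estimates |z| ≤ x are written ‖ z ‖² ≤ x * x with 0 ≤ x throughout, which keeps square roots
  -- out of the proof.
  ‖_‖² : ℂ R → Carrier
  ‖ z ‖² = re z * re z + im z * im z

  ‖‖²-cong : ∀ {z w} → z C.≈ w → ‖ z ‖² ≈ ‖ w ‖²
  ‖‖²-cong (p , q) = +-cong (*-cong p p) (*-cong q q)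

  ‖‖²-nonneg : ∀ z → 0# ≤ ‖ z ‖²
  ‖‖²-nonneg z = +-nonneg (x²-nonneg _) (x²-nonneg _)

  ‖‖²-* : ∀ z w → ‖ z C.* w ‖² ≈ ‖ z ‖² * ‖ w ‖²
  ‖‖²-* z w = solve 4 (λ a b c d → (a :* c :- b :* d) :* (a :* c :- b :* d) :+ (a :* d :+ b :* c) :* (a :* d :+ b :* c)
                     := (a :* a :+ b :* b) :* (c :* c :+ d :* d)) refl _ _ _ _

  ‖‖²-real : ∀ x → ‖ real R x ‖² ≈ x * x
  ‖‖²-real x = solve 1 (λ x → x :* x :+ 0: :* 0: := x :* x) refl x

  ‖‖²-conj : ∀ z → ‖ conj R z ‖² ≈ ‖ z ‖²
  ‖‖²-conj z = solve 2 (λ a b → a :* a :+ :- b :* :- b := a :* a :+ b :* b) refl _ _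

  z*conj-z : ∀ z → z C.* conj R z C.≈ real R ‖ z ‖²
  z*conj-z z = solve 2 (λ a b → a :* a :- b :* :- b := a :* a :+ b :* b) refl _ _
             , solve 2 (λ a b → a :* :- b :+ b :* a := 0:) refl _ _

  ‖‖²≤⇒∣re∣≤ : ∀ {z x} → 0# ≤ x → ‖ z ‖² ≤ x * x → - x ≤ re z × re z ≤ x
  ‖‖²≤⇒∣re∣≤ 0≤x ‖z‖²≤x² = x²≤y²⇒∣x∣≤y 0≤x
    (≤-trans (≤-respˡ-≈ (+-identityʳ _) (+-monoʳ-≤ _ (x²-nonneg _))) ‖z‖²≤x²)

  ‖‖²≤⇒∣im∣≤ : ∀ {z x} → 0# ≤ x → ‖ z ‖² ≤ x * x → - x ≤ im z × im z ≤ x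
  ‖‖²≤⇒∣im∣≤ 0≤x ‖z‖²≤x² = x²≤y²⇒∣x∣≤y 0≤x
    (≤-trans (≤-respˡ-≈ (+-identityˡ _) (+-monoˡ-≤ _ (x²-nonneg _))) ‖z‖²≤x²)

  sumᴹ-entry : ∀ {m n} (f : Fin m → Matrix R n) i j → Mat.sumᴹ R f i j C.≈ C.sum (λ k → f k i j)
  sumᴹ-entry {zero}  f i j = C.refl
  sumᴹ-entry {suc m} f i j = C.+-congˡ {f Fin.zero i j} (sumᴹ-entry (f ∘ Fin.suc) i j)

  open Limits R

  infix 4 _⟶ᶜ_
  _⟶ᶜ_ : (ℕ → ℂ R) → ℂ R → Set _
  s ⟶ᶜ l = ((re ∘ s) ⟶ re l) × ((im ∘ s) ⟶ im l)

  ⟶ᶜ-cong : ∀ {s t l m} → (∀ n → s n C.≈ t n) → l C.≈ m → s ⟶ᶜ l → t ⟶ᶜ m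
  ⟶ᶜ-cong s≈t (p , q) (a , b) = ⟶-cong (proj₁ ∘ s≈t) p a , ⟶-cong (proj₂ ∘ s≈t) q b

  ⟶ᶜ-const : ∀ z → (λ _ → z) ⟶ᶜ z
  ⟶ᶜ-const z = ⟶-const _ , ⟶-const _

  ⟶ᶜ-+ : ∀ {s t l m} → s ⟶ᶜ l → t ⟶ᶜ m → (λ n → s n C.+ t n) ⟶ᶜ (l C.+ m)
  ⟶ᶜ-+ (a , b) (c , d) = ⟶-+ a c , ⟶-+ b d

  ⟶ᶜ-* : ∀ {s t l m} → s ⟶ᶜ l → t ⟶ᶜ m → (λ n → s n C.* t n) ⟶ᶜ (l C.* m)
  ⟶ᶜ-* (a , b) (c , d) = ⟶-+ (⟶-* a c) (⟶-neg (⟶-* b d)) , ⟶-+ (⟶-* a d) (⟶-* b c)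

  ⟶ᶜ-conj : ∀ {s l} → s ⟶ᶜ l → (conj R ∘ s) ⟶ᶜ conj R l
  ⟶ᶜ-conj (a , b) = a , ⟶-neg b

  ⟶ᶜ-sum : ∀ {k} {s : Fin k → ℕ → ℂ R} {l : Fin k → ℂ R} → (∀ i → s i ⟶ᶜ l i) →
    (λ n → C.sum (λ i → s i n)) ⟶ᶜ C.sum l
  ⟶ᶜ-sum {zero}  s⟶l = ⟶ᶜ-const _
  ⟶ᶜ-sum {suc k} s⟶l = ⟶ᶜ-+ (s⟶l Fin.zero) (⟶ᶜ-sum (s⟶l ∘ Fin.suc))

  ⟶ᶜ-unique : ∀ {s t l m} → Null (λ n → re (s n) - re (t n)) → Null (λ n → im (s n) - im (t n)) →
    s ⟶ᶜ l → t ⟶ᶜ m → l C.≈ m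
  ⟶ᶜ-unique null-re null-im (a , b) (c , d) = ⟶-unique null-re a c , ⟶-unique null-im b d

-- The algebra of the Cauchy product of two exponential series.

module DoubleSums {c ℓ} (K : CommutativeRing c ℓ) where
  open CommutativeRing K
  open Algebra.Definitions.RawSemiring (RawRing.rawSemiring rawRing) using () renaming (_×_ to _×ℕ_)
  open Algebra.Properties.Semiring.Sum semiring
    using (sum; sum-cong-≋; ∑-distrib-+; *-distribˡ-sum)
  open IntegerRingSolver K
  open import Relation.Binary.Reasoning.Setoid setoid

  Σ< : ℕ → (ℕ → Carrier) → Carrier
  Σ< N f = sum {N} (λ k → f (toℕ k))

  rectangle : ℕ → ℕ → (ℕ → ℕ → Carrier) → Carrier
  rectangle M N θ = Σ< M (λ k → Σ< N (θ k))

  -- The indices are those with k + l < N, taken row by row; `diagonal` m collects those with k + l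
  -- = m.
  triangle : ℕ → (ℕ → ℕ → Carrier) → Carrier
  triangle zero    θ = 0#
  triangle (suc N) θ = Σ< (suc N) (θ 0) + triangle N (θ ∘ suc)

  diagonal : ℕ → (ℕ → ℕ → Carrier) → Carrier
  diagonal zero    θ = θ 0 0
  diagonal (suc m) θ = θ 0 (suc m) + diagonal m (θ ∘ suc)

  Σ<-cong : ∀ N {f g} → (∀ k → f k ≈ g k) → Σ< N f ≈ Σ< N g
  Σ<-cong N f≈g = sum-cong-≋ {N} (f≈g ∘ toℕ)

  Σ<-last : ∀ N f → Σ< (suc N) f ≈ Σ< N f + f N
  Σ<-last zero    f = +-comm (f 0) 0#
  Σ<-last (suc N) f = trans (+-congˡ (Σ<-last N (f ∘ suc))) (sym (+-assoc _ _ _))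

  Σ<-linear : ∀ N x f g → Σ< N (λ k → f k + x * g k) ≈ Σ< N f + x * Σ< N g
  Σ<-linear N x f g =
    trans (∑-distrib-+ {N} _ _) (+-congˡ (sym (*-distribˡ-sum {N} x _)))

  rectangle-linear : ∀ M N x θ ψ →
    rectangle M N (λ k l → θ k l + x * ψ k l) ≈ rectangle M N θ + x * rectangle M N ψ
  rectangle-linear M N x θ ψ =
    trans (Σ<-cong M (λ k → Σ<-linear N x (θ k) (ψ k))) (Σ<-linear M x (λ k → Σ< N (θ k)) (λ k → Σ< N (ψ k)))

  triangle-linear : ∀ N x θ ψ →
    triangle N (λ k l → θ k l + x * ψ k l) ≈ triangle N θ + x * triangle N ψ
  triangle-linear zero    x θ ψ = solve 1 (λ x → 0: := 0: :+ x :* 0:) refl x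
  triangle-linear (suc N) x θ ψ = trans
    (+-cong (Σ<-linear (suc N) x (θ 0) (ψ 0)) (triangle-linear N x (θ ∘ suc) (ψ ∘ suc)))
    (solve 5 (λ a b c d x → a :+ x :* b :+ (c :+ x :* d) := a :+ c :+ x :* (b :+ d)) refl _ _ _ _ x)

  -- The definition removes the row k = 0; removing the antidiagonal k + l = N instead regroups the
  -- sum by total degree.
  triangle-suc : ∀ N θ → triangle (suc N) θ ≈ triangle N θ + diagonal N θ
  triangle-suc zero    θ = solve 1 (λ x → x :+ 0: :+ 0: := 0: :+ x) refl _
  triangle-suc (suc N) θ = trans
    (+-cong (Σ<-last (suc N) (θ 0)) (triangle-suc N (θ ∘ suc)))
    (solve 4 (λ a b c d → a :+ b :+ (c :+ d) := a :+ c :+ (b :+ d)) refl _ _ _ _)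

  triangle-diagonals : ∀ N θ → triangle N θ ≈ Σ< N (λ m → diagonal m θ)
  triangle-diagonals zero    θ = refl
  triangle-diagonals (suc N) θ = trans (triangle-suc N θ)
    (trans (+-congʳ (triangle-diagonals N θ)) (sym (Σ<-last N (λ m → diagonal m θ))))

  diagonal-cong : ∀ m {θ ψ} → (∀ k l → k ℕ.+ l ≡ m → θ k l ≈ ψ k l) → diagonal m θ ≈ diagonal m ψ
  diagonal-cong zero    θ≈ψ = θ≈ψ 0 0 ≡.refl
  diagonal-cong (suc m) θ≈ψ = +-cong (θ≈ψ 0 (suc m) ≡.refl)
    (diagonal-cong m (λ k l k+l≡m → θ≈ψ (suc k) l (≡.cong suc k+l≡m)))

  diagonal-+ : ∀ m θ ψ → diagonal m (λ k l → θ k l + ψ k l) ≈ diagonal m θ + diagonal m ψ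
  diagonal-+ zero    θ ψ = refl
  diagonal-+ (suc m) θ ψ = trans (+-congˡ (diagonal-+ m _ _))
    (solve 4 (λ a b c d → a :+ b :+ (c :+ d) := a :+ c :+ (b :+ d)) refl _ _ _ _)

  diagonal-* : ∀ m x θ → diagonal m (λ k l → x * θ k l) ≈ x * diagonal m θ
  diagonal-* zero    x θ = refl
  diagonal-* (suc m) x θ = trans (+-congˡ (diagonal-* m x _)) (sym (distribˡ x _ _))

  diagonal-last : ∀ m θ → diagonal (suc m) θ ≈ diagonal m (λ k l → θ k (suc l)) + θ (suc m) 0
  diagonal-last zero    θ = refl
  diagonal-last (suc m) θ = trans (+-congˡ (diagonal-last m (θ ∘ suc))) (sym (+-assoc _ _ _))

  -- The image of n in an arbitrary commutative ring: the argument below is applied over ℂ to the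
  -- series itself and over ℝ to its majorant.
  ν : ℕ → Carrier
  ν n = n ×ℕ 1#

  ν-+ : ∀ m n → ν (m ℕ.+ n) ≈ ν m + ν n
  ν-+ zero    n = sym (+-identityˡ _)
  ν-+ (suc m) n = trans (+-congˡ (ν-+ m n)) (sym (+-assoc _ _ _))

  -- The recursion characterising the divided powers α k = zᵏ / k!.
  IsDividedPower : Carrier → (ℕ → Carrier) → Set ℓ
  IsDividedPower z α = α 0 ≈ 1# × (∀ k → ν (suc k) * α (suc k) ≈ z * α k)

  infixl 7 _⊗_
  _⊗_ : (ℕ → Carrier) → (ℕ → Carrier) → ℕ → ℕ → Carrier
  (α ⊗ β) k l = α k * β l

  module _ {z w α β} (dp-α : IsDividedPower z α) (dp-β : IsDividedPower w β) where

    -- On the antidiagonal m + 1 = k + l, so the factor splits between α k and β l, and each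
    -- recursion lowers one index. This is the Leibniz rule for a product of exponentials, and it
    -- replaces binomial coefficients.
    diagonal-step : ∀ m → ν (suc m) * diagonal (suc m) (α ⊗ β) ≈ (z + w) * diagonal m (α ⊗ β)
    diagonal-step m = begin
      ν (suc m) * diagonal (suc m) (α ⊗ β)                          ≈⟨ diagonal-* (suc m) (ν (suc m)) (α ⊗ β) ⟨
      diagonal (suc m) (λ k l → ν (suc m) * (α k * β l))            ≈⟨ diagonal-cong (suc m) split ⟩
      diagonal (suc m) (λ k l → ν k * α k * β l + α k * (ν l * β l))  ≈⟨ diagonal-+ (suc m) (λ k l → ν k * α k * β l)
          (λ k l → α k * (ν l * β l)) ⟩
      diagonal (suc m) (λ k l → ν k * α k * β l) + diagonal (suc m) (λ k l → α k * (ν l * β l))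
        ≈⟨ +-cong first second ⟩
      z * diagonal m (α ⊗ β) + w * diagonal m (α ⊗ β)               ≈⟨ distribʳ _ z w ⟨
      (z + w) * diagonal m (α ⊗ β)                                  ∎
      where
      split : ∀ k l → k ℕ.+ l ≡ suc m → ν (suc m) * (α k * β l) ≈ ν k * α k * β l + α k * (ν l * β l)
      split k l k+l≡1+m = trans
        (*-congʳ (trans (reflexive (≡.cong ν (≡.sym k+l≡1+m))) (ν-+ k l)))
        (solve 4 (λ m n a b → (m :+ n) :* (a :* b) := m :* a :* b :+ a :* (n :* b)) refl _ _ _ _)
      first : diagonal (suc m) (λ k l → ν k * α k * β l) ≈ z * diagonal m (α ⊗ β)
      first = begin
        0# * α 0 * β (suc m) + diagonal m (λ k l → ν (suc k) * α (suc k) * β l)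
          ≈⟨ +-cong (solve 2 (λ a b → 0: :* a :* b := 0:) refl _ _)
                    (diagonal-cong m (λ k l _ → trans (*-congʳ (proj₂ dp-α k)) (*-assoc _ _ _))) ⟩
        0# + diagonal m (λ k l → z * (α k * β l))  ≈⟨ +-identityˡ _ ⟩
        diagonal m (λ k l → z * (α k * β l))       ≈⟨ diagonal-* m z (α ⊗ β) ⟩
        z * diagonal m (α ⊗ β)                     ∎
      second : diagonal (suc m) (λ k l → α k * (ν l * β l)) ≈ w * diagonal m (α ⊗ β)
      second = begin
        diagonal (suc m) (λ k l → α k * (ν l * β l))  ≈⟨ diagonal-last m (λ k l → α k * (ν l * β l)) ⟩
        diagonal m (λ k l → α k * (ν (suc l) * β (suc l))) + α (suc m) * (0# * β 0)
          ≈⟨ +-cong (diagonal-cong m (λ k l _ → trans (*-congˡ (proj₂ dp-β l))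
                      (solve 3 (λ a w b → a :* (w :* b) := w :* (a :* b)) refl _ _ _)))
                    (solve 2 (λ a b → a :* (0: :* b) := 0:) refl _ _) ⟩
        diagonal m (λ k l → w * (α k * β l)) + 0#  ≈⟨ +-identityʳ _ ⟩
        diagonal m (λ k l → w * (α k * β l))       ≈⟨ diagonal-* m w (α ⊗ β) ⟩
        w * diagonal m (α ⊗ β)                     ∎

    module _ {γ} (dp-γ : IsDividedPower (z + w) γ)
             (ν-cancel : ∀ k {x y} → ν (suc k) * x ≈ ν (suc k) * y → x ≈ y) where

      -- The binomial theorem for divided powers: both sides satisfy the same recursion, which
      -- determines them once multiplication by m + 1 can be cancelled.
      diagonal-dividedPower : ∀ m → diagonal m (α ⊗ β) ≈ γ m
      diagonal-dividedPower zero    = trans (*-cong (proj₁ dp-α) (proj₁ dp-β))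
        (trans (*-identityˡ 1#) (sym (proj₁ dp-γ)))
      diagonal-dividedPower (suc m) = ν-cancel m (trans (diagonal-step m)
        (trans (*-congˡ (diagonal-dividedPower m)) (sym (proj₂ dp-γ m))))

      triangle-dividedPower : ∀ N (r : ℕ → Carrier) →
        triangle N (λ k l → r (k ℕ.+ l) * (α k * β l)) ≈ Σ< N (λ m → r m * γ m)
      triangle-dividedPower N r = trans (triangle-diagonals N _) (Σ<-cong N λ m → begin
        diagonal m (λ k l → r (k ℕ.+ l) * (α k * β l))
          ≈⟨ diagonal-cong m (λ k l k+l≡m → *-congʳ (reflexive (≡.cong r k+l≡m))) ⟩
        diagonal m (λ k l → r m * (α k * β l))  ≈⟨ diagonal-* m (r m) (α ⊗ β) ⟩
        r m * diagonal m (α ⊗ β)                ≈⟨ *-congˡ (diagonal-dividedPower m) ⟩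
        r m * γ m                               ∎)

-- Comparison of squares with triangles, and tails of exponential series.

module RealDoubleSums {c ℓ₁ ℓ₂} (R : RealNumbers c ℓ₁ ℓ₂) where
  open OrderedField R
  open ℝ-Solver
  open DoubleSums ℝ-commutativeRing
  open Limits R

  Σ<-nonneg : ∀ N {f} → (∀ k → 0# ≤ f k) → 0# ≤ Σ< N f
  Σ<-nonneg N 0≤f = sum-nonneg {N} (0≤f ∘ toℕ)

  Σ<-extend : ∀ {M N f} → M ℕ.≤ N → (∀ k → 0# ≤ f k) → Σ< M f ≤ Σ< N f
  Σ<-extend {N = N} ℕ.z≤n       0≤f = Σ<-nonneg N 0≤f
  Σ<-extend {suc M} {suc N} (ℕ.s≤s M≤N) 0≤f = +-monoʳ-≤ _ (Σ<-extend {M} {N} M≤N (0≤f ∘ suc))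

  triangle-nonneg : ∀ N {θ} → (∀ k l → 0# ≤ θ k l) → 0# ≤ triangle N θ
  triangle-nonneg zero    0≤θ = ≤-refl
  triangle-nonneg (suc N) 0≤θ = +-nonneg (Σ<-nonneg (suc N) (0≤θ 0)) (triangle-nonneg N (0≤θ ∘ suc))

  triangle≤rectangle : ∀ {N M θ} → N ℕ.≤ M → (∀ k l → 0# ≤ θ k l) → triangle N θ ≤ rectangle N M θ
  triangle≤rectangle {zero}  N≤M 0≤θ = ≤-refl
  triangle≤rectangle {suc N} N<M 0≤θ =
    +-mono-≤ (Σ<-extend N<M (0≤θ 0)) (triangle≤rectangle (ℕₚ.<⇒≤ N<M) (0≤θ ∘ suc))

  rectangle≤triangle : ∀ N M {θ} → (∀ k l → 0# ≤ θ k l) → rectangle N M θ ≤ triangle (N ℕ.+ M) θ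
  rectangle≤triangle zero    M 0≤θ = triangle-nonneg M 0≤θ
  rectangle≤triangle (suc N) M 0≤θ =
    +-mono-≤ (Σ<-extend (ℕₚ.m≤n⇒m≤1+n (ℕₚ.m≤n+m M N)) (0≤θ 0)) (rectangle≤triangle N M (0≤θ ∘ suc))

  -- The terms with k, l < N ≤ k + l, by which the product of two partial sums exceeds the partial
  -- sum of the Cauchy product.
  corner : ℕ → (ℕ → ℕ → Carrier) → Carrier
  corner N θ = rectangle N N θ - triangle N θ

  corner-linear : ∀ N x θ ψ → corner N (λ k l → θ k l + x * ψ k l) ≈ corner N θ + x * corner N ψ
  corner-linear N x θ ψ = trans
    (+-cong (rectangle-linear N N x θ ψ) (-‿cong (triangle-linear N x θ ψ)))
    (solve 5 (λ a b c d x → a :+ x :* b :- (c :+ x :* d) := a :- c :+ x :* (b :- d)) refl _ _ _ _ x)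

  corner-nonneg : ∀ N {θ} → (∀ k l → 0# ≤ θ k l) → 0# ≤ corner N θ
  corner-nonneg N 0≤θ = x≤y⇒0≤y-x (triangle≤rectangle {N} ℕₚ.≤-refl 0≤θ)

  -- The triangle inequality without absolute values: `corner` is linear and nonnegative on the two
  -- nonnegative families ψ + θ and ψ - θ.
  corner-bound : ∀ N {θ ψ} → (∀ k l → - ψ k l ≤ θ k l × θ k l ≤ ψ k l) →
    - corner N ψ ≤ corner N θ × corner N θ ≤ corner N ψ
  corner-bound N {θ} {ψ} ∣θ∣≤ψ =
    0≤y-x⇒x≤y (trans (corner-linear N 1# θ ψ) (solve 2 (λ t p → t :+ 1: :* p := t :- :- p) refl _ _))
      (corner-nonneg N (λ k l → ≤-respʳ-≈ (solve 2 (λ t p → t :- :- p := t :+ 1: :* p) refl _ _)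
        (x≤y⇒0≤y-x (proj₁ (∣θ∣≤ψ k l))))) ,
    0≤y-x⇒x≤y (trans (corner-linear N (- 1#) ψ θ) (solve 2 (λ p t → p :+ :- 1: :* t := p :- t) refl _ _))
      (corner-nonneg N (λ k l → ≤-respʳ-≈ (solve 2 (λ t p → p :- t := p :+ :- 1: :* t) refl _ _)
        (x≤y⇒0≤y-x (proj₂ (∣θ∣≤ψ k l)))))

  module _ (y : ℕ → Carrier) (x : Carrier) (0≤y : ∀ m → 0# ≤ y m) (0≤x : 0# ≤ x)
           (y-step : ∀ m → fromNat (suc m) * y (suc m) ≈ x * y m) where
    private
      -- From M > 2x on, the ratio x / (m + 1) of successive terms is at most 1/2.
      M : ℕ
      M = proj₁ (archimedean (x + x))

      halving : ∀ {m} → M ℕ.≤ m → y (suc m) + y (suc m) ≤ y m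
      halving {m} M≤m = *-cancelˡ-≤ (0<fromNat (suc m)) (begin
        fromNat (suc m) * (y (suc m) + y (suc m))
          ≈⟨ distribˡ _ _ _ ⟩
        fromNat (suc m) * y (suc m) + fromNat (suc m) * y (suc m)
          ≈⟨ +-cong (y-step m) (y-step m) ⟩
        x * y m + x * y m
          ≈⟨ distribʳ (y m) x x ⟨
        (x + x) * y m
          ≤⟨ *-monoʳ-≤ (0≤y m) (≤-trans (<⇒≤ (proj₂ (archimedean (x + x)))) (fromNat-mono-≤ (ℕₚ.m≤n⇒m≤1+n M≤m))) ⟩
        fromNat (suc m) * y m
          ∎)
        where open ≤-Reasoning

      decreasing : ∀ {m} → M ℕ.≤ m → y (suc m) ≤ y m
      decreasing M≤m = ≤-trans (≤-respˡ-≈ (+-identityʳ _) (+-monoʳ-≤ _ (0≤y _))) (halving M≤m)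

      bound : ∀ {m} → M ℕ.≤′ m → y m ≤ y M
      bound ℕ.≤′-refl        = ≤-refl
      bound (ℕ.≤′-step M≤m) = ≤-trans (decreasing (ℕₚ.≤′⇒≤ M≤m)) (bound M≤m)

      -- Σ_{k<m} y k + 2 y m does not increase once y halves at each step.
      potential : ℕ → Carrier
      potential m = Σ< m y + (y m + y m)

      potential-decreasing : ∀ {m n} → M ℕ.≤ m → m ℕ.≤′ n → potential n ≤ potential m
      potential-decreasing M≤m ℕ.≤′-refl = ≤-refl
      potential-decreasing {m} {suc n} M≤m (ℕ.≤′-step m≤n) = begin
        Σ< (suc n) y + (y (suc n) + y (suc n))  ≤⟨ +-mono-≤ (≤-reflexive (Σ<-last n y)) (halving (ℕₚ.≤-trans M≤m (ℕₚ.≤′⇒≤ m≤n))) ⟩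
        Σ< n y + y n + y n                      ≈⟨ +-assoc _ _ _ ⟩
        potential n                             ≤⟨ potential-decreasing M≤m m≤n ⟩
        potential m                             ∎
        where open ≤-Reasoning

      y-small : ∀ ε → 0# < ε → ∃[ N ] (∀ n → N ℕ.≤ n → y n < ε)
      y-small ε 0<ε with archimedean (recip ε 0<ε * (x * y M))
      ... | M′ , B<M′ = suc (M ℕ.⊔ M′) , small
        where
        open ≤-Reasoning
        small : ∀ n → suc (M ℕ.⊔ M′) ℕ.≤ n → y n < ε
        small (suc m) (ℕ.s≤s M⊔M′≤m) = *-cancelˡ-< (0<fromNat (suc m)) (begin-strict
          fromNat (suc m) * y (suc m)    ≈⟨ y-step m ⟩
          x * y m                        ≤⟨ *-monoˡ-≤ 0≤x (bound (ℕₚ.≤⇒≤′ (ℕₚ.m⊔n≤o⇒m≤o M M′ M⊔M′≤m))) ⟩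
          x * y M                        ≈⟨ x*recip-x*y≈y ε 0<ε _ ⟨
          ε * (recip ε 0<ε * (x * y M))  <⟨ *-monoˡ-< 0<ε B<M′ ⟩
          ε * fromNat M′                 ≤⟨ *-monoˡ-≤ (<⇒≤ 0<ε) (fromNat-mono-≤ (ℕₚ.m≤n⇒m≤1+n (ℕₚ.m⊔n≤o⇒n≤o M M′ M⊔M′≤m))) ⟩
          ε * fromNat (suc m)            ≈⟨ *-comm _ _ ⟩
          fromNat (suc m) * ε            ∎)

    -- Here y m = y 0 · xᵐ / m!. Once n is at least M, the potential at 2n is at most that at n, so
    -- the terms from n to 2n - 1 add up to at most 2 y n, which tends to 0.
    null-tail : Null (λ N → Σ< (N ℕ.+ N) y - Σ< N y)
    null-tail ε 0<ε with y-small (half ε) (0<half 0<ε)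
    ... | N₀ , small = M ℕ.⊔ N₀ , λ n M⊔N₀≤n →
      <-≤-trans (<-respʳ-≈ -0#≈0# (neg-anti-< 0<ε))
        (x≤y⇒0≤y-x (Σ<-extend (ℕₚ.m≤m+n n n) 0≤y)) ,
      (begin-strict
        Σ< (n ℕ.+ n) y - Σ< n y                          ≤⟨ +-monoˡ-≤ _ (≤-respˡ-≈ (+-identityʳ _) (+-monoʳ-≤ _ (+-nonneg (0≤y _) (0≤y _)))) ⟩
        potential (n ℕ.+ n) - Σ< n y                     ≤⟨ +-monoˡ-≤ _ (potential-decreasing (ℕₚ.m⊔n≤o⇒m≤o M N₀ M⊔N₀≤n) (ℕₚ.≤⇒≤′ (ℕₚ.m≤m+n n n))) ⟩
        Σ< n y + (y n + y n) - Σ< n y                    ≈⟨ solve 2 (λ s y → s :+ (y :+ y) :- s := y :+ y) refl _ _ ⟩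
        y n + y n                                        <⟨ +-mono-< (small n (ℕₚ.m⊔n≤o⇒n≤o M N₀ M⊔N₀≤n)) (small n (ℕₚ.m⊔n≤o⇒n≤o M N₀ M⊔N₀≤n)) ⟩
        half ε + half ε                                  ≈⟨ half+half ε ⟩
        ε                                                ∎)
      where open ≤-Reasoning

-- Divided powers zᵏ / k! and the limit of a weighted Cauchy product.

module DividedPowers {c ℓ₁ ℓ₂} (R : RealNumbers c ℓ₁ ℓ₂) where
  open OrderedField R
  open ℝ-Solver
  open ComplexNumbers R
  open Limits R
  open RealDoubleSums R
  module ΣR = DoubleSums ℝ-commutativeRing
  module ΣC = DoubleSums ℂ-commutativeRing
  open Algebra.Definitions.RawSemiring (RawRing.rawSemiring rawRing) using (_^_)

  1/! : ℕ → Carrier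
  1/! k = 1/_ (k !) {{k ℕₚ.!≢0}}

  !*1/! : ∀ k → fromNat (k !) * 1/! k ≈ 1#
  !*1/! k = recip-inverseʳ _ (0<fromNat (k !) {{k ℕₚ.!≢0}})

  0≤1/! : ∀ k → 0# ≤ 1/! k
  0≤1/! k = <⇒≤ (0<recip _ (0<fromNat (k !) {{k ℕₚ.!≢0}}))

  1/!-zero : 1/! 0 ≈ 1#
  1/!-zero = trans (solve 1 (λ x → x := (1: :+ 0:) :* x) refl _) (!*1/! 0)

  1/!-suc : ∀ k → fromNat (suc k) * 1/! (suc k) ≈ 1/! k
  1/!-suc k = *-cancelˡ-≈ (0<fromNat (k !) {{k ℕₚ.!≢0}}) (trans
    (trans (solve 3 (λ a b c → a :* (b :* c) := b :* a :* c) refl _ _ _)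
      (trans (*-congʳ (sym (fromNat-* (suc k) (k !)))) (!*1/! (suc k))))
    (sym (!*1/! k)))

  infix 8 _^[_] _^ᶜ[_]
  _^[_] : Carrier → ℕ → Carrier
  x ^[ k ] = 1/! k * x ^ k

  _^ᶜ[_] : ℂ R → ℕ → ℂ R
  z ^ᶜ[ k ] = real R (1/! k) C.* z C.^ k

  isDividedPower : ∀ x → ΣR.IsDividedPower x (x ^[_])
  isDividedPower x = trans (*-identityʳ _) 1/!-zero , λ k →
    trans (solve 4 (λ n f x p → n :* (f :* (x :* p)) := x :* (n :* f :* p)) refl _ _ _ _)
      (*-congˡ (*-congʳ (1/!-suc k)))

  ν-real : ∀ n → ΣC.ν n C.≈ real R (fromNat n)
  ν-real zero    = C.refl
  ν-real (suc n) = C.trans (C.+-congˡ (ν-real n)) (C.sym (real-+ 1# (fromNat n)))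

  isDividedPowerᶜ : ∀ z → ΣC.IsDividedPower z (z ^ᶜ[_])
  isDividedPowerᶜ z = C.trans (C.*-identityʳ _) (real-cong 1/!-zero) , λ k →
    C.trans (C.*-congʳ (ν-real (suc k)))
      (C.trans (C.Solver.solve 4 (λ n f x p → n :*ᶜ (f :*ᶜ (x :*ᶜ p)) :=ᶜ x :*ᶜ (n :*ᶜ f :*ᶜ p)) C.refl _ _ _ _)
        (C.*-congˡ (C.*-congʳ (C.trans (C.sym (real-* _ _)) (real-cong (1/!-suc k))))))
    where open C.Solver using () renaming (_:*_ to _:*ᶜ_; _:=_ to _:=ᶜ_)

  ν-cancelᶜ : ∀ k {z w} → ΣC.ν (suc k) C.* z C.≈ ΣC.ν (suc k) C.* w → z C.≈ w
  ν-cancelᶜ k {z} {w} νz≈νw = C.trans (C.sym (lemma z)) (C.trans (C.*-congˡ νz≈νw) (lemma w))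
    where
    r = recip (fromNat (suc k)) (0<fromNat (suc k))
    lemma : ∀ z → real R r C.* (ΣC.ν (suc k) C.* z) C.≈ z
    lemma z = C.trans (C.sym (C.*-assoc _ _ _)) (C.trans (C.*-congʳ
      (C.trans (C.*-congˡ (ν-real (suc k))) (C.trans (C.sym (real-* _ _))
        (real-cong (trans (*-comm _ _) (recip-inverseʳ _ _))))))
      (C.*-identityˡ z))

  ^-nonneg : ∀ {x} → 0# ≤ x → ∀ k → 0# ≤ x ^ k
  ^-nonneg 0≤x zero    = <⇒≤ 0<1
  ^-nonneg 0≤x (suc k) = *-nonneg 0≤x (^-nonneg 0≤x k)

  ^-+ : ∀ x k l → x ^ (k ℕ.+ l) ≈ x ^ k * x ^ l
  ^-+ x zero    l = sym (*-identityˡ _)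
  ^-+ x (suc k) l = trans (*-congˡ (^-+ x k l)) (sym (*-assoc _ _ _))

  ^[]-nonneg : ∀ {x} → 0# ≤ x → ∀ k → 0# ≤ x ^[ k ]
  ^[]-nonneg 0≤x k = *-nonneg (0≤1/! k) (^-nonneg 0≤x k)

  ‖*‖²≤ : ∀ {z w x y} → ‖ z ‖² ≤ x * x → ‖ w ‖² ≤ y * y → ‖ z C.* w ‖² ≤ (x * y) * (x * y)
  ‖*‖²≤ {z} {w} {x} {y} z≤x w≤y = begin
    ‖ z C.* w ‖²         ≈⟨ ‖‖²-* z w ⟩
    ‖ z ‖² * ‖ w ‖²      ≤⟨ *-mono-≤ (‖‖²-nonneg w) (x²-nonneg x) z≤x w≤y ⟩
    x * x * (y * y)      ≈⟨ solve 2 (λ x y → x :* x :* (y :* y) := x :* y :* (x :* y)) refl x y ⟩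
    (x * y) * (x * y)    ∎
    where open ≤-Reasoning

  ‖real‖²≤ : ∀ x → ‖ real R x ‖² ≤ x * x
  ‖real‖²≤ x = ≤-reflexive (‖‖²-real x)

  ‖^‖²≤ : ∀ {z x} → ‖ z ‖² ≤ x * x → ∀ k → ‖ z C.^ k ‖² ≤ x ^ k * x ^ k
  ‖^‖²≤ z≤x zero    = ‖real‖²≤ 1#
  ‖^‖²≤ z≤x (suc k) = ‖*‖²≤ {_} {_ C.^ k} z≤x (‖^‖²≤ z≤x k)

  ‖^[]‖²≤ : ∀ {z x} → ‖ z ‖² ≤ x * x → ∀ k → ‖ z ^ᶜ[ k ] ‖² ≤ x ^[ k ] * x ^[ k ]
  ‖^[]‖²≤ {z} z≤x k = ‖*‖²≤ {real R (1/! k)} {z C.^ k} (‖real‖²≤ (1/! k)) (‖^‖²≤ z≤x k)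

  module Projection (π : ℂ R → Carrier) (π-0 : π C.0# ≈ 0#)
                    (π-+ : ∀ z w → π (z C.+ w) ≈ π z + π w) where
    π-Σ< : ∀ N f → π (ΣC.Σ< N f) ≈ ΣR.Σ< N (π ∘ f)
    π-Σ< zero    f = π-0
    π-Σ< (suc N) f = trans (π-+ _ _) (+-congˡ (π-Σ< N (f ∘ suc)))

    π-rectangle : ∀ M N θ → π (ΣC.rectangle M N θ) ≈ ΣR.rectangle M N (λ k l → π (θ k l))
    π-rectangle M N θ = trans (π-Σ< M (λ k → ΣC.Σ< N (θ k))) (ΣR.Σ<-cong M (λ k → π-Σ< N (θ k)))

    π-triangle : ∀ N θ → π (ΣC.triangle N θ) ≈ ΣR.triangle N (λ k l → π (θ k l))
    π-triangle zero    θ = π-0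
    π-triangle (suc N) θ = trans (π-+ _ _) (+-cong (π-Σ< (suc N) (θ 0)) (π-triangle N (θ ∘ suc)))

  module CauchyProduct {z w : ℂ R} {x y D : Carrier} (q : ℕ → Carrier)
      (0≤x : 0# ≤ x) (0≤y : 0# ≤ y) (0≤D : 0# ≤ D)
      (z≤x : ‖ z ‖² ≤ x * x) (w≤y : ‖ w ‖² ≤ y * y) (q≤D : ∀ m → q m * q m ≤ D ^ m * D ^ m) where

    -- With q m the (e, e) entry of aᵐ, these are the terms of the (e, e) entry of exp(za) exp(wa).
    -- Because the weight depends on k + l only, antidiagonals still collapse by the binomial
    -- theorem.
    term : ℕ → ℕ → ℂ R
    term k l = real R (q (k ℕ.+ l)) C.* (z ^ᶜ[ k ] C.* w ^ᶜ[ l ])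

    majorant : ℕ → ℕ → Carrier
    majorant k l = D ^ (k ℕ.+ l) * (x ^[ k ] * y ^[ l ])

    0≤majorant : ∀ k l → 0# ≤ majorant k l
    0≤majorant k l = *-nonneg (^-nonneg 0≤D (k ℕ.+ l)) (*-nonneg (^[]-nonneg 0≤x k) (^[]-nonneg 0≤y l))

    ‖term‖²≤ : ∀ k l → ‖ term k l ‖² ≤ majorant k l * majorant k l
    ‖term‖²≤ k l = ‖*‖²≤ {real R (q (k ℕ.+ l))} {z ^ᶜ[ k ] C.* w ^ᶜ[ l ]}
      (≤-trans (‖real‖²≤ (q (k ℕ.+ l))) (q≤D (k ℕ.+ l)))
      (‖*‖²≤ {z ^ᶜ[ k ]} {w ^ᶜ[ l ]} (‖^[]‖²≤ z≤x k) (‖^[]‖²≤ w≤y l))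

    diagonalBound : ℕ → Carrier
    diagonalBound m = D ^ m * (x + y) ^[ m ]

    triangle-majorant : ∀ N → ΣR.triangle N majorant ≈ ΣR.Σ< N diagonalBound
    triangle-majorant N = ΣR.triangle-dividedPower (isDividedPower x) (isDividedPower y)
      (isDividedPower (x + y)) (λ k → *-cancelˡ-≈ (0<fromNat (suc k))) N (D ^_)

    null-diagonals : Null (λ N → ΣR.Σ< (N ℕ.+ N) diagonalBound - ΣR.Σ< N diagonalBound)
    null-diagonals = null-tail diagonalBound (D * (x + y))
      (λ m → *-nonneg (^-nonneg 0≤D m) (^[]-nonneg (+-nonneg 0≤x 0≤y) m))
      (*-nonneg 0≤D (+-nonneg 0≤x 0≤y))
      (λ m → trans (solve 4 (λ n d p a → n :* (d :* p :* a) := d :* p :* (n :* a)) refl _ _ _ _)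
        (trans (*-congˡ (proj₂ (isDividedPower (x + y)) m))
          (solve 4 (λ d p s a → d :* p :* (s :* a) := d :* s :* (p :* a)) refl _ _ _ _)))

    -- The square of side N lies in the triangle of side 2N, so the corner is covered by the
    -- antidiagonals from N to 2N - 1, a piece of the tail of an exponential series.
    corner-majorant≤ : ∀ N →
      corner N majorant ≤ ΣR.Σ< (N ℕ.+ N) diagonalBound - ΣR.Σ< N diagonalBound
    corner-majorant≤ N = +-mono-≤
      (≤-respʳ-≈ (triangle-majorant (N ℕ.+ N)) (rectangle≤triangle N N 0≤majorant))
      (≤-reflexive (-‿cong (triangle-majorant N)))

    -- The map π stands for the real or the imaginary part: domination by the majorant is an order
    -- statement, so each part is squeezed separately.
    null-π : (π : ℂ R → Carrier) → π C.0# ≈ 0# → (∀ z w → π (z C.+ w) ≈ π z + π w) →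
      (∀ {z x} → 0# ≤ x → ‖ z ‖² ≤ x * x → - x ≤ π z × π z ≤ x) →
      Null (λ N → π (ΣC.rectangle N N term) - π (ΣC.triangle N term))
    null-π π π-0 π-+ π-bound = null-squeeze null-diagonals λ N →
      let lower , upper = corner-bound N {λ k l → π (term k l)} {majorant}
            (λ k l → π-bound {term k l} (0≤majorant k l) (‖term‖²≤ k l))
          eq = +-cong (π-rectangle N N term) (-‿cong (π-triangle N term))
      in ≤-trans (neg-anti-≤ (corner-majorant≤ N)) (≤-respʳ-≈ (sym eq) lower)
       , ≤-respˡ-≈ (sym eq) (≤-trans upper (corner-majorant≤ N))
      where open Projection π π-0 π-+

    triangle-term : ∀ N → ΣC.triangle N term C.≈ ΣC.Σ< N (λ m → real R (q m) C.* (z C.+ w) ^ᶜ[ m ])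
    triangle-term N = ΣC.triangle-dividedPower (isDividedPowerᶜ z) (isDividedPowerᶜ w)
      (isDividedPowerᶜ (z C.+ w)) ν-cancelᶜ N (real R ∘ q)

    cauchyProduct-limit : ∀ {l m} →
      (λ N → ΣC.rectangle N N term) ⟶ᶜ l →
      (λ N → ΣC.Σ< N (λ k → real R (q k) C.* (z C.+ w) ^ᶜ[ k ])) ⟶ᶜ m →
      l C.≈ m
    cauchyProduct-limit rect⟶l sum⟶m = ⟶ᶜ-unique
      (null-π re refl (λ _ _ → refl) (λ {z} → ‖‖²≤⇒∣re∣≤ {z}))
      (null-π im refl (λ _ _ → refl) (λ {z} → ‖‖²≤⇒∣im∣≤ {z}))
      rect⟶l (⟶ᶜ-cong (λ N → C.sym (triangle-term N)) C.refl sum⟶m)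

-- Sums against Kronecker deltas, and products of finite sums.

module DeltaSums {c ℓ} (K : CommutativeRing c ℓ) where
  open CommutativeRing K
  open Algebra.Properties.Semiring.Sum semiring
    using (sum; sum-cong-≋; sum-replicate-zero)

  δ : ∀ {n} → Fin n → Fin n → Carrier
  δ i j = if ⌊ i ≟ᶠ j ⌋ then 1# else 0#

  δ-refl : ∀ {n} (i : Fin n) → δ i i ≈ 1#
  δ-refl i with i ≟ᶠ i
  ... | yes _   = refl
  ... | no  i≢i = contradiction ≡.refl i≢i

  sum-zero : ∀ {n} (f : Fin n → Carrier) → (∀ i → f i ≈ 0#) → sum f ≈ 0#
  sum-zero {n} f f≈0 = trans (sum-cong-≋ f≈0) (sum-replicate-zero n)

  δ-suc : ∀ {n} (i j : Fin n) → δ (Fin.suc i) (Fin.suc j) ≡ δ i j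
  δ-suc i j with i ≟ᶠ j
  ... | record { does = true }  = ≡.refl
  ... | record { does = false } = ≡.refl

  sum-δ : ∀ {n} (f : Fin n → Carrier) (j : Fin n) → sum (λ i → δ i j * f i) ≈ f j
  sum-δ {suc n} f Fin.zero    = trans
    (+-cong (*-identityˡ _) (sum-zero _ (λ i → zeroˡ (f (Fin.suc i))))) (+-identityʳ _)
  sum-δ {suc n} f (Fin.suc j) = trans
    (+-cong (zeroˡ _) (trans (sum-cong-≋ (λ i → *-congʳ (reflexive (δ-suc i j)))) (sum-δ (f ∘ Fin.suc) j)))
    (+-identityˡ _)

module ProductOfSums {c ℓ} (K : CommutativeRing c ℓ) where
  open CommutativeRing K
  open DoubleSums K
  open Algebra.Properties.Semiring.Sum semiring
    using (sum; sum-cong-≋; ∑-comm; *-distribˡ-sum; *-distribʳ-sum)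
  open IntegerRingSolver K
  open import Relation.Binary.Reasoning.Setoid setoid

  sum-of-products : ∀ {n} N (p : ℕ → Fin n → Carrier) (r α β : ℕ → Carrier) →
    (∀ k l → sum (λ h → p k h * p l h) ≈ r (k ℕ.+ l)) →
    sum (λ h → Σ< N (λ k → p k h * α k) * Σ< N (λ l → p l h * β l)) ≈
    rectangle N N (λ k l → r (k ℕ.+ l) * (α k * β l))
  sum-of-products {n} N p r α β p-product = begin
    sum (λ h → Σ< N (λ k → p k h * α k) * Σ< N (λ l → p l h * β l))
      ≈⟨ sum-cong-≋ (λ h → trans (*-distribʳ-sum {N} _ _)
           (sum-cong-≋ {N} (λ k → *-distribˡ-sum {N} (p (toℕ k) h * α (toℕ k)) _))) ⟩
    sum (λ h → rectangle N N (λ k l → t k l h))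
      ≈⟨ ∑-comm {n} {N} (λ h k → Σ< N (λ l → t (toℕ k) l h)) ⟩
    Σ< N (λ k → sum (λ h → Σ< N (λ l → t k l h)))
      ≈⟨ Σ<-cong N (λ k → ∑-comm {n} {N} (λ h l → t k (toℕ l) h)) ⟩
    rectangle N N (λ k l → sum (t k l))
      ≈⟨ Σ<-cong N (λ k → Σ<-cong N (λ l → trans
           (sum-cong-≋ {n} {t k l} {λ h → p k h * p l h * (α k * β l)} (λ h → solve 4 (λ a b c d → (a :* b) :* (c :* d)
               := (a :* c) :* (b :* d)) refl (p k h) (α k) (p l h) (β l)))
           (trans (sym (*-distribʳ-sum (α k * β l) (λ h → p k h * p l h))) (*-congʳ (p-product k l))))) ⟩
    rectangle N N (λ k l → r (k ℕ.+ l) * (α k * β l)) ∎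
    where
    t : ℕ → ℕ → Fin n → Carrier
    t k l h = p k h * α k * (p l h * β l)

-- The columns aᵏe and the column exp(za)e for a real matrix a.

module Walk {c ℓ₁ ℓ₂} (R : RealNumbers c ℓ₁ ℓ₂) {n : ℕ}
  (a : Fin n → Fin n → RealNumbers.Carrier R) (e : Fin n) where
  open OrderedField R
  open ComplexNumbers R
  open Limits R
  open DividedPowers R
  open DeltaSums ℝ-commutativeRing
  open Algebra.Definitions.RawSemiring (RawRing.rawSemiring rawRing) using (_^_)

  powerColumn : ℕ → Fin n → Carrier
  powerColumn zero    h = δ h e
  powerColumn (suc k) h = sum (λ j → a h j * powerColumn k j)

  P : ℕ → Fin n → ℂ R
  P k h = real R (powerColumn k h)

  partialSum : ℂ R → Fin n → ℕ → ℂ R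
  partialSum z h N = ΣC.Σ< N (λ k → P k h C.* z ^ᶜ[ k ])

  IsExpColumn : ℂ R → (Fin n → ℂ R) → Set _
  IsExpColumn z u = ∀ h → partialSum z h ⟶ᶜ u h

  ^ᶜ-cong : ∀ {z w} → z C.≈ w → ∀ k → z C.^ k C.≈ w C.^ k
  ^ᶜ-cong z≈w zero    = C.refl
  ^ᶜ-cong z≈w (suc k) = C.*-cong z≈w (^ᶜ-cong z≈w k)

  partialSum-cong : ∀ {z w} → z C.≈ w → ∀ h N → partialSum z h N C.≈ partialSum w h N
  partialSum-cong {z} {w} z≈w h N = ΣC.Σ<-cong N {g = λ k → P k h C.* w ^ᶜ[ k ]}
    (λ k → C.*-congˡ {P k h} (C.*-congˡ {real R (1/! k)} (^ᶜ-cong z≈w k)))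

  partialSum-conj : ∀ z h N → conj R (partialSum z h N) C.≈ partialSum (conj R z) h N
  partialSum-conj z h N = C.trans (conj-sum {N} (λ k → P (toℕ k) h C.* z ^ᶜ[ toℕ k ]))
    (ΣC.Σ<-cong N {g = λ k → P k h C.* conj R z ^ᶜ[ k ]} λ k →
      C.trans (conj-* (P k h) (z ^ᶜ[ k ])) (C.*-cong (conj-real (powerColumn k h))
        (C.trans (conj-* (real R (1/! k)) (z C.^ k)) (C.*-cong (conj-real (1/! k)) (conj-^ z k)))))

  expColumn-conj : ∀ {z u} → IsExpColumn z u → IsExpColumn (conj R z) (conj R ∘ u)
  expColumn-conj {z} exp h = ⟶ᶜ-cong (partialSum-conj z h) C.refl (⟶ᶜ-conj (exp h))

  partialSum-zero : ∀ h N → partialSum C.0# h (suc N) C.≈ real R (δ h e)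
  partialSum-zero h N = C.trans
    (C.+-cong (C.trans (C.*-congˡ {P 0 h} (C.trans (C.*-identityʳ (real R (1/! 0))) (real-cong 1/!-zero))) (C.*-identityʳ (P 0 h)))
      (C.trans (ΣC.Σ<-cong N {λ k → P (suc k) h C.* C.0# ^ᶜ[ suc k ]} {λ _ → C.0#} (λ k →
          C.Solver.solve 3 (λ q f w → q :* (f :* (0: :* w)) := 0:) C.refl (P (suc k) h) (real R (1/! (suc k))) (C.0# C.^ k)))
        (C.sum-replicate-zero N)))
    (C.+-identityʳ (P 0 h))
    where open C.Solver using (_:*_; _:=_; 0:)

  expColumn-zero : ∀ {z u} → z C.≈ C.0# → IsExpColumn z u → ∀ h → u h C.≈ real R (δ h e)
  expColumn-zero {z} {u} z≈0 exp h = ⟶ᶜ-unique (eventually re proj₁ ) (eventually im proj₂) (exp h) (⟶ᶜ-const _)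
    where
    eventually : (π : ℂ R → Carrier) → (∀ {z w} → z C.≈ w → π z ≈ π w) →
      Null (λ N → π (partialSum z h N) - π (real R (δ h e)))
    -- The threshold is 1 because the empty partial sum still misses the identity term of the
    -- series.
    eventually π π-cong ε 0<ε = 1 , λ where
      (suc N) _ → ∣∣<-cong
        (sym (trans (+-congʳ (π-cong (C.trans (partialSum-cong z≈0 h (suc N)) (partialSum-zero h N)))) (-‿inverseʳ _)))
        (proj₂ (null-0 ε 0<ε) 0 ℕ.z≤n)

  module _ (a-sym : ∀ i j → a i j ≈ a j i) where

    -- Symmetry moves one factor a across the inner product, ⟨a u, w⟩ = ⟨u, a w⟩.
    powerColumn-shift : ∀ k l → sum (λ h → powerColumn (suc k) h * powerColumn l h) ≈
                                sum (λ h → powerColumn k h * powerColumn (suc l) h)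
    powerColumn-shift k l = begin
      sum (λ h → sum (λ j → a h j * p j) * r h)       ≈⟨ sum-cong-≋ (λ h → *-distribʳ-sum (r h) (λ j → a h j * p j)) ⟩
      sum (λ h → sum (λ j → a h j * p j * r h))       ≈⟨ ∑-comm (λ h j → a h j * p j * r h) ⟩
      sum (λ j → sum (λ h → a h j * p j * r h))
        ≈⟨ sum-cong-≋ (λ j → sum-cong-≋ (λ h → trans (*-congʳ (*-congʳ (a-sym h j)))
             (solve 3 (λ a p r → a :* p :* r := p :* (a :* r)) refl _ _ _))) ⟩
      sum (λ j → sum (λ h → p j * (a j h * r h)))     ≈⟨ sum-cong-≋ (λ j → sym (*-distribˡ-sum (p j) (λ h → a j h * r h))) ⟩
      sum (λ j → p j * sum (λ h → a j h * r h))       ∎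
      where
      p = powerColumn k
      r = powerColumn l
      open ℝ-Solver
      open import Relation.Binary.Reasoning.Setoid (CommutativeRing.setoid ℝ-commutativeRing)

    powerColumn-product : ∀ k l → sum (λ h → powerColumn k h * powerColumn l h) ≈ powerColumn (k ℕ.+ l) e
    powerColumn-product zero    l = sum-δ (powerColumn l) e
    powerColumn-product (suc k) l = trans (powerColumn-shift k l)
      (trans (powerColumn-product k (suc l)) (reflexive (≡.cong (λ m → powerColumn m e) (ℕₚ.+-suc k l))))

    module _ (0≤a : ∀ i j → 0# ≤ a i j) (a≤1 : ∀ i j → a i j ≤ 1#) where

      δ-bounds : ∀ {m} (i j : Fin m) → 0# ≤ δ i j × δ i j ≤ 1#
      δ-bounds i j with ⌊ i ≟ᶠ j ⌋
      ... | true  = <⇒≤ 0<1 , ≤-refl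
      ... | false = ≤-refl , <⇒≤ 0<1

      -- Entries in [0, 1] cost at most a factor n per step. This supplies the geometric bound on
      -- the weights of the Cauchy product.
      powerColumn-bounds : ∀ k h → 0# ≤ powerColumn k h × powerColumn k h ≤ fromNat n ^ k
      powerColumn-bounds zero    h = δ-bounds h e
      powerColumn-bounds (suc k) h =
        sum-nonneg (λ j → *-nonneg (0≤a h j) (proj₁ (powerColumn-bounds k j))) ,
        ≤-respʳ-≈ (sum-const n _) (sum-mono-≤ (λ j → ≤-respʳ-≈ (*-identityˡ _)
          (*-mono-≤ (proj₁ (powerColumn-bounds k j)) (<⇒≤ 0<1) (a≤1 h j) (proj₂ (powerColumn-bounds k j)))))

      -- Since a is symmetric, this is the (e , e) entry of exp (z a) exp (w a) = exp ((z + w) a).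
      expColumn-product : ∀ {z w x y u v} {uv : ℂ R} → 0# ≤ x → 0# ≤ y → ‖ z ‖² ≤ x * x → ‖ w ‖² ≤ y * y →
        IsExpColumn z u → IsExpColumn w v → partialSum (z C.+ w) e ⟶ᶜ uv → C.sum (λ h → u h C.* v h) C.≈ uv
      expColumn-product {z} {w} {x} {y} {u} {v} 0≤x 0≤y z≤x w≤y exp-z exp-w exp-z+w =
        cauchyProduct-limit (⟶ᶜ-cong product≈rectangle C.refl (⟶ᶜ-sum (λ h → ⟶ᶜ-* (exp-z h) (exp-w h)))) exp-z+w
        where
        q²-bound : ∀ m → powerColumn m e * powerColumn m e ≤ fromNat n ^ m * fromNat n ^ m
        q²-bound m = *-mono-≤ 0≤p (≤-trans 0≤p p≤n^m) p≤n^m p≤n^m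
          where
          0≤p = proj₁ (powerColumn-bounds m e)
          p≤n^m = proj₂ (powerColumn-bounds m e)

        open CauchyProduct {z} {w} {x} {y} {fromNat n} (λ m → powerColumn m e) 0≤x 0≤y (0≤fromNat n) z≤x w≤y q²-bound

        P-product : ∀ k l → C.sum (λ h → P k h C.* P l h) C.≈ real R (powerColumn (k ℕ.+ l) e)
        P-product k l = C.trans (C.sum-cong-≋ {n} {λ h → P k h C.* P l h}
            (λ h → C.sym (real-* (powerColumn k h) (powerColumn l h))))
          (C.trans (C.sym (real-sum (λ h → powerColumn k h * powerColumn l h))) (real-cong (powerColumn-product k l)))

        product≈rectangle : ∀ N → C.sum (λ h → partialSum z h N C.* partialSum w h N) C.≈ ΣC.rectangle N N term
        product≈rectangle N = ProductOfSums.sum-of-products ℂ-commutativeRing N P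
          (λ m → real R (powerColumn m e)) (z ^ᶜ[_]) (w ^ᶜ[_]) P-product

-- Gram matrices, frame operators and the Welch bound.

module GramSums {c ℓ} (K : CommutativeRing c ℓ) where
  open CommutativeRing K
  open Algebra.Properties.Semiring.Sum semiring
  open IntegerRingSolver K
  open DeltaSums K
  open import Relation.Binary.Reasoning.Setoid setoid

  sum-*-sum : ∀ {m n} (f : Fin m → Carrier) (g : Fin n → Carrier) →
    sum f * sum g ≈ sum (λ i → sum (λ j → f i * g j))
  sum-*-sum f g = trans (*-distribʳ-sum (sum g) f) (sum-cong-≋ (λ i → *-distribˡ-sum (f i) g))

  -- Tr (BB*) = Tr (GG*) for B = Σᵢ fᵢ gᵢᵀ and the Gram matrix G i j = Σₕ fᵢ(h) gⱼ(h).
  frame≈gram : ∀ {N n} (f g : Fin N → Fin n → Carrier) →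
    sum (λ h → sum (λ h′ → sum (λ i → f i h * g i h′) * sum (λ j → g j h * f j h′))) ≈
    sum (λ i → sum (λ j → sum (λ h → f i h * g j h) * sum (λ h′ → g i h′ * f j h′)))
  frame≈gram {N} {n} f g = begin
    sum (λ h → sum (λ h′ → sum (λ i → f i h * g i h′) * sum (λ j → g j h * f j h′)))
      ≈⟨ sum-cong-≋ (λ h → sum-cong-≋ (λ h′ → sum-*-sum (λ i → f i h * g i h′) (λ j → g j h * f j h′))) ⟩
    sum (λ h → sum (λ h′ → sum (λ i → sum (λ j → t h h′ i j))))
      ≈⟨ sum-cong-≋ (λ h → ∑-comm (λ h′ i → sum (λ j → t h h′ i j))) ⟩
    sum (λ h → sum (λ i → sum (λ h′ → sum (λ j → t h h′ i j))))
      ≈⟨ ∑-comm (λ h i → sum (λ h′ → sum (λ j → t h h′ i j))) ⟩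
    sum (λ i → sum (λ h → sum (λ h′ → sum (λ j → t h h′ i j))))
      ≈⟨ sum-cong-≋ (λ i → sum-cong-≋ (λ h → ∑-comm (λ h′ j → t h h′ i j))) ⟩
    sum (λ i → sum (λ h → sum (λ j → sum (λ h′ → t h h′ i j))))
      ≈⟨ sum-cong-≋ (λ i → ∑-comm (λ h j → sum (λ h′ → t h h′ i j))) ⟩
    sum (λ i → sum (λ j → sum (λ h → sum (λ h′ → t h h′ i j))))
      ≈⟨ sum-cong-≋ (λ i → sum-cong-≋ (λ j → trans
           (sum-cong-≋ (λ h → sum-cong-≋ (λ h′ →
             solve 4 (λ a b c d → (a :* b) :* (c :* d) := (a :* c) :* (b :* d)) refl (f i h) (g i h′) (g j h) (f j h′))))
           (sym (sum-*-sum (λ h → f i h * g j h) (λ h′ → g i h′ * f j h′))))) ⟩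
    sum (λ i → sum (λ j → sum (λ h → f i h * g j h) * sum (λ h′ → g i h′ * f j h′))) ∎
    where
    t : Fin n → Fin n → Fin N → Fin N → Carrier
    t h h′ i j = (f i h * g i h′) * (g j h * f j h′)

  sum-linear₃ : ∀ {n} x y z (f g k : Fin n → Carrier) →
    sum (λ i → x * f i + y * g i + z * k i) ≈ x * sum f + y * sum g + z * sum k
  sum-linear₃ x y z f g k = trans (∑-distrib-+ (λ i → x * f i + y * g i) (λ i → z * k i))
    (+-cong (trans (∑-distrib-+ (λ i → x * f i) (λ i → y * g i))
      (+-cong (sym (*-distribˡ-sum x f)) (sym (*-distribˡ-sum y g)))) (sym (*-distribˡ-sum z k)))

  δ-idem : ∀ {n} (i j : Fin n) → δ i j * δ i j ≈ δ i j
  δ-idem i j with ⌊ i ≟ᶠ j ⌋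
  ... | true  = *-identityˡ 1#
  ... | false = zeroˡ 0#

module Welch {c ℓ₁ ℓ₂} (R : RealNumbers c ℓ₁ ℓ₂) {N n : ℕ}
  (ψ : Fin N → Fin n → ℂ R) (v : Fin n → RealNumbers.Carrier R) where
  open OrderedField R
  open ComplexNumbers R
  open GramSums ℝ-commutativeRing using (sum-linear₃; δ-idem; sum-*-sum)
  open DeltaSums ℝ-commutativeRing
  open ℝ-Solver
  open import Relation.Binary.Reasoning.Setoid (CommutativeRing.setoid ℝ-commutativeRing)

  gram : Fin N → Fin N → ℂ R
  gram i j = C.sum (λ h → ψ i h C.* conj R (ψ j h))

  -- The frame operator Σᵢ ψᵢψᵢ*. It has the same Hilbert-Schmidt norm as the Gram matrix, but acts
  -- on the space in which v lives.
  frame : Fin n → Fin n → ℂ R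
  frame h h′ = C.sum (λ i → ψ i h C.* conj R (ψ i h′))

  framePotential : Carrier
  framePotential = sum (λ i → sum (λ j → ‖ gram i j ‖²))

  ∣v∣² : Carrier
  ∣v∣² = sum (λ h → v h * v h)

  -- |v|² times the orthogonal projection onto the complement of v.
  projection : Fin n → Fin n → Carrier
  projection h h′ = ∣v∣² * δ h′ h - v h * v h′

  ∑₂ : (Fin n → Fin n → Carrier) → Carrier
  ∑₂ f = sum (λ h → sum (f h))

  ∑₂-cong : ∀ {f g} → (∀ h h′ → f h h′ ≈ g h h′) → ∑₂ f ≈ ∑₂ g
  ∑₂-cong f≈g = sum-cong-≋ (λ h → sum-cong-≋ (f≈g h))

  ∑₂-linear₃ : ∀ x y z f g k →
    ∑₂ (λ h h′ → x * f h h′ + y * g h h′ + z * k h h′) ≈ x * ∑₂ f + y * ∑₂ g + z * ∑₂ k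
  ∑₂-linear₃ x y z f g k = trans (sum-cong-≋ (λ h → sum-linear₃ x y z (f h) (g h) (k h)))
    (sum-linear₃ x y z (sum ∘ f) (sum ∘ g) (sum ∘ k))

  real-∑₂ : ∀ {m} (f : Fin m → Fin m → Carrier) →
    real R (sum (λ i → sum (f i))) C.≈ C.sum (λ i → C.sum (λ j → real R (f i j)))
  real-∑₂ f = C.trans (real-sum (sum ∘ f)) (C.sum-cong-≋ (λ i → real-sum (f i)))

  conj-sum-* : ∀ {m} (f g : Fin m → ℂ R) →
    conj R (C.sum (λ i → f i C.* conj R (g i))) C.≈ C.sum (λ i → conj R (f i) C.* g i)
  conj-sum-* f g = C.trans (conj-sum (λ i → f i C.* conj R (g i)))
    (C.sum-cong-≋ (λ i → C.trans (conj-* (f i) (conj R (g i))) (C.*-congˡ {conj R (f i)} (conj-conj (g i)))))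

  framePotential≈ : ∑₂ (λ h h′ → ‖ frame h h′ ‖²) ≈ framePotential
  framePotential≈ = proj₁ (C.trans (real-∑₂ (λ h h′ → ‖ frame h h′ ‖²)) (C.trans
    (C.sum-cong-≋ (λ h → C.sum-cong-≋ (λ h′ → C.trans (C.sym (z*conj-z (frame h h′)))
      (C.*-congˡ {frame h h′} (conj-sum-* (λ i → ψ i h) (λ i → ψ i h′))))))
    (C.trans (GramSums.frame≈gram ℂ-commutativeRing ψ (λ i h → conj R (ψ i h))) (C.trans
    (C.sum-cong-≋ (λ i → C.sum-cong-≋ (λ j → C.trans
      (C.*-congˡ {gram i j} (C.sym (conj-sum-* (ψ i) (ψ j)))) (z*conj-z (gram i j)))))
    (C.sym (real-∑₂ (λ i j → ‖ gram i j ‖²)))))))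

  module _ (unit : ∀ i → gram i i C.≈ C.1#) (orthogonal : ∀ i → C.sum (λ h → real R (v h) C.* ψ i h) C.≈ C.0#) where

    -- The frame operator kills v because every ψᵢ is orthogonal to v; as v is real, its real part
    -- kills v too.
    frame-v : ∀ h′ → sum (λ h → v h * re (frame h h′)) ≈ 0#
    frame-v h′ = trans
      (trans (sum-cong-≋ (λ h → solve 3 (λ v x y → v :* x
          := v :* x :- 0: :* y) refl (v h) (re (frame h h′)) (im (frame h h′))))
        (sym (re-sum (λ h → real R (v h) C.* frame h h′))))
      (proj₁ (C.trans (C.sum-cong-≋ (λ h → C.*-distribˡ-sum (real R (v h)) (λ i → ψ i h C.* conj R (ψ i h′))))
        (C.trans (C.∑-comm (λ h i → real R (v h) C.* (ψ i h C.* conj R (ψ i h′))))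
        (DeltaSums.sum-zero ℂ-commutativeRing _ (λ i → C.trans
          (C.sum-cong-≋ (λ h → C.sym (C.*-assoc (real R (v h)) (ψ i h) (conj R (ψ i h′)))))
          (C.trans (C.sym (C.*-distribʳ-sum (conj R (ψ i h′)) (λ h → real R (v h) C.* ψ i h)))
          (C.trans (C.*-congʳ {conj R (ψ i h′)} (orthogonal i)) (C.zeroˡ (conj R (ψ i h′)))))))))) 

    frame-trace : sum (λ h → re (frame h h)) ≈ fromNat N
    frame-trace = trans (sym (re-sum (λ h → frame h h))) (trans
      (proj₁ (C.trans (C.∑-comm (λ h i → ψ i h C.* conj R (ψ i h))) (C.sum-cong-≋ unit)))
      (trans (re-sum {N} (λ _ → C.1#)) (trans (sum-const N 1#) (*-identityʳ _))))

    -- The frame operator B vanishes on v, so projecting onto the complement of v leaves its trace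
    -- unchanged: Tr(ΠB) = Tr B = N, up to the factor |v|².
    projection-frame : ∑₂ (λ h h′ → projection h h′ * re (frame h h′)) ≈ ∣v∣² * fromNat N
    projection-frame = begin
      ∑₂ (λ h h′ → projection h h′ * re (frame h h′))
        -- The zero summand pads the expression to the three terms of `∑₂-linear₃`.
        ≈⟨ ∑₂-cong (λ h h′ → solve 5 (λ w d a b f → (w :* d :- a :* b) :* f
            := w :* (d :* f) :+ :- 1: :* (b :* (a :* f)) :+ 0: :* 0:) refl
             ∣v∣² (δ h′ h) (v h) (v h′) (re (frame h h′))) ⟩
      ∑₂ (λ h h′ → ∣v∣² * (δ h′ h * re (frame h h′)) + - 1# * (v h′ * (v h * re (frame h h′))) + 0# * 0#)
        ≈⟨ ∑₂-linear₃ ∣v∣² (- 1#) 0# (λ h h′ → δ h′ h * re (frame h h′)) (λ h h′ → v h′ * (v h * re (frame h h′)))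
            (λ _ _ → 0#) ⟩
      ∣v∣² * ∑₂ (λ h h′ → δ h′ h * re (frame h h′)) + - 1# * ∑₂ (λ h h′ → v h′ * (v h * re (frame h h′))) + 0# * ∑₂
          (λ _ _ → 0#)
        ≈⟨ +-cong (+-cong (*-congˡ (trans (sum-cong-≋ (λ h → sum-δ (λ h′ → re (frame h h′)) h)) frame-trace))
             (*-congˡ (trans (∑-comm (λ h h′ → v h′ * (v h * re (frame h h′)))) (sum-zero _ (λ h′ → trans
               (sym (*-distribˡ-sum (v h′) (λ h → v h * re (frame h h′)))) (trans (*-congˡ (frame-v h′)) (zeroʳ _)))))))
             (zeroˡ _) ⟩
      ∣v∣² * fromNat N + - 1# * 0# + 0#
        ≈⟨ solve 1 (λ x → x :+ :- 1: :* 0: :+ 0: := x) refl _ ⟩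
      ∣v∣² * fromNat N ∎

    -- For a projection Tr Π² = Tr Π = n - 1, here scaled by |v|⁴; this is where the lost dimension
    -- enters the bound.
    projection² : ∑₂ (λ h h′ → projection h h′ * projection h h′) ≈ ∣v∣² * ∣v∣² * (fromNat n - 1#)
    projection² = begin
      ∑₂ (λ h h′ → projection h h′ * projection h h′)
        ≈⟨ ∑₂-cong (λ h h′ → trans
             (solve 4 (λ w d a b → (w :* d :- a :* b) :* (w :* d :- a :* b)
                 := w :* w :* (d :* d) :+ :- 2: :* w :* (d :* (a :* b)) :+ 1: :* ((a :* a) :* (b :* b))) refl
               ∣v∣² (δ h′ h) (v h) (v h′))
             (+-congʳ (+-congʳ (*-congˡ (trans (δ-idem h′ h) (sym (*-identityʳ _))))))) ⟩
      ∑₂ (λ h h′ → ∣v∣² * ∣v∣² * (δ h′ h * 1#) + - (1# + 1#) * ∣v∣² * (δ h′ h * (v h * v h′)) + 1# * ((v h * v h) * (v h′ * v h′)))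
        ≈⟨ ∑₂-linear₃ (∣v∣² * ∣v∣²) (- (1# + 1#) * ∣v∣²) 1# (λ h h′ → δ h′ h * 1#) (λ h h′ → δ h′ h * (v h * v h′))
            (λ h h′ → (v h * v h) * (v h′ * v h′)) ⟩
      ∣v∣² * ∣v∣² * ∑₂ (λ h h′ → δ h′ h * 1#) + - (1# + 1#) * ∣v∣² * ∑₂ (λ h h′ → δ h′ h * (v h * v h′)) + 1# * ∑₂
          (λ h h′ → (v h * v h) * (v h′ * v h′))
        ≈⟨ +-cong (+-cong (*-congˡ (trans (sum-cong-≋ {n} {λ h → sum (λ h′ → δ h′ h * 1#)} {λ _ → 1#} (λ h → sum-δ
            (λ _ → 1#) h)) (sum-const n 1#)))
             (*-congˡ (sum-cong-≋ {n} {λ h → sum (λ h′ → δ h′ h * (v h * v h′))} {λ h → v h * v h} (λ h → sum-δ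
                 (λ h′ → v h * v h′) h))))
             (*-congˡ (sym (sum-*-sum (λ h → v h * v h) (λ h′ → v h′ * v h′)))) ⟩
      ∣v∣² * ∣v∣² * (fromNat n * 1#) + - (1# + 1#) * ∣v∣² * ∣v∣² + 1# * (∣v∣² * ∣v∣²)
        ≈⟨ solve 2 (λ w n → w :* w :* (n :* 1:) :+ :- 2: :* w :* w :+ 1: :* (w :* w)
            := w :* w :* (n :- 1:)) refl ∣v∣² (fromNat n) ⟩
      ∣v∣² * ∣v∣² * (fromNat n - 1#) ∎

    -- The difference between the frame operator and x times the projection, multiplied by |v|² to
    -- avoid a division.
    deviation : Carrier → Fin n → Fin n → ℂ R
    deviation x h h′ = real R ∣v∣² C.* frame h h′ C.+ C.- real R (x * projection h h′)

    distance² : ∀ x → ∑₂ (λ h h′ → ‖ deviation x h h′ ‖²) ≈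
      ∣v∣² * ∣v∣² * (framePotential - (1# + 1#) * x * fromNat N + x * x * (fromNat n - 1#))
    distance² x = begin
      ∑₂ (λ h h′ → ‖ deviation x h h′ ‖²)
        ≈⟨ ∑₂-cong (λ h h′ → solve 5 (λ w x p b c →
             (w :* b :- 0: :* c :- x :* p) :* (w :* b :- 0: :* c :- x :* p) :+ (w :* c :+ 0: :* b :- 0:) :* (w :* c :+ 0: :* b :- 0:)
             := w :* w :* (b :* b :+ c :* c) :+ :- 2: :* w :* x :* (p :* b) :+ x :* x :* (p :* p)) refl
             ∣v∣² x (projection h h′) (re (frame h h′)) (im (frame h h′))) ⟩
      ∑₂ (λ h h′ → ∣v∣² * ∣v∣² * ‖ frame h h′ ‖² + - (1# + 1#) * ∣v∣² * x * (projection h h′ * re (frame h h′)) + x * x * (projection h h′ * projection h h′))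
        ≈⟨ ∑₂-linear₃ (∣v∣² * ∣v∣²) (- (1# + 1#) * ∣v∣² * x) (x * x) (λ h h′ → ‖ frame h h′ ‖²)
             (λ h h′ → projection h h′ * re (frame h h′)) (λ h h′ → projection h h′ * projection h h′) ⟩
      ∣v∣² * ∣v∣² * ∑₂ (λ h h′ → ‖ frame h h′ ‖²) + - (1# + 1#) * ∣v∣² * x * ∑₂
          (λ h h′ → projection h h′ * re (frame h h′)) + x * x * ∑₂ (λ h h′ → projection h h′ * projection h h′)
        ≈⟨ +-cong (+-cong (*-congˡ framePotential≈) (*-congˡ projection-frame)) (*-congˡ projection²) ⟩
      ∣v∣² * ∣v∣² * framePotential + - (1# + 1#) * ∣v∣² * x * (∣v∣² * fromNat N) + x * x * (∣v∣² * ∣v∣² * (fromNat n - 1#))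
        ≈⟨ solve 5 (λ w F x N n → w :* w :* F :+ :- 2: :* w :* x :* (w :* N) :+ x :* x :* (w :* w :* (n :- 1:))
            := w :* w :* (F :- 2: :* x :* N :+ x :* x :* (n :- 1:))) refl
             ∣v∣² framePotential x (fromNat N) (fromNat n) ⟩
      ∣v∣² * ∣v∣² * (framePotential - (1# + 1#) * x * fromNat N + x * x * (fromNat n - 1#)) ∎

    -- The squared Hilbert-Schmidt norm of `deviation` is nonnegative. For n > 1 the choice x = N /
    -- (n - 1) would give the usual N² / (n - 1); keeping x free avoids dividing by n - 1, which may
    -- be zero.
    welch-bound : 0# < ∣v∣² → ∀ x →
      (1# + 1#) * x * fromNat N ≤ framePotential + x * x * (fromNat n - 1#)
    welch-bound 0<w x = 0≤y-x⇒x≤y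
      (solve 3 (λ F y z → F :- y :+ z := F :+ z :- y) refl _ _ _)
      (*-cancelˡ-≤ (*-pos 0<w 0<w) (≤-respˡ-≈ (sym (zeroʳ _)) (≤-respʳ-≈ (distance² x)
        (sum-nonneg (λ h → sum-nonneg (λ h′ → ‖‖²-nonneg (deviation x h h′)))))))

-- The evolution of e, sampled at equally spaced times.

module Annihilator {c ℓ} (K : CommutativeRing c ℓ) where
  open CommutativeRing K
  open DoubleSums K
  open DeltaSums K
  open Algebra.Properties.Semiring.Sum semiring
    using (sum; sum-cong-≋; ∑-comm; *-distribˡ-sum; *-distribʳ-sum)

  annihilates-sum : ∀ {n} N (v : Fin n → Carrier) (p : ℕ → Fin n → Carrier) (α : ℕ → Carrier) →
    (∀ k → sum (λ h → v h * p k h) ≈ 0#) → sum (λ h → v h * Σ< N (λ k → p k h * α k)) ≈ 0#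
  annihilates-sum {n} N v p α v⊥p = trans
    (sum-cong-≋ (λ h → *-distribˡ-sum {N} (v h) (λ k → p (toℕ k) h * α (toℕ k))))
    (trans (∑-comm {n} {N} (λ h k → v h * (p (toℕ k) h * α (toℕ k))))
    (sum-zero {N} _ (λ k → trans
      (sum-cong-≋ (λ h → sym (*-assoc (v h) (p (toℕ k) h) (α (toℕ k)))))
      (trans (sym (*-distribʳ-sum (α (toℕ k)) (λ h → v h * p (toℕ k) h)))
      (trans (*-congʳ (v⊥p (toℕ k))) (zeroˡ _))))))

module Evolution {c ℓ₁ ℓ₂} (R : RealNumbers c ℓ₁ ℓ₂) {n : ℕ}
  (a : Fin n → Fin n → RealNumbers.Carrier R) (e : Fin n)
  (A : Matrix R n) (U : RealNumbers.Carrier R → Matrix R n) (isU : IsTransitionMatrix R A U) where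
  open OrderedField R
  open ComplexNumbers R
  open Limits R
  open DividedPowers R
  open Walk R a e
  open Mat R {n} using () renaming (_^_ to _^ᴹ_)

  phase : Carrier → ℂ R
  phase t = C.- (𝕚 R C.* real R t)

  module _ (A≈a : ∀ i j → A i j C.≈ real R (a i j)) where

    power-entry : ∀ z k h → (_•_ R z A ^ᴹ k) h e C.≈ z C.^ k C.* P k h
    power-entry z zero h with ⌊ h ≟ᶠ e ⌋
    ... | true  = C.sym (C.*-identityˡ C.1#)
    ... | false = C.sym (C.*-identityˡ C.0#)
    power-entry z (suc k) h = C.trans
      (C.sum-cong-≋ {n} {λ j → z C.* A h j C.* (_•_ R z A ^ᴹ k) j e} (λ j → C.trans
        (C.*-cong (C.*-congˡ {z} (A≈a h j)) (power-entry z k j))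
        (C.trans (C.Solver.solve 4 (λ z a w p → z :* a :* (w :* p)
            := z :* w :* (a :* p)) C.refl z (real R (a h j)) (z C.^ k) (P k j))
        (C.*-congˡ {z C.* z C.^ k} (C.sym (real-* (a h j) (powerColumn k j)))))))
      (C.trans (C.sym (C.*-distribˡ-sum (z C.* z C.^ k) (λ j → real R (a h j * powerColumn k j))))
      (C.*-congˡ {z C.* z C.^ k} (C.sym (real-sum (λ j → a h j * powerColumn k j)))))
      where open C.Solver using (_:*_; _:=_)

    expPartialSum-entry : ∀ z h N → expPartialSum R (_•_ R z A) N h e C.≈ partialSum z h N
    expPartialSum-entry z h N = C.trans
      (sumᴹ-entry {N} (λ k → _•_ R (real R (1/! (toℕ k))) (_•_ R z A ^ᴹ toℕ k)) h e)
      (C.sum-cong-≋ {N} (λ k → C.trans (C.*-congˡ {real R (1/! (toℕ k))} (power-entry z (toℕ k) h))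
        (C.Solver.solve 3 (λ f w p → f :* (w :* p)
            := p :* (f :* w)) C.refl (real R (1/! (toℕ k))) (z C.^ toℕ k) (P (toℕ k) h))))
      where open C.Solver using (_:*_; _:=_)

    expColumn : ∀ t → IsExpColumn (phase t) (λ h → U t h e)
    expColumn t h = ⟶ᶜ-cong (expPartialSum-entry (phase t) h) C.refl (isU t h e)

    -- Each partial sum of the exponential is a combination of the columns aᵏe, and orthogonality to
    -- v passes to the limit.
    orthogonal : ∀ (v : Fin n → Carrier) → (∀ k → sum (λ h → v h * powerColumn k h) ≈ 0#) →
      ∀ t → C.sum (λ h → real R (v h) C.* U t h e) C.≈ C.0#
    orthogonal v v⊥p t = ⟶ᶜ-unique {λ N → C.0#} {λ N → C.0#}
      (null-cong (λ _ → sym (-‿inverseʳ 0#)) null-0) (null-cong (λ _ → sym (-‿inverseʳ 0#)) null-0)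
      (⟶ᶜ-cong (λ N → Annihilator.annihilates-sum ℂ-commutativeRing N (real R ∘ v) P (phase t ^ᶜ[_])
          (λ k → C.trans (C.sum-cong-≋ (λ h → C.sym (real-* (v h) (powerColumn k h))))
            (C.trans (C.sym (real-sum (λ h → v h * powerColumn k h))) (real-cong (v⊥p k))))) C.refl
        (⟶ᶜ-sum (λ h → ⟶ᶜ-* (⟶ᶜ-const (real R (v h))) (expColumn t h))))
      (⟶ᶜ-const C.0#)

    module Grid (a-sym : ∀ i j → a i j ≈ a j i) (0≤a : ∀ i j → 0# ≤ a i j) (a≤1 : ∀ i j → a i j ≤ 1#)
                (τ : Carrier) (0≤τ : 0# ≤ τ) where
      open ℝ-Solver

      t : ℕ → Carrier
      t k = fromNat k * τ

      ψ : ℕ → Fin n → ℂ R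
      ψ k h = U (t k) h e

      returnProbability : ℕ → Carrier
      returnProbability k = ‖ ψ k e ‖²

      0≤t : ∀ k → 0# ≤ t k
      0≤t k = *-nonneg (0≤fromNat k) 0≤τ

      ‖phase‖² : ∀ x → ‖ phase x ‖² ≤ x * x
      ‖phase‖² x = ≤-reflexive (solve 1 (λ t →
        :- (0: :* t :- 1: :* 0:) :* :- (0: :* t :- 1: :* 0:) :+ :- (0: :* 0: :+ 1: :* t) :* :- (0: :* 0: :+ 1: :* t)
            := t :* t) refl x)

      inner : ℕ → ℕ → ℂ R
      inner i j = C.sum (λ h → ψ i h C.* conj R (ψ j h))

      -- Conjugating U(t)e reverses the sign of t because a is real. The exponential of the combined
      -- exponent is not constructed: the caller rewrites the exponent as w and supplies a known
      -- limit, an entry of `U` or its conjugate.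
      inner-limit : ∀ i j {w u} → phase (t i) C.+ conj R (phase (t j)) C.≈ w → partialSum w e ⟶ᶜ u → inner i j C.≈ u
      inner-limit i j {w} {u} z≈w w⟶u = expColumn-product a-sym 0≤a a≤1 {z = phase (t i)} {w = conj R (phase (t j))}
        {x = t i} {y = t j} {u = ψ i} {v = conj R ∘ ψ j} {uv = u} (0≤t i) (0≤t j)
        (‖phase‖² (t i)) (≤-respˡ-≈ (sym (‖‖²-conj (phase (t j)))) (‖phase‖² (t j)))
        (expColumn (t i)) (expColumn-conj (expColumn (t j)))
        (⟶ᶜ-cong (partialSum-cong (C.sym z≈w) e) C.refl w⟶u)

      t-+ : ∀ j d → t (j ℕ.+ d) ≈ t j + t d
      t-+ j d = trans (*-congʳ (fromNat-+ j d)) (distribʳ τ _ _)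

      inner-≥ : ∀ j d → inner (j ℕ.+ d) j C.≈ ψ d e
      inner-≥ j d = inner-limit (j ℕ.+ d) j
        ( solve 3 (λ s t d → :- (0: :* s :- 1: :* 0:) :+ :- (0: :* t :- 1: :* 0:)
            := :- (0: :* d :- 1: :* 0:)) refl (t (j ℕ.+ d)) (t j) (t d)
        , trans (+-congʳ (-‿cong (+-congˡ (*-congˡ (t-+ j d)))))
            (solve 2 (λ t d → :- (0: :* 0: :+ 1: :* (t :+ d)) :+ :- :- (0: :* 0: :+ 1: :* t)
                := :- (0: :* 0: :+ 1: :* d)) refl (t j) (t d)))
        (expColumn (t d) e)

      inner-≤ : ∀ j d → inner j (j ℕ.+ d) C.≈ conj R (ψ d e)
      inner-≤ j d = inner-limit j (j ℕ.+ d)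
        ( solve 3 (λ s t d → :- (0: :* t :- 1: :* 0:) :+ :- (0: :* s :- 1: :* 0:)
            := :- (0: :* d :- 1: :* 0:)) refl (t (j ℕ.+ d)) (t j) (t d)
        , trans (+-congˡ (-‿cong (-‿cong (+-congˡ (*-congˡ (t-+ j d))))))
            (solve 2 (λ t d → :- (0: :* 0: :+ 1: :* t) :+ :- :- (0: :* 0: :+ 1: :* (t :+ d))
                := :- :- (0: :* 0: :+ 1: :* d)) refl (t j) (t d)))
        (expColumn-conj (expColumn (t d)) e)

      -- Exchanging the two times conjugates the inner product and keeps its modulus, so the squared
      -- moduli of the Gram matrix form a symmetric Toeplitz matrix.
      ‖inner‖² : ∀ i j → ‖ inner i j ‖² ≈ returnProbability ℕ.∣ i - j ∣
      ‖inner‖² i j with ℕₚ.≤-total j i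
      ... | inj₁ j≤i with ℕₚ.m≤n⇒∃[o]m+o≡n j≤i
      ...   | d , ≡.refl rewrite ℕₚ.∣-∣-comm (j ℕ.+ d) j | ℕₚ.∣m-m+n∣≡n j d = ‖‖²-cong (inner-≥ j d)
      ‖inner‖² i j | inj₂ i≤j with ℕₚ.m≤n⇒∃[o]m+o≡n i≤j
      ...   | d , ≡.refl rewrite ℕₚ.∣m-m+n∣≡n i d = trans (‖‖²-cong (inner-≤ i d)) (‖‖²-conj (ψ d e))

      ψ-zero : ψ 0 e C.≈ C.1#
      ψ-zero = C.trans (expColumn-zero
          ( solve 1 (λ τ → :- (0: :* (0: :* τ) :- 1: :* 0:) := 0:) refl τ
          , solve 1 (λ τ → :- (0: :* 0: :+ 1: :* (0: :* τ)) := 0:) refl τ)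
          (expColumn (t 0)) e) (real-cong (DeltaSums.δ-refl ℝ-commutativeRing e))

      -- Unitarity is the case of equal times, where the inner product becomes U(0)ₑₑ.
      inner-diagonal : ∀ i → inner i i C.≈ C.1#
      inner-diagonal i = C.trans (C.reflexive (≡.cong (λ k → inner k i) (≡.sym (ℕₚ.+-identityʳ i))))
        (C.trans (inner-≥ i 0) ψ-zero)

      returnProbability-zero : returnProbability 0 ≈ 1#
      returnProbability-zero = trans (‖‖²-cong ψ-zero) (trans (‖‖²-real 1#) (*-identityˡ 1#))

      gram-bound : ∀ (v : Fin n → Carrier) → (∀ k → sum (λ h → v h * powerColumn k h) ≈ 0#) →
        0# < sum (λ h → v h * v h) → ∀ N x →
        (1# + 1#) * x * fromNat N ≤
          ΣR.rectangle N N (λ i j → returnProbability ℕ.∣ i - j ∣) + x * x * (fromNat n - 1#)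
      gram-bound v v⊥p 0<∣v∣² N x = ≤-respʳ-≈
        (+-congʳ (sum-cong-≋ {N} (λ i → sum-cong-≋ {N} (λ j → ‖inner‖² (toℕ i) (toℕ j)))))
        (welch-bound (λ i → inner-diagonal (toℕ i)) (λ i → orthogonal v v⊥p (t (toℕ i))) 0<∣v∣² x)
        where open Welch R {N} {n} (ψ ∘ toℕ) v

-- Upper and lower bounds for the sum of a Toeplitz matrix.

module ToeplitzSums {c ℓ₁ ℓ₂} (R : RealNumbers c ℓ₁ ℓ₂) where
  open OrderedField R
  open DoubleSums ℝ-commutativeRing using (Σ<; Σ<-last; rectangle)
  open RealDoubleSums R
  open ℝ-Solver
  open ≤-Reasoning

  -- Row 0 and column 0 contribute g 0 and two copies of the cumulative sum of g; what remains is
  -- the same matrix of size one less.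
  toeplitz-sum : ∀ N (g : ℕ → Carrier) → rectangle N N (λ i j → g ℕ.∣ i - j ∣) ≈
    fromNat N * g 0 + (1# + 1#) * Σ< N (λ i → Σ< i (g ∘ suc))
  toeplitz-sum zero    g = solve 1 (λ x → 0: := 0: :* x :+ 2: :* 0:) refl (g 0)
  toeplitz-sum (suc N) g = begin-equality
    g 0 + S N + Σ< N (λ i → g (suc i) + Σ< N (λ j → g ℕ.∣ i - j ∣))
      ≈⟨ +-congˡ (∑-distrib-+ {N} (λ i → g (suc (toℕ i))) (λ i → Σ< N (λ j → g ℕ.∣ toℕ i - j ∣))) ⟩
    g 0 + S N + (S N + rectangle N N (λ i j → g ℕ.∣ i - j ∣))
      ≈⟨ +-congˡ (+-congˡ (toeplitz-sum N g)) ⟩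
    g 0 + S N + (S N + (fromNat N * g 0 + (1# + 1#) * Σ< N S))
      ≈⟨ solve 4 (λ g s n t → g :+ s :+ (s :+ (n :* g :+ 2: :* t))
          := (1: :+ n) :* g :+ 2: :* (t :+ s)) refl (g 0) (S N) (fromNat N) (Σ< N S) ⟩
    fromNat (suc N) * g 0 + (1# + 1#) * (Σ< N S + S N)
      ≈⟨ +-congˡ (*-congˡ (Σ<-last N S)) ⟨
    fromNat (suc N) * g 0 + (1# + 1#) * Σ< (suc N) S ∎
    where
    S : ℕ → Carrier
    S i = Σ< i (g ∘ suc)

  Σ<-split : ∀ m n f → Σ< (m ℕ.+ n) f ≈ Σ< m f + Σ< n (f ∘ (m ℕ.+_))
  Σ<-split zero    n f = sym (+-identityˡ _)
  Σ<-split (suc m) n f = trans (+-congˡ (Σ<-split m n (f ∘ suc))) (sym (+-assoc _ _ _))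

  -- The cumulative sums of the return probability are controlled only at multiples of L, so every
  -- index of a block is moved up to the end of that block.
  monotone-block-sum : ∀ K L (S : ℕ → Carrier) → (∀ {i j} → i ℕ.≤ j → S i ≤ S j) →
    Σ< (K ℕ.* L) S ≤ fromNat L * Σ< K (λ j → S (suc j ℕ.* L))
  monotone-block-sum zero    L S mono = ≤-reflexive (sym (zeroʳ _))
  monotone-block-sum (suc K) L S mono = begin
    Σ< (L ℕ.+ K ℕ.* L) S
      ≈⟨ Σ<-split L (K ℕ.* L) S ⟩
    Σ< L S + Σ< (K ℕ.* L) (S ∘ (L ℕ.+_))
      ≤⟨ +-mono-≤
           (sum-mono-≤ {L} (λ k → mono (ℕₚ.≤-trans (ℕₚ.<⇒≤ (Finₚ.toℕ<n k)) (ℕₚ.m≤m+n L 0))))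
           (monotone-block-sum K L (S ∘ (L ℕ.+_)) (mono ∘ ℕₚ.+-monoʳ-≤ L)) ⟩
    sum {L} (λ _ → S (1 ℕ.* L)) + fromNat L * Σ< K (λ j → S (suc (suc j) ℕ.* L))
      ≈⟨ +-congʳ (sum-const L (S (1 ℕ.* L))) ⟩
    fromNat L * S (1 ℕ.* L) + fromNat L * Σ< K (λ j → S (suc (suc j) ℕ.* L))
      ≈⟨ distribˡ _ _ _ ⟨
    fromNat L * Σ< (suc K) (λ j → S (suc j ℕ.* L)) ∎

  Σ<-suc : ∀ K → (1# + 1#) * Σ< K (fromNat ∘ suc) ≈ fromNat K * (fromNat K + 1#)
  Σ<-suc zero    = solve 0 (2: :* 0: := 0: :* (0: :+ 1:)) refl
  Σ<-suc (suc K) = begin-equality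
    (1# + 1#) * Σ< (suc K) (fromNat ∘ suc)                     ≈⟨ *-congˡ (Σ<-last K (fromNat ∘ suc)) ⟩
    (1# + 1#) * (Σ< K (fromNat ∘ suc) + (1# + fromNat K))      ≈⟨ distribˡ _ _ _ ⟩
    (1# + 1#) * Σ< K (fromNat ∘ suc) + (1# + 1#) * (1# + fromNat K)
      ≈⟨ +-congʳ (Σ<-suc K) ⟩
    fromNat K * (fromNat K + 1#) + (1# + 1#) * (1# + fromNat K)
      ≈⟨ solve 1 (λ k → k :* (k :+ 1:) :+ 2: :* (1: :+ k) := (1: :+ k) :* (1: :+ k :+ 1:)) refl (fromNat K) ⟩
    fromNat (suc K) * (fromNat (suc K) + 1#) ∎

  -- The upper and lower bounds for the Toeplitz sum cross at 2n² + 2n + 1 blocks.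
  blockCount : ℕ → ℕ
  blockCount n = suc (2 ℕ.* (n ℕ.* n) ℕ.+ 2 ℕ.* n ℕ.+ 1)

  -- If the blocks of g have average at most (1 + 1/2n)/n, the Toeplitz sum is
  -- too small for the Welch bound in dimension n - 1.
  module _ (n : ℕ) .{{_ : NonZero n}} (L′ : ℕ) (g : ℕ → Carrier) (g0≈1 : g 0 ≈ 1#) (0≤g : ∀ k → 0# ≤ g k) where
    private
      ν = fromNat n
      two = 1# + 1#
      L = suc L′
      λ′ = fromNat L
      K = blockCount n
      κ = fromNat K

      S : ℕ → Carrier
      S i = Σ< i (g ∘ suc)

      N = K ℕ.* L
      F = rectangle N N (λ i j → g ℕ.∣ i - j ∣)

      κ≈ : κ ≈ two * (ν * ν) + two * ν + two
      κ≈ = trans (+-congˡ (trans (fromNat-+ (2 ℕ.* (n ℕ.* n) ℕ.+ 2 ℕ.* n) 1)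
          (+-congʳ (trans (fromNat-+ (2 ℕ.* (n ℕ.* n)) (2 ℕ.* n))
            (+-cong (trans (fromNat-* 2 (n ℕ.* n)) (*-congˡ (fromNat-* n n))) (fromNat-* 2 n))))))
        (solve 1 (λ n → 1: :+ ((1: :+ (1: :+ 0:)) :* (n :* n) :+ (1: :+ (1: :+ 0:)) :* n :+ (1: :+ 0:))
            := 2: :* (n :* n) :+ 2: :* n :+ 2:) refl ν)

      0<ν = 0<fromNat n
      0<two = +-pos 0<1 0<1
      0<λ′ = 0<fromNat L
      0<κ = 0<fromNat K

    toeplitz-upper : (∀ j → j ℕ.< K → two * (ν * ν) * S (suc j ℕ.* L) ≤ (two * ν + 1#) * λ′ * fromNat (suc j)) →
      two * (ν * ν) * F ≤ κ * (λ′ * λ′) * (two * (ν * ν) + (two * ν + 1#) * (κ + 1#))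
    toeplitz-upper small = begin
      two * (ν * ν) * F
        ≈⟨ *-congˡ (trans (toeplitz-sum N g) (+-congʳ (trans (*-congˡ g0≈1) (trans (*-identityʳ _) (fromNat-* K L))))) ⟩
      two * (ν * ν) * (κ * λ′ + two * Σ< N S)
        ≤⟨ *-monoˡ-≤ (<⇒≤ (*-pos 0<two (*-pos 0<ν 0<ν))) (+-monoʳ-≤ _ (*-monoˡ-≤ (<⇒≤ 0<two)
             (monotone-block-sum K L S (λ i≤j → Σ<-extend i≤j (0≤g ∘ suc))))) ⟩
      two * (ν * ν) * (κ * λ′ + two * (λ′ * Σ< K (λ j → S (suc j ℕ.* L))))
        ≈⟨ solve 4 (λ n k l s → 2: :* (n :* n) :* (k :* l :+ 2: :* (l :* s))
            := 2: :* (n :* n) :* k :* l :* 1: :+ 2: :* l :* (2: :* (n :* n) :* s)) refl ν κ λ′ _ ⟩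
      two * (ν * ν) * κ * λ′ * 1# + two * λ′ * (two * (ν * ν) * Σ< K (λ j → S (suc j ℕ.* L)))
        ≈⟨ +-congˡ (*-congˡ (*-distribˡ-sum {K} (two * (ν * ν)) (λ j → S (suc (toℕ j) ℕ.* L)))) ⟩
      two * (ν * ν) * κ * λ′ * 1# + two * λ′ * Σ< K (λ j → two * (ν * ν) * S (suc j ℕ.* L))
        -- The diagonal contributes a multiple of KL; enlarging it by 1 ≤ L gives both summands the
        -- factor KL², which cancels against the lower bound.
        ≤⟨ +-mono-≤ (*-monoˡ-≤ (<⇒≤ (*-pos (*-pos (*-pos 0<two (*-pos 0<ν 0<ν)) 0<κ) 0<λ′)) (1≤fromNat L′))
             (*-monoˡ-≤ (<⇒≤ (*-pos 0<two 0<λ′)) (sum-mono-≤ {K} (λ j → small (toℕ j) (Finₚ.toℕ<n j)))) ⟩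
      two * (ν * ν) * κ * λ′ * λ′ + two * λ′ * Σ< K (λ j → (two * ν + 1#) * λ′ * fromNat (suc j))
        ≈⟨ +-congˡ (*-congˡ (*-distribˡ-sum {K} ((two * ν + 1#) * λ′) (λ j → fromNat (suc (toℕ j))))) ⟨
      two * (ν * ν) * κ * λ′ * λ′ + two * λ′ * ((two * ν + 1#) * λ′ * Σ< K (fromNat ∘ suc))
        ≈⟨ +-congˡ (solve 4 (λ t l a s → t :* l :* (a :* l :* s) := l :* l :* a :* (t :* s)) refl two λ′ _ _) ⟩
      two * (ν * ν) * κ * λ′ * λ′ + λ′ * λ′ * (two * ν + 1#) * (two * Σ< K (fromNat ∘ suc))
        ≈⟨ +-congˡ (*-congˡ (Σ<-suc K)) ⟩
      two * (ν * ν) * κ * λ′ * λ′ + λ′ * λ′ * (two * ν + 1#) * (κ * (κ + 1#))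
        ≈⟨ solve 3 (λ n k l → 2: :* (n :* n) :* k :* l :* l :+ l :* l :* (2: :* n :+ 1:) :* (k :* (k :+ 1:))
            := k :* (l :* l) :* (2: :* (n :* n) :+ (2: :* n :+ 1:) :* (k :+ 1:))) refl ν κ λ′ ⟩
      κ * (λ′ * λ′) * (two * (ν * ν) + (two * ν + 1#) * (κ + 1#)) ∎

    toeplitz-lower : (∀ x → two * x * fromNat N ≤ F + x * x * (ν - 1#)) →
      κ * (λ′ * λ′) * (two * κ * (ν + 1#)) ≤ two * (ν * ν) * F
    toeplitz-lower welch = begin
      κ * (λ′ * λ′) * (two * κ * (ν + 1#))
        ≈⟨ solve 3 (λ n k l → k :* (l :* l) :* (2: :* k :* (n :+ 1:))
            := 2: :* ((k :* l) :* (k :* l) :* (n :+ 1:))) refl ν κ λ′ ⟩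
      two * ((κ * λ′) * (κ * λ′) * (ν + 1#))
        ≤⟨ *-monoˡ-≤ (<⇒≤ 0<two) key ⟩
      two * (ν * ν * F)
        ≈⟨ *-assoc _ _ _ ⟨
      two * (ν * ν) * F ∎
      where
      0<ν² = *-pos 0<ν 0<ν
      r = recip (ν * ν) 0<ν²
      M = κ * λ′
      -- This is N(n + 1)/n², within a factor 1 - 1/n² of the optimal N / (n - 1) when n > 1, and it
      -- divides by n² only.
      x = r * (M * (ν + 1#))
      ν²x≈ : ν * ν * x ≈ M * (ν + 1#)
      ν²x≈ = trans (sym (*-assoc _ _ _)) (trans (*-congʳ (recip-inverseʳ _ _)) (*-identityˡ _))
      0≤M = <⇒≤ (*-pos 0<κ 0<λ′)
      0≤x : 0# ≤ x
      0≤x = *-nonneg (<⇒≤ (0<recip _ _)) (*-nonneg 0≤M (<⇒≤ (+-pos 0<ν 0<1)))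
      -- ν² times the Welch bound, with one factor ν² x replaced throughout.
      scaled : two * (M * (ν + 1#)) * M ≤ ν * ν * F + x * (M * (ν + 1#)) * (ν - 1#)
      scaled = begin
        two * (M * (ν + 1#)) * M          ≈⟨ *-cong (*-congˡ (sym ν²x≈)) (sym (fromNat-* K L)) ⟩
        two * (ν * ν * x) * fromNat N     ≈⟨ solve 3 (λ n x m → 2: :* (n :* n :* x) :* m
            := n :* n :* (2: :* x :* m)) refl ν x (fromNat N) ⟩
        ν * ν * (two * x * fromNat N)     ≤⟨ *-monoˡ-≤ (<⇒≤ 0<ν²) (welch x) ⟩
        ν * ν * (F + x * x * (ν - 1#))    ≈⟨ solve 3 (λ n f x → n :* n :* (f :+ x :* x :* (n :- 1:))
            := n :* n :* f :+ x :* (n :* n :* x) :* (n :- 1:)) refl ν F x ⟩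
        ν * ν * F + x * (ν * ν * x) * (ν - 1#)  ≈⟨ +-congˡ (*-congʳ (*-congˡ ν²x≈)) ⟩
        ν * ν * F + x * (M * (ν + 1#)) * (ν - 1#) ∎
      key : M * M * (ν + 1#) ≤ ν * ν * F
      -- The surplus over the claim is the nonnegative term x M, which is discarded; the last
      -- bracket is zero by `ν²x≈`.
      key = 0≤y-x⇒x≤y
        (solve 4 (λ n f x m → (n :* n :* f :+ x :* (m :* (n :+ 1:)) :* (n :- 1:) :- 2: :* (m :* (n :+ 1:)) :* m) :+ (x :* m :+ (m :* (m :* (n :+ 1:)) :- m :* (n :* n :* x)))
             := n :* n :* f :- m :* m :* (n :+ 1:)) refl ν F x M)
        (+-nonneg (x≤y⇒0≤y-x scaled) (+-nonneg (*-nonneg 0≤x 0≤M)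
          (≤-reflexive (sym (trans (+-congˡ (-‿cong (*-congˡ ν²x≈))) (-‿inverseʳ _))))))

    toeplitz-contradiction :
      (∀ x → two * x * fromNat N ≤ F + x * x * (ν - 1#)) →
      (∀ j → j ℕ.< K → two * (ν * ν) * S (suc j ℕ.* L) ≤ (two * ν + 1#) * λ′ * fromNat (suc j)) → ⊥
    toeplitz-contradiction welch small =
      *-cancelˡ-≤ (*-pos 0<κ (*-pos 0<λ′ 0<λ′)) (≤-trans (toeplitz-lower welch) (toeplitz-upper small))
        -- After cancelling KL², the lower bound minus the upper bound is K - 2n² - 2n - 1, which is
        -- exactly 1 for the chosen K.
        (0<y-x⇒x<y (trans
          (solve 2 (λ n k → 1: := (2: :* (n :* n) :+ 2: :* n :+ 2:) :- 2: :* (n :* n) :- 2: :* n :- 1:) refl ν κ)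
          (trans (+-congʳ (+-congʳ (+-congʳ (sym κ≈))))
            (solve 2 (λ n k → k :- 2: :* (n :* n) :- 2: :* n :- 1:
                := 2: :* k :* (n :+ 1:) :- (2: :* (n :* n) :+ (2: :* n :+ 1:) :* (k :+ 1:))) refl ν κ)))
          0<1)

-- From the long time average to averages over a grid.

module RiemannSums {c ℓ₁ ℓ₂} (R : RealNumbers c ℓ₁ ℓ₂) where
  open OrderedField R
  open DoubleSums ℝ-commutativeRing using (Σ<)
  open ℝ-Solver
  open ≤-Reasoning

  -- Finitely many thresholds have a maximum; this yields one mesh for all K integrals.
  eventually-all : ∀ {p} {Q : ℕ → ℕ → Set p} → (∀ j → ∃[ N ] (∀ n → N ℕ.≤ n → Q j n)) →
    ∀ K → ∃[ N ] (∀ j → j ℕ.< K → Q j N)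
  eventually-all {Q = Q} eventually K = proj₁ (go K) , λ j j<K → proj₂ (go K) j j<K _ ℕₚ.≤-refl
    where
    go : ∀ K → ∃[ N ] (∀ j → j ℕ.< K → ∀ n → N ℕ.≤ n → Q j n)
    go zero    = 0 , λ _ ()
    go (suc K) with eventually K | go K
    ... | M , Q-K | N , Q-<K = M ℕ.⊔ N , λ j j<1+K n M⊔N≤n → case (ℕₚ.m≤n⇒m<n∨m≡n (ℕₚ.≤-pred j<1+K)) n M⊔N≤n
      where
      case : ∀ {j} → j ℕ.< K ⊎ j ≡ K → ∀ n → M ℕ.⊔ N ℕ.≤ n → Q j n
      case (inj₁ j<K)    n M⊔N≤n = Q-<K _ j<K n (ℕₚ.m⊔n≤o⇒n≤o M N M⊔N≤n)
      case (inj₂ ≡.refl) n M⊔N≤n = Q-K n (ℕₚ.m⊔n≤o⇒m≤o M N M⊔N≤n)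

  -- Tagging right endpoints makes the Riemann sum run over τ, 2τ, and so on: the positive
  -- differences of grid times. Time 0 belongs to the diagonal of the Toeplitz matrix.
  uniformPartition : ∀ {T} (pieces : ℕ) (τ : Carrier) → 0# ≤ τ → fromNat pieces * τ ≈ T → TaggedPartition R 0# T
  uniformPartition pieces τ 0≤τ pieces*τ≈T = record
    { pieces    = pieces
    ; point     = λ k → fromNat (toℕ k) * τ
    ; tag       = λ k → fromNat (suc (toℕ k)) * τ
    ; start     = zeroˡ τ
    ; end       = trans (*-congʳ (reflexive (≡.cong fromNat (Finₚ.toℕ-fromℕ pieces)))) pieces*τ≈T
    ; point≤tag = λ k → *-monoʳ-≤ 0≤τ (fromNat-mono-≤ (ℕₚ.≤-trans (ℕₚ.≤-reflexive (Finₚ.toℕ-inject₁ k)) (ℕₚ.n≤1+n _)))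
    ; tag≤point = λ k → ≤-refl
    }

  uniformPartition-width : ∀ {T} pieces τ 0≤τ (p : fromNat pieces * τ ≈ T) k →
    TaggedPartition.width (uniformPartition pieces τ 0≤τ p) k ≈ τ
  uniformPartition-width pieces τ 0≤τ p k = trans
    (+-congˡ (-‿cong (*-congʳ (reflexive (≡.cong fromNat (Finₚ.toℕ-inject₁ k))))))
    (solve 2 (λ m t → (1: :+ m) :* t :- m :* t := t) refl (fromNat (toℕ k)) τ)

  riemann-upper : ∀ {f T I} → HasRealIntegral R f 0# T I → ∀ ε → 0# < ε →
    ∃[ δ ] (0# < δ × (∀ pieces τ → 0# ≤ τ → τ < δ → fromNat pieces * τ ≈ T →
      Σ< pieces (λ k → f (fromNat (suc k) * τ)) * τ < I + ε))
  riemann-upper {f} {T} {I} integral ε 0<ε = proj₁ (integral ε 0<ε) , proj₁ (proj₂ (integral ε 0<ε)) , λ pieces τ 0≤τ τ<δ pτ≈T →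
    let P = uniformPartition pieces τ 0≤τ pτ≈T
        width≈ = uniformPartition-width pieces τ 0≤τ pτ≈T
        _ , sum-I<ε = proj₂ (proj₂ (integral ε 0<ε)) P (λ k → <-respˡ-≈ (sym (width≈ k)) τ<δ)
    in begin-strict
      Σ< pieces (λ k → f (fromNat (suc k) * τ)) * τ
        ≈⟨ *-distribʳ-sum {pieces} τ (λ k → f (fromNat (suc (toℕ k)) * τ)) ⟩
      sum {pieces} (λ k → f (fromNat (suc (toℕ k)) * τ) * τ)
        ≈⟨ sum-cong-≋ {pieces} (λ k → *-congˡ (sym (width≈ k))) ⟩
      TaggedPartition.riemannSum P f
        ≈⟨ solve 2 (λ s i → s := i :+ (s :- i)) refl _ I ⟩
      I + (TaggedPartition.riemannSum P f - I)
        <⟨ +-monoʳ-< I sum-I<ε ⟩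
      I + ε ∎

  time-average-upper : ∀ {f : (T : Carrier) → 0# < T → Carrier} {l} →
    RealLimitAtInfinity R (λ T 0<T → recip T 0<T * f T 0<T) l → ∀ ε → 0# < ε →
    ∃[ T₀ ] (∀ T (0<T : 0# < T) → T₀ < T → f T 0<T < T * (l + ε))
  time-average-upper {f} {l} limit ε 0<ε = proj₁ (limit ε 0<ε) , λ T 0<T T₀<T → begin-strict
    f T 0<T                              ≈⟨ x*recip-x*y≈y T 0<T _ ⟨
    T * (recip T 0<T * f T 0<T)          ≈⟨ *-congˡ (solve 2 (λ s i → s := i :+ (s :- i)) refl _ l) ⟩
    T * (l + (recip T 0<T * f T 0<T - l))  <⟨ *-monoˡ-< 0<T (+-monoʳ-< l (proj₂ (proj₂ (limit ε 0<ε) T 0<T T₀<T))) ⟩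
    T * (l + ε)                          ∎

  recip-mesh : ∀ {T δ} → 0# < T → 0# < δ →
    ∃[ N ] (∀ n → N ℕ.≤ n → T * (1/ suc n) < δ)
  recip-mesh {T} {δ} 0<T 0<δ = N , λ n N≤n → *-cancelˡ-< (0<fromNat (suc n)) (begin-strict
    fromNat (suc n) * (T * 1/ suc n)     ≈⟨ solve 3 (λ n t r → n :* (t :* r) := n :* r :* t) refl _ T _ ⟩
    fromNat (suc n) * (1/ suc n) * T     ≈⟨ trans (*-congʳ (recip-inverseʳ _ _)) (*-identityˡ T) ⟩
    T                                    ≈⟨ x*recip-x*y≈y δ 0<δ T ⟨
    δ * (recip δ 0<δ * T)                <⟨ *-monoˡ-< 0<δ T/δ<N ⟩
    δ * fromNat N                        ≤⟨ *-monoˡ-≤ (<⇒≤ 0<δ) (fromNat-mono-≤ (ℕₚ.m≤n⇒m≤1+n N≤n)) ⟩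
    δ * fromNat (suc n)                  ≈⟨ *-comm _ _ ⟩
    fromNat (suc n) * δ                  ∎)
    where
    N = proj₁ (archimedean (recip δ 0<δ * T))
    T/δ<N = proj₂ (archimedean (recip δ 0<δ * T))

  -- Sampled with a fine enough mesh, each of K blocks of a function with long
  -- time average 1/n has average below (1 + 1/2n)/n.
  module _ (n : ℕ) .{{_ : NonZero n}} (f : Carrier → Carrier)
           (I : (T : Carrier) → 0# < T → Carrier)
           (integral : ∀ T 0<T → HasRealIntegral R f 0# T (I T 0<T))
           (limit : RealLimitAtInfinity R (λ T 0<T → recip T 0<T * I T 0<T) (1/ n)) where
    private
      ν = fromNat n
      0<ν = 0<fromNat n
      four = (1# + 1#) * (1# + 1#)
      0<4ν² : 0# < four * (ν * ν)
      0<4ν² = *-pos (*-pos (+-pos 0<1 0<1) (+-pos 0<1 0<1)) (*-pos 0<ν 0<ν)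
      -- The time average and the Riemann sum each cost at most ε relative to T, and 2ε = 1/(2n²) is
      -- the excess of (1 + 1/2n)/n over 1/n.
      ε = recip (four * (ν * ν)) 0<4ν²
      0<ε = 0<recip _ 0<4ν²

      average = time-average-upper limit ε 0<ε
      T₀ = proj₁ average

      -- The successor keeps T₁ positive whatever the sign of T₀.
      M = suc (proj₁ (archimedean T₀))
      T₁ = fromNat M
      0<T₁ = 0<fromNat M
      T₀<T₁ : T₀ < T₁
      T₀<T₁ = <-≤-trans (proj₂ (archimedean T₀)) (fromNat-mono-≤ (ℕₚ.n≤1+n (proj₁ (archimedean T₀))))

      T : ℕ → Carrier
      T j = fromNat (suc j) * T₁

      0<T : ∀ j → 0# < T j
      0<T j = *-pos {fromNat (suc j)} {T₁} (0<fromNat (suc j)) 0<T₁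

      T₁≤T : ∀ j → T₁ ≤ T j
      T₁≤T j = ≤-respˡ-≈ (*-identityˡ T₁) (*-monoʳ-≤ (<⇒≤ 0<T₁) (1≤fromNat j))

      sampleBound : ∀ j → Carrier → Set _
      sampleBound j δ = ∀ pieces τ → 0# ≤ τ → τ < δ → fromNat pieces * τ ≈ T j →
        Σ< pieces (λ k → f (fromNat (suc k) * τ)) * τ < I (T j) (0<T j) + T₁ * ε

      riemann : ∀ j → ∃[ δ ] (0# < δ × sampleBound j δ)
      riemann j = riemann-upper {f} {T j} {I (T j) (0<T j)} (integral (T j) (0<T j)) (T₁ * ε) (*-pos 0<T₁ 0<ε)

      mesh : ∀ K → ∃[ N ] (∀ j → j ℕ.< K → T₁ * (1/ suc N) < proj₁ (riemann j))
      mesh = eventually-all {Q = λ j N → T₁ * (1/ suc N) < proj₁ (riemann j)}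
        (λ j → recip-mesh 0<T₁ (proj₁ (proj₂ (riemann j))))

    fine-mesh : ∀ K → ∃[ L′ ] ∃[ τ ] (0# ≤ τ × (∀ j → j ℕ.< K →
      (1# + 1#) * (ν * ν) * Σ< (suc j ℕ.* suc L′) (λ k → f (fromNat (suc k) * τ)) ≤
      ((1# + 1#) * ν + 1#) * fromNat (suc L′) * fromNat (suc j)))
    -- Multiplying by 2τ turns the plain sum of samples into a Riemann sum and clears the
    -- denominators.
    fine-mesh K = L′ , τ , <⇒≤ 0<τ , λ j j<K → *-cancelˡ-≤ (*-pos (+-pos 0<1 0<1) 0<τ) (<⇒≤ (small j j<K))
      where
      L′ = proj₁ (mesh K)
      τ = T₁ * (1/ suc L′)
      0<τ : 0# < τ
      0<τ = *-pos 0<T₁ (0<recip _ _)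
      Lτ≈T₁ : fromNat (suc L′) * τ ≈ T₁
      Lτ≈T₁ = trans (solve 3 (λ n t r → n :* (t :* r) := n :* r :* t) refl _ T₁ _)
        (trans (*-congʳ (recip-inverseʳ _ _)) (*-identityˡ T₁))
      small : ∀ j → j ℕ.< K → (1# + 1#) * τ * ((1# + 1#) * (ν * ν) * Σ< (suc j ℕ.* suc L′) (λ k → f (fromNat (suc k) * τ))) <
                (1# + 1#) * τ * (((1# + 1#) * ν + 1#) * fromNat (suc L′) * fromNat (suc j))
      small j j<K = begin-strict
        (1# + 1#) * τ * ((1# + 1#) * (ν * ν) * s)
          ≈⟨ solve 3 (λ t n s → 2: :* t :* (2: :* (n :* n) :* s) := 2: :* 2: :* (n :* n) :* (s :* t)) refl τ ν s ⟩
        four * (ν * ν) * (s * τ)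
          <⟨ *-monoˡ-< 0<4ν² (proj₂ (proj₂ (riemann j)) (suc j ℕ.* suc L′) τ (<⇒≤ 0<τ) (proj₂ (mesh K) j j<K)
               (trans (*-congʳ (fromNat-* (suc j) (suc L′))) (trans (*-assoc _ _ _) (*-congˡ Lτ≈T₁)))) ⟩
        four * (ν * ν) * (I (T j) (0<T j) + T₁ * ε)
          <⟨ *-monoˡ-< 0<4ν² (+-monoˡ-< _ (proj₂ average (T j) (0<T j) (<-≤-trans T₀<T₁ (T₁≤T j)))) ⟩
        four * (ν * ν) * (T j * ((1/ n) + ε) + T₁ * ε)
          ≤⟨ *-monoˡ-≤ (<⇒≤ 0<4ν²) (+-monoʳ-≤ _ (*-monoʳ-≤ (<⇒≤ 0<ε) (T₁≤T j))) ⟩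
        four * (ν * ν) * (T j * ((1/ n) + ε) + T j * ε)
          ≈⟨ solve 4 (λ n t r e → 2: :* 2: :* (n :* n) :* (t :* (r :+ e) :+ t :* e)
               := t :* (2: :* 2: :* n :* (n :* r) :+ 2: :* (2: :* 2: :* (n :* n) :* e))) refl ν (T j) (1/ n) ε ⟩
        T j * (four * ν * (ν * (1/ n)) + (1# + 1#) * (four * (ν * ν) * ε))
          ≈⟨ *-congˡ (+-cong (*-congˡ (recip-inverseʳ _ _)) (*-congˡ (recip-inverseʳ _ _))) ⟩
        fromNat (suc j) * T₁ * (four * ν * 1# + (1# + 1#) * 1#)
          ≈⟨ *-congʳ (*-congˡ (sym Lτ≈T₁)) ⟩
        fromNat (suc j) * (fromNat (suc L′) * τ) * (four * ν * 1# + (1# + 1#) * 1#)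
          ≈⟨ solve 4 (λ j l t n → j :* (l :* t) :* (2: :* 2: :* n :* 1: :+ 2: :* 1:)
              := 2: :* t :* ((2: :* n :+ 1:) :* l :* j)) refl
               (fromNat (suc j)) (fromNat (suc L′)) τ ν ⟩
        (1# + 1#) * τ * (((1# + 1#) * ν + 1#) * fromNat (suc L′) * fromNat (suc j)) ∎
        where
        s = Σ< (suc j ℕ.* suc L′) (λ k → f (fromNat (suc k) * τ))

-- Uniform mixing forces the columns aᵏe to have no annihilator.

module UniformMixing {c ℓ₁ ℓ₂} (R : RealNumbers c ℓ₁ ℓ₂) {n : ℕ} .{{_ : NonZero n}}
  (a : Fin n → Fin n → RealNumbers.Carrier R) (A : Matrix R n) where
  open OrderedField R
  open ComplexNumbers R
  open ℝ-Solver

  module _ (A≈a : ∀ i j → A i j C.≈ real R (a i j)) (a-sym : ∀ i j → a i j ≈ a j i)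
           (0≤a : ∀ i j → 0# ≤ a i j) (a≤1 : ∀ i j → a i j ≤ 1#)
           (uniform : HasAverageUniformMixing R A) (e : Fin n) where
    open Walk R a e using (powerColumn)

    private
      U = proj₁ (proj₁ (proj₂ uniform))
      isU = proj₁ (proj₂ (proj₁ (proj₂ uniform)))
      longTimeAverage = proj₂ (proj₂ (proj₁ (proj₂ uniform))) e e

      f : Carrier → Carrier
      f t = re (mixingMatrix R U t e e)

      I : (T : Carrier) → 0# < T → Carrier
      I T 0<T = re (proj₁ longTimeAverage T 0<T)

      limit : RealLimitAtInfinity R (λ T 0<T → recip T 0<T * I T 0<T) (1/ n)
      limit ε 0<ε = proj₁ average , λ T 0<T T₀<T → Limits.∣∣<-cong R
        (+-cong (solve 3 (λ r x y → r :* x :- 0: :* y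
            := r :* x) refl (recip T 0<T) (I T 0<T) (im (proj₁ longTimeAverage T 0<T)))
          (-‿cong (trans (proj₁ (proj₂ (proj₂ uniform) e e)) (solve 1 (λ x → x :* 1: :- 0: :* 0: := x) refl (1/ n)))))
        (proj₂ average T 0<T T₀<T)
        where
        average = proj₁ (proj₂ (proj₂ longTimeAverage)) ε 0<ε

    no-annihilator : ∀ (v : Fin n → Carrier) → (∀ k → sum (λ h → v h * powerColumn k h) ≈ 0#) →
      ¬ (0# < sum (λ h → v h * v h))
    no-annihilator v v⊥p 0<∣v∣² = ToeplitzSums.toeplitz-contradiction R n L′ returnProbability returnProbability-zero
      (λ k → ‖‖²-nonneg (ψ k e)) (gram-bound v v⊥p 0<∣v∣² (ToeplitzSums.blockCount R n ℕ.* suc L′))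
      (λ j j<K → ≤-respˡ-≈ (*-congˡ (sum-cong-≋ {suc j ℕ.* suc L′} (λ k →
        solve 2 (λ x y → x :* x :- y :* :- y := x :* x :+ y :* y) refl (re (ψ (suc (toℕ k)) e)) (im (ψ (suc (toℕ k)) e)))))
        (proj₂ (proj₂ (proj₂ mesh)) j j<K))
      where
      -- The block count depends on n alone, so it is available before the block length and the time
      -- step are chosen.
      mesh = RiemannSums.fine-mesh R n f I (λ T 0<T → proj₁ (proj₁ (proj₂ longTimeAverage) T 0<T)) limit (ToeplitzSums.blockCount R n)
      L′ = proj₁ mesh
      τ = proj₁ (proj₂ mesh)
      open Evolution.Grid R a e A U isU A≈a a-sym 0≤a a≤1 τ (proj₁ (proj₂ (proj₂ mesh)))

    -- By tightness it suffices to refute that some entry is apart from zero; such an entry would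
    -- make |v|² positive.
    annihilator-zero : ∀ (v : Fin n → Carrier) → (∀ k → sum (λ h → v h * powerColumn k h) ≈ 0#) → ∀ h → v h ≈ 0#
    annihilator-zero v v⊥p h = proj₁ (tight (v h) 0#) λ vh#0 →
      no-annihilator v v⊥p (<-≤-trans (#0⇒0<x² vh#0) (term≤sum (λ i → x²-nonneg (v i)) h))
      where
      term≤sum : ∀ {m} {g : Fin m → Carrier} → (∀ i → 0# ≤ g i) → ∀ i → g i ≤ sum g
      term≤sum 0≤g Fin.zero    = ≤-respˡ-≈ (+-identityʳ _) (+-monoʳ-≤ _ (sum-nonneg (0≤g ∘ Fin.suc)))
      term≤sum 0≤g (Fin.suc i) = ≤-trans (term≤sum (0≤g ∘ Fin.suc) i)
        (≤-respˡ-≈ (+-identityˡ _) (+-monoˡ-≤ _ (0≤g Fin.zero)))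

-- Cayley graphs, convolution and class functions.

module CayleyGraph {c ℓ₁ ℓ₂ g ℓ} (R : RealNumbers c ℓ₁ ℓ₂) (𝔾 : FiniteGroup g ℓ)
  (S : Subset (FiniteGroup.order 𝔾)) (S-inverse : FiniteGroup.InverseClosed 𝔾 S) where
  open OrderedField R
  open ComplexNumbers R
  open DeltaSums ℝ-commutativeRing
  open Algebra.Properties.Semiring.Sum semiring using (sum-permute)
  module G = FiniteGroup 𝔾
  open G using (_∙_; ε; _⁻¹; _//_; _\\_; order; element; index)
  open Algebra.Properties.Group G.group using
    (//-cong₂; ⁻¹-anti-homo-//; ⁻¹-anti-homo-∙; ⁻¹-involutive; ε⁻¹≈ε; //-rightDividesˡ; //-rightDividesʳ; \\-leftDividesˡ; \\-leftDividesʳ)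
  open import Relation.Binary.Reasoning.Setoid (CommutativeRing.setoid ℝ-commutativeRing)

  index-cong : ∀ {x y} → x G.≈ y → index x ≡ index y
  index-cong = Inverse.from-cong G.enumeration

  element-index : ∀ x → element (index x) G.≈ x
  element-index = Inverse.strictlyInverseˡ G.enumeration

  index-element : ∀ i → index (element i) ≡ i
  index-element = Inverse.strictlyInverseʳ G.enumeration

  index-injective : ∀ {x y} → index x ≡ index y → x G.≈ y
  index-injective {x} {y} eq = G.trans (G.sym (element-index x))
    (G.trans (G.reflexive (≡.cong element eq)) (element-index y))

  χ : G.Carrier → Carrier
  χ x = if lookup S (index x) then 1# else 0#

  χ-cong : ∀ {x y} → x G.≈ y → χ x ≈ χ y
  χ-cong x≈y = reflexive (≡.cong (λ i → if lookup S i then 1# else 0#) (index-cong x≈y))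

  χ-⁻¹ : ∀ x → χ (x ⁻¹) ≈ χ x
  χ-⁻¹ x with lookup S (index x) in x∈S | lookup S (index (x ⁻¹)) in x⁻¹∈S
  ... | true  | true  = refl
  ... | false | false = refl
  ... | true  | false = contradiction
    (≡.trans (≡.sym x⁻¹∈S) ([]=⇒lookup (S-inverse x (lookup⇒[]= _ S x∈S)))) λ ()
  ... | false | true  = contradiction
    (≡.trans (≡.sym x∈S) (≡.trans (≡.cong (lookup S) (index-cong (G.sym (⁻¹-involutive x))))
      ([]=⇒lookup (S-inverse (x ⁻¹) (lookup⇒[]= _ S x⁻¹∈S))))) λ ()

  adjacency : Fin order → Fin order → Carrier
  adjacency i j = χ (element i ∙ element j ⁻¹)

  χ-bounds : ∀ x → 0# ≤ χ x × χ x ≤ 1#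
  χ-bounds x with lookup S (index x)
  ... | true  = <⇒≤ 0<1 , ≤-refl
  ... | false = ≤-refl , <⇒≤ 0<1

  adjacency-sym : ∀ i j → adjacency i j ≈ adjacency j i
  adjacency-sym i j = trans (sym (χ-⁻¹ _)) (χ-cong (⁻¹-anti-homo-// (element i) (element j)))

  -- Exactly one group element carries vertex j to vertex i, namely the quotient of the two, so the
  -- sum over the group collapses to one indicator value.
  cayleyAdjacency≈ : ∀ i j → cayleyAdjacency R 𝔾 S i j C.≈ real R (adjacency i j)
  cayleyAdjacency≈ i j = C.trans (sumᴹ-entry (λ k → if lookup S k then leftRegular R 𝔾 (element k) else Mat.0ᴹ R) i j)
    (C.trans (C.sum-cong-≋ term) (DeltaSums.sum-δ ℂ-commutativeRing (λ k → real R (if lookup S k then 1# else 0#)) k₀))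
    where
    k₀ = index (element i ∙ element j ⁻¹)

    to : ∀ {k} → i ≡ index (element k ∙ element j) → k ≡ k₀
    to {k} i≡kj = ≡.trans (≡.sym (index-element k)) (index-cong (G.trans
      (G.sym (//-rightDividesʳ (element j) (element k)))
      (G.∙-congʳ (G.trans (G.sym (element-index _)) (G.reflexive (≡.cong element (≡.sym i≡kj)))))))

    from : ∀ {k} → k ≡ k₀ → i ≡ index (element k ∙ element j)
    from {k} ≡.refl = ≡.trans (≡.sym (index-element i)) (index-cong (G.trans
      (G.sym (//-rightDividesˡ (element j) (element i)))
      (G.∙-congʳ (G.sym (element-index _)))))

    term : ∀ k → (if lookup S k then leftRegular R 𝔾 (element k) else Mat.0ᴹ R) i j C.≈
                 DeltaSums.δ ℂ-commutativeRing k k₀ C.* real R (if lookup S k then 1# else 0#)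
    term k with lookup S k
    ... | false = C.sym (C.zeroʳ (DeltaSums.δ ℂ-commutativeRing k k₀))
    ... | true  with i ≟ᶠ index (element k ∙ element j) | k ≟ᶠ k₀
    ...   | yes _    | yes _    = C.sym (C.*-identityˡ C.1#)
    ...   | no  _    | no  _    = C.sym (C.zeroˡ C.1#)
    ...   | yes i≡kj | no  k≢k₀ = contradiction (to i≡kj) k≢k₀
    ...   | no  i≢kj | yes k≡k₀ = contradiction (from k≡k₀) i≢kj

  e : Fin order
  e = index ε

  open Walk R adjacency e using (powerColumn)

  p : ℕ → G.Carrier → Carrier
  p k x = powerColumn k (index x)

  p-cong : ∀ k {x y} → x G.≈ y → p k x ≈ p k y
  p-cong k x≈y = reflexive (≡.cong (powerColumn k) (index-cong x≈y))

  ∑ᴳ : (G.Carrier → Carrier) → Carrier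
  ∑ᴳ f = sum (f ∘ element)

  ∑ᴳ-cong : ∀ {f h} → (∀ x → f x ≈ h x) → ∑ᴳ f ≈ ∑ᴳ h
  ∑ᴳ-cong f≈h = sum-cong-≋ (f≈h ∘ element)

  ∑ᴳ-reindex : ∀ {f : G.Carrier → Carrier} (φ φ⁻¹ : G.Carrier → G.Carrier) →
    (∀ {x y} → x G.≈ y → f x ≈ f y) →
    (∀ {x y} → x G.≈ y → φ x G.≈ φ y) → (∀ {x y} → x G.≈ y → φ⁻¹ x G.≈ φ⁻¹ y) →
    (∀ x → φ (φ⁻¹ x) G.≈ x) → (∀ x → φ⁻¹ (φ x) G.≈ x) →
    ∑ᴳ f ≈ ∑ᴳ (f ∘ φ)
  ∑ᴳ-reindex {f} φ φ⁻¹ f-cong φ-cong φ⁻¹-cong φφ⁻¹ φ⁻¹φ =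
    trans (sum-permute (f ∘ element) π) (sum-cong-≋ (λ i → f-cong (element-index (φ (element i)))))
    where
    π : Permutation order order
    π = permutation (λ i → index (φ (element i))) (λ i → index (φ⁻¹ (element i)))
      (λ i → ≡.trans (index-cong (G.trans (φ-cong (element-index _)) (φφ⁻¹ _))) (index-element i))
      (λ i → ≡.trans (index-cong (G.trans (φ⁻¹-cong (element-index _)) (φ⁻¹φ _))) (index-element i))

  p-suc : ∀ k x → p (suc k) x ≈ ∑ᴳ (λ y → χ (x ∙ y ⁻¹) * p k y)
  p-suc k x = sum-cong-≋ (λ j → *-cong (χ-cong (G.∙-congʳ (element-index x)))
    (reflexive (≡.cong (powerColumn k) (≡.sym (index-element j)))))

  δ-at : ∀ {f : G.Carrier → Carrier} → (∀ {x y} → x G.≈ y → f x ≈ f y) → ∀ x →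
    ∑ᴳ (λ y → δ (index y) (index x) * f y) ≈ f x
  δ-at {f} f-cong x = trans
    (sum-cong-≋ (λ i → *-congʳ (reflexive (≡.cong (λ j → δ j (index x)) (index-element i)))))
    (trans (sum-δ (f ∘ element) (index x)) (f-cong (element-index x)))

  x//ε≈x : ∀ x → x // ε G.≈ x
  x//ε≈x x = G.trans (G.∙-congˡ ε⁻¹≈ε) (G.identityʳ x)

  -- In the group algebra `p k` is the k-th convolution power of `χ`. Multiplication by `χ` on the
  -- left defines the next power; associativity of convolution moves it to the right.
  p-step-right : ∀ k x → p (suc k) x ≈ ∑ᴳ (λ h → p k h * χ (h ⁻¹ ∙ x))
  p-step-right zero x = begin
    p 1 x                                  ≈⟨ p-suc 0 x ⟩
    ∑ᴳ (λ y → χ (x // y) * p 0 y)          ≈⟨ ∑ᴳ-cong (λ y → *-comm (χ (x // y)) (p 0 y)) ⟩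
    ∑ᴳ (λ y → p 0 y * χ (x // y))          ≈⟨ δ-at (λ y≈z → χ-cong (//-cong₂ G.refl y≈z)) ε ⟩
    χ (x // ε)                             ≈⟨ χ-cong (G.trans (x//ε≈x x) (G.sym (G.trans (G.∙-congʳ ε⁻¹≈ε) (G.identityˡ x)))) ⟩
    χ (ε ⁻¹ ∙ x)                           ≈⟨ δ-at (λ y≈z → χ-cong (G.∙-congʳ (G.⁻¹-cong y≈z))) ε ⟨
    ∑ᴳ (λ h → p 0 h * χ (h ⁻¹ ∙ x))        ∎
  p-step-right (suc k) x = begin
    p (suc (suc k)) x
      ≈⟨ p-suc (suc k) x ⟩
    ∑ᴳ (λ z → χ (x // z) * p (suc k) z)
      ≈⟨ ∑ᴳ-cong (λ z → trans (*-congˡ (p-step-right k z)) (*-distribˡ-sum (χ (x // z))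
          (λ j → p k (element j) * χ (element j ⁻¹ ∙ z)))) ⟩
    ∑ᴳ (λ z → ∑ᴳ (λ y → χ (x // z) * (p k y * χ (y ⁻¹ ∙ z))))
      ≈⟨ ∑-comm (λ i j → χ (x // element i) * (p k (element j) * χ (element j ⁻¹ ∙ element i))) ⟩
    ∑ᴳ (λ y → ∑ᴳ (λ z → χ (x // z) * (p k y * χ (y ⁻¹ ∙ z))))
      ≈⟨ ∑ᴳ-cong reindex ⟩
    ∑ᴳ (λ y → ∑ᴳ (λ h → χ (h // y) * p k y * χ (h ⁻¹ ∙ x)))
      ≈⟨ ∑-comm (λ j i → χ (element i // element j) * p k (element j) * χ (element i ⁻¹ ∙ x)) ⟩
    ∑ᴳ (λ h → ∑ᴳ (λ y → χ (h // y) * p k y * χ (h ⁻¹ ∙ x)))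
      ≈⟨ ∑ᴳ-cong (λ h → trans (sym (*-distribʳ-sum (χ (h ⁻¹ ∙ x))
          (λ j → χ (h // element j) * p k (element j)))) (*-congʳ (sym (p-suc k h)))) ⟩
    ∑ᴳ (λ h → p (suc k) h * χ (h ⁻¹ ∙ x)) ∎
    where
    inverse : ∀ u w h → (u // ((w // h) ∙ u)) ∙ w G.≈ h
    inverse u w h = G.trans
      (G.∙-congʳ (G.trans (G.∙-congˡ (G.trans (⁻¹-anti-homo-∙ (w // h) u) (G.∙-congˡ (⁻¹-anti-homo-// w h)))) (\\-leftDividesˡ u (h // w))))
      (//-rightDividesˡ w h)

    inverse-\\ : ∀ y z → ((x // z) ∙ y) ⁻¹ ∙ x G.≈ y ⁻¹ ∙ z
    inverse-\\ y z = G.trans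
      (G.∙-congʳ (G.trans (⁻¹-anti-homo-∙ (x // z) y) (G.∙-congˡ (⁻¹-anti-homo-// x z))))
      (G.trans (G.assoc (y ⁻¹) (z // x) x) (G.∙-congˡ (//-rightDividesˡ x z)))

    reindex : ∀ y → ∑ᴳ (λ z → χ (x // z) * (p k y * χ (y ⁻¹ ∙ z))) ≈ ∑ᴳ (λ h → χ (h // y) * p k y * χ (h ⁻¹ ∙ x))
    -- The substitution h = xz⁻¹y gives hy⁻¹ = xz⁻¹ and h⁻¹x = y⁻¹z. Its inverse z = yh⁻¹x has the
    -- same shape with x and y exchanged, so one lemma proves both inverse laws.
    reindex y = sym (trans
      (∑ᴳ-reindex {λ h → χ (h // y) * p k y * χ (h ⁻¹ ∙ x)} (λ z → (x // z) ∙ y) (λ h → (y // h) ∙ x)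
        (λ h≈h′ → *-cong (*-congʳ (χ-cong (//-cong₂ h≈h′ G.refl))) (χ-cong (G.∙-congʳ (G.⁻¹-cong h≈h′))))
        (λ z≈z′ → G.∙-congʳ (//-cong₂ G.refl z≈z′)) (λ z≈z′ → G.∙-congʳ (//-cong₂ G.refl z≈z′))
        (inverse x y) (inverse y x))
      (∑ᴳ-cong {λ z → χ (((x // z) ∙ y) // y) * p k y * χ (((x // z) ∙ y) ⁻¹ ∙ x)} {λ z → χ (x // z) * (p k y * χ (y ⁻¹ ∙ z))} (λ z → trans
        (*-cong (*-congʳ (χ-cong (//-rightDividesʳ y (x // z)))) (χ-cong (inverse-\\ y z)))
        (*-assoc (χ (x // z)) (p k y) (χ (y ⁻¹ ∙ z))))))

  module _ (annihilator-zero : ∀ (v : Fin order → Carrier) →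
              (∀ k → sum (λ h → v h * powerColumn k h) ≈ 0#) → ∀ h → v h ≈ 0#) where

    annihilatorᴳ-zero : ∀ (f : G.Carrier → Carrier) → (∀ {x y} → x G.≈ y → f x ≈ f y) →
      (∀ k → ∑ᴳ (λ h → f h * p k h) ≈ 0#) → ∀ x → f x ≈ 0#
    annihilatorᴳ-zero f f-cong f⊥p x = trans (f-cong (G.sym (element-index x)))
      (annihilator-zero (f ∘ element) (λ k → trans
        (sum-cong-≋ (λ j → *-congˡ (reflexive (≡.cong (powerColumn k) (≡.sym (index-element j)))))) (f⊥p k)) (index x))

    ∑ᴳ-difference : ∀ (u w : G.Carrier → Carrier) k →
      ∑ᴳ (λ h → (u h - w h) * p k h) ≈ ∑ᴳ (λ h → u h * p k h) - ∑ᴳ (λ h → w h * p k h)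
    ∑ᴳ-difference u w k = trans
      (∑ᴳ-cong (λ h → solve 3 (λ u w p → (u :- w) :* p := u :* p :+ :- 1: :* (w :* p)) refl (u h) (w h) (p k h)))
      (trans (∑-distrib-+ (λ j → u (element j) * p k (element j)) (λ j → - 1# * (w (element j) * p k (element j))))
      (+-congˡ (trans (sym (*-distribˡ-sum (- 1#) (λ j → w (element j) * p k (element j)))) (solve 1 (λ x → :- 1: :* x
          := :- x) refl _))))
      where open ℝ-Solver

    zero-difference : ∀ {x y} → x - y ≈ 0# → x ≈ y
    zero-difference {x} {y} x-y≈0 = trans (solve 2 (λ x y → x := x :- y :+ y) refl x y) (trans (+-congʳ x-y≈0) (+-identityˡ y))
      where open ℝ-Solver

    χ-class : ∀ x y → χ (x // y) ≈ χ (y ⁻¹ ∙ x)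
    χ-class x y = zero-difference (annihilatorᴳ-zero (λ h → χ (x // h) - χ (h ⁻¹ ∙ x))
      (λ h≈h′ → +-cong (χ-cong (//-cong₂ G.refl h≈h′)) (-‿cong (χ-cong (G.∙-congʳ (G.⁻¹-cong h≈h′)))))
      (λ k → begin
        ∑ᴳ (λ h → (χ (x // h) - χ (h ⁻¹ ∙ x)) * p k h)                   ≈⟨ ∑ᴳ-difference (λ h → χ (x // h))
            (λ h → χ (h ⁻¹ ∙ x)) k ⟩
        ∑ᴳ (λ h → χ (x // h) * p k h) - ∑ᴳ (λ h → χ (h ⁻¹ ∙ x) * p k h)  ≈⟨ +-cong (p-suc k x) (-‿cong
            (trans (p-step-right k x) (∑ᴳ-cong (λ h → *-comm (p k h) (χ (h ⁻¹ ∙ x)))))) ⟨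
        p (suc k) x - p (suc k) x                                        ≈⟨ -‿inverseʳ _ ⟩
        0#                                                               ∎)
      y)

    conjugate : G.Carrier → G.Carrier → G.Carrier
    conjugate g x = (g ∙ x) // g

    conjugate-inverseʳ : ∀ g x → conjugate g (g \\ (x ∙ g)) G.≈ x
    conjugate-inverseʳ g x = G.trans (G.∙-congʳ (\\-leftDividesˡ g (x ∙ g))) (//-rightDividesʳ g x)

    conjugate-inverseˡ : ∀ g x → g \\ (conjugate g x ∙ g) G.≈ x
    conjugate-inverseˡ g x = G.trans (G.∙-congˡ (//-rightDividesˡ g (g ∙ x))) (\\-leftDividesʳ g x)

    -- The inner factors g and g⁻¹ cancel at once, leaving (gx)(gy)⁻¹. The remaining ones meet only
    -- after `χ-class` turns this into (gy)⁻¹(gx).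
    χ-conjugate : ∀ g x y → χ (conjugate g x // conjugate g y) ≈ χ (x // y)
    χ-conjugate g x y = begin
      χ (conjugate g x // conjugate g y)
        ≈⟨ χ-cong (G.trans (G.∙-congˡ (⁻¹-anti-homo-// (g ∙ y) g)) (G.trans (G.sym (G.assoc _ g _)) (G.∙-congʳ (//-rightDividesˡ g (g ∙ x))))) ⟩
      χ ((g ∙ x) // (g ∙ y))
        ≈⟨ χ-class (g ∙ x) (g ∙ y) ⟩
      χ ((g ∙ y) ⁻¹ ∙ (g ∙ x))
        ≈⟨ χ-cong (G.trans (G.∙-congʳ (⁻¹-anti-homo-∙ g y)) (G.trans (G.assoc (y ⁻¹) (g ⁻¹) (g ∙ x)) (G.∙-congˡ (\\-leftDividesʳ g x)))) ⟩
      χ (y ⁻¹ ∙ x)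
        ≈⟨ χ-class x y ⟨
      χ (x // y) ∎

    -- Conjugation permutes the summation variable of the convolution and preserves its kernel, so
    -- invariance is inherited from `p k`; at k = 0 the identity is fixed by conjugation.
    p-conjugate : ∀ k g x → p k (conjugate g x) ≈ p k x
    p-conjugate zero g x with index (conjugate g x) ≟ᶠ e | index x ≟ᶠ e
    ... | yes _   | yes _   = refl
    ... | no  _   | no  _   = refl
    ... | yes gxg≡e | no x≢e = contradiction (index-cong (G.trans (G.sym (conjugate-inverseˡ g x))
      (G.trans (G.∙-congˡ (G.trans (G.∙-congʳ (index-injective gxg≡e)) (G.identityˡ g))) (G.inverseˡ g)))) x≢e
    ... | no gxg≢e | yes x≡e = contradiction (index-cong (G.trans
      (G.∙-congʳ (G.trans (G.∙-congˡ (index-injective x≡e)) (G.identityʳ g))) (G.inverseʳ g))) gxg≢e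
    p-conjugate (suc k) g x = begin
      p (suc k) (conjugate g x)
        ≈⟨ p-suc k (conjugate g x) ⟩
      ∑ᴳ (λ y → χ (conjugate g x // y) * p k y)
        ≈⟨ ∑ᴳ-reindex {λ y → χ (conjugate g x // y) * p k y} (conjugate g) (λ y → g \\ (y ∙ g))
             (λ y≈z → *-cong (χ-cong (//-cong₂ G.refl y≈z)) (p-cong k y≈z))
             (λ y≈z → G.∙-congʳ (G.∙-congˡ y≈z)) (λ y≈z → G.∙-congˡ (G.∙-congʳ y≈z))
             (conjugate-inverseʳ g) (conjugate-inverseˡ g) ⟩
      ∑ᴳ (λ y → χ (conjugate g x // conjugate g y) * p k (conjugate g y))
        ≈⟨ ∑ᴳ-cong (λ y → *-cong (χ-conjugate g x y) (p-conjugate k g y)) ⟩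
      ∑ᴳ (λ y → χ (x // y) * p k y)
        ≈⟨ p-suc k x ⟨
      p (suc k) x ∎

    p-comm : ∀ k x y → p k (x ∙ y) ≈ p k (y ∙ x)
    p-comm k x y = trans
      (p-cong k (G.sym (G.trans (G.∙-congʳ (G.sym (G.assoc x y x))) (//-rightDividesʳ x (x ∙ y)))))
      (p-conjugate k x (y ∙ x))

    commutative : ∀ x y → x ∙ y G.≈ y ∙ x
    commutative x y with index (x ∙ y) ≟ᶠ index (y ∙ x) in eq
    ... | yes xy≡yx = index-injective xy≡yx
    ... | no  _     = contradiction 0<1 (<-irrefl (sym (trans (sym (+-identityʳ 1#)) (trans (sym δ-values) δ-difference))))
      where
      δ-difference : δ (index (x ∙ y)) (index (x ∙ y)) - δ (index (x ∙ y)) (index (y ∙ x)) ≈ 0#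
      -- The inner product of this function with `p k` is the difference of `p k` at the two
      -- products, zero by `p-comm`. Evaluating the function itself at xy then gives 1 = 0.
      δ-difference = annihilatorᴳ-zero (λ h → δ (index h) (index (x ∙ y)) - δ (index h) (index (y ∙ x)))
        (λ h≈h′ → reflexive (≡.cong (λ i → δ i (index (x ∙ y)) - δ i (index (y ∙ x))) (index-cong h≈h′)))
        (λ k → trans (∑ᴳ-difference (λ h → δ (index h) (index (x ∙ y))) (λ h → δ (index h) (index (y ∙ x))) k)
          (trans (+-cong (δ-at (p-cong k) (x ∙ y)) (-‿cong (trans (δ-at (p-cong k) (y ∙ x)) (sym (p-comm k x y)))))
            (-‿inverseʳ _)))
        (x ∙ y)
      δ-values : δ (index (x ∙ y)) (index (x ∙ y)) - δ (index (x ∙ y)) (index (y ∙ x)) ≈ 1# + 0#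
      -- The recorded decision is negative, so the second delta reduces to 0.
      δ-values rewrite eq = +-cong (δ-refl (index (x ∙ y))) -0#≈0#

corollary8 : ∀ {c ℓ₁ ℓ₂ g ℓ} (ℝ : RealNumbers c ℓ₁ ℓ₂) (G : FiniteGroup g ℓ) →
    FiniteGroup.Nonabelian G →
    (S : Subset (FiniteGroup.order G)) →
    FiniteGroup.InverseClosed G S →
    FiniteGroup._∉ᴳ_ G (FiniteGroup.ε G) S →
    ¬ HasAverageUniformMixing ℝ {{FiniteGroup.order-nonZero G}} (cayleyAdjacency ℝ G S)
corollary8 ℝ G nonabelian S S-inverse _ uniform =
  nonabelian (commutative (annihilator-zero cayleyAdjacency≈ adjacency-sym
    (λ i j → proj₁ (χ-bounds _)) (λ i j → proj₂ (χ-bounds _)) uniform e))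
  where
  open CayleyGraph ℝ G S S-inverse
  open UniformMixing ℝ {{FiniteGroup.order-nonZero G}} adjacency (cayleyAdjacency ℝ G S)
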